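{- Assume that for every prime $p$ and every squarefree $n \in \mathbb{N}$, the Dedekind zeta functions of the fields $\mathbb{Q}(\sqrt[n]{1}, \sqrt[n]{p})$ and $\mathbb{Q}(\sqrt[4n]{1}, \sqrt[4n]{p})$ satisfy the generalized Riemann hypothesis. Then for every prime $p$ the set \[ E(p) = \{ q \text{ prime} \mid X^q - 1 \text{ is reducible in } \mathbb{F}_p[X;M] \} \] is infinite. In particular, the monoid $M = \langle 2,3\rangle$ is not a Matsuda monoid of any positive type (that is, for no prime $p$ is $M$ a Matsuda monoid of type $p$).
   Context: $M = \langle 2,3\rangle = \mathbb{N}_0 \setminus \{1\}$ is the additive submonoid of $\mathbb{N}_0$ generated by $2$ and $3$. For a field $F$ and a commutative additive monoid $\Gamma$, $F[X;\Gamma]$ is the monoid ring of polynomials in $X$ with coefficients in $F$ and exponents in $\Gamma$. $F[X;M]$ is identified with the subring of $F[X]$ consisting of the polynomials whose coefficient of $X^1$ is zero. An element is called reducible if it is not a unit and not irreducible. $\Gamma$ is torsion-free if $n\alpha = n\beta$ with $n \in \mathbb{N}$, $\alpha,\beta\in\Gamma$ implies $\alpha=\beta$, and cancellative if $\alpha+\beta=\alpha+\gamma$ implies $\beta=\gamma$. An element $\pi \in \Gamma$ is indivisible if $nx = \pi$ with $n \in \mathbb{N}$ (positive) and $x \in \Gamma$ implies $n=1$ and $x = \pi$. A commutative, torsion-free, cancellative monoid $\Gamma$ is a Matsuda monoid of type $p$ (where $p \ge 0$ is a possible characteristic of a field) if for every field $F$ of characteristic $p$ and every indivisible $\pi \in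 \Gamma$, the element $X^{\pi} - 1$ is irreducible in $F[X;\Gamma]$. $\mathbb{Q}(\sqrt[m]{1},\sqrt[m]{p})$ is the field generated over $\mathbb{Q}$ by all $m$th roots of unity and all $m$th roots of $p$. -}

module Defs where

open import Level using (0ℓ) renaming (suc to lsuc)
open import Algebra.Bundles using (RawSemiring; CommutativeRing; CommutativeMonoid)
open import Algebra.Apartness.Bundles using (HeytingField; HeytingCommutativeRing)
import Algebra.Definitions as AlgDefs
import Algebra.Definitions.RawMonoid as Multiples
import Algebra.Definitions.RawSemiring as Divisibility
import Algebra.Properties.CommutativeSemigroup as CommutativeSemigroupProperties
open import Data.Empty using (⊥-elim)
open import Data.Fin.Base using (Fin)
open import Data.Integer.Base as ℤ using (ℤ; +_; -[1+_])
import Data.Integer.Properties as ℤP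
import Data.Integer.Divisibility.Signed as ℤ∣
import Data.Integer.Solver as ℤS
open import Data.List.Base using (List; []; _∷_; _++_; foldr; cartesianProductWith)
open import Data.Nat.Base as ℕ using (ℕ; zero; suc)
import Data.Nat.Properties as ℕP
import Data.Nat.Divisibility as ℕ∣
import Data.Nat.Coprimality as ℕC
open import Data.Nat.GCD using (module Bézout)
open import Data.Nat.Primality as Primality using (Prime)
open import Data.Product.Base using (Σ; ∃; ∃₂; _×_; _,_; proj₁; proj₂)
open import Data.Rational.Base as ℚ using (ℚ; 0ℚ; 1ℚ; ½)
import Data.Rational.Properties as ℚP
open import Data.Sum.Base using (inj₁; inj₂)
open import Function.Bundles using (_⇔_)
open import Relation.Binary.PropositionalEquality as ≡ using (_≡_; refl; cong; cong₂)
open import Relation.Nullary using (¬_; yes; no; contradiction)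
open import Relation.Unary using (Pred; _≐_)

IsCauchy : (ℕ → ℚ) → Set
IsCauchy x = ∀ ε → 0ℚ ℚ.< ε →
  ∃ λ N → ∀ m n → N ℕ.≤ m → N ℕ.≤ n → ℚ.∣ x m ℚ.- x n ∣ ℚ.≤ ε

record ℝ : Set where
  field
    seq    : ℕ → ℚ
    cauchy : IsCauchy seq

open ℝ

infix 4 _≈ℝ_ _<ℝ_ _≤ℝ_

_≈ℝ_ _<ℝ_ _≤ℝ_ : ℝ → ℝ → Set
x ≈ℝ y = ∀ ε → 0ℚ ℚ.< ε → ∃ λ N → ∀ n → N ℕ.≤ n → ℚ.∣ seq x n ℚ.- seq y n ∣ ℚ.≤ ε
x <ℝ y = ∃ λ ε → 0ℚ ℚ.< ε × ∃ λ N → ∀ n → N ℕ.≤ n → seq x n ℚ.+ ε ℚ.≤ seq y n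
x ≤ℝ y = ¬ (y <ℝ x)

fromℚ : ℚ → ℝ
fromℚ q .seq _ = q
fromℚ q .cauchy ε ε>0 = 0 , λ _ _ _ _ →
  ≡.subst (λ r → ℚ.∣ r ∣ ℚ.≤ ε) (≡.sym (ℚP.+-inverseʳ q)) (ℚP.<⇒≤ ε>0)

private
  open ℚP.≤-Reasoning
  open CommutativeSemigroupProperties (CommutativeMonoid.commutativeSemigroup ℚP.+-0-commutativeMonoid) using (interchange)

  ⊔≤⇒≤ˡ : ∀ m n {k} → m ℕ.⊔ n ℕ.≤ k → m ℕ.≤ k
  ⊔≤⇒≤ˡ m n = ℕP.m⊔n≤o⇒m≤o m n

  ⊔≤⇒≤ʳ : ∀ m n {k} → m ℕ.⊔ n ℕ.≤ k → n ℕ.≤ k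
  ⊔≤⇒≤ʳ m n = ℕP.m⊔n≤o⇒n≤o m n

  ½*-pos : ∀ {ε} → 0ℚ ℚ.< ε → 0ℚ ℚ.< ½ ℚ.* ε
  ½*-pos {ε} ε>0 = ℚP.positive⁻¹ _ {{ℚP.pos*pos⇒pos ½ ε {{ℚ.positive ε>0}}}}

  ½+½ : ∀ ε → ½ ℚ.* ε ℚ.+ ½ ℚ.* ε ≡ ε
  ½+½ ε = ≡.trans (≡.sym (ℚP.*-distribʳ-+ ε ½ ½)) (ℚP.*-identityˡ ε)

  split : ∀ a b → a ≡ (a ℚ.- b) ℚ.+ b
  split a b = ≡.sym (≡.trans (ℚP.+-assoc a (ℚ.- b) b)
                    (≡.trans (cong (a ℚ.+_) (ℚP.+-inverseˡ b)) (ℚP.+-identityʳ a)))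

  +-cauchy : ∀ {x y} → IsCauchy x → IsCauchy y → IsCauchy (λ n → x n ℚ.+ y n)
  +-cauchy {x} {y} cx cy ε ε>0
    with cx (½ ℚ.* ε) (½*-pos ε>0) | cy (½ ℚ.* ε) (½*-pos ε>0)
  ... | N , hx | M , hy = N ℕ.⊔ M , λ m n Nm Nn → begin
    ℚ.∣ (x m ℚ.+ y m) ℚ.- (x n ℚ.+ y n) ∣
      ≡⟨ cong ℚ.∣_∣ (regroup (x m) (y m) (x n) (y n)) ⟩
    ℚ.∣ (x m ℚ.- x n) ℚ.+ (y m ℚ.- y n) ∣
      ≤⟨ ℚP.∣p+q∣≤∣p∣+∣q∣ (x m ℚ.- x n) (y m ℚ.- y n) ⟩
    ℚ.∣ x m ℚ.- x n ∣ ℚ.+ ℚ.∣ y m ℚ.- y n ∣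
      ≤⟨ ℚP.+-mono-≤ (hx m n (⊔≤⇒≤ˡ N M Nm) (⊔≤⇒≤ˡ N M Nn))
                     (hy m n (⊔≤⇒≤ʳ N M Nm) (⊔≤⇒≤ʳ N M Nn)) ⟩
    ½ ℚ.* ε ℚ.+ ½ ℚ.* ε
      ≡⟨ ½+½ ε ⟩
    ε ∎
    where
    regroup : ∀ a b c d → (a ℚ.+ b) ℚ.- (c ℚ.+ d) ≡ (a ℚ.- c) ℚ.+ (b ℚ.- d)
    regroup a b c d = ≡.trans (cong ((a ℚ.+ b) ℚ.+_) (ℚP.neg-distrib-+ c d))
                              (interchange a b (ℚ.- c) (ℚ.- d))

  neg-cauchy : ∀ {x} → IsCauchy x → IsCauchy (λ n → ℚ.- x n)
  neg-cauchy {x} cx ε ε>0 with cx ε ε>0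
  ... | N , h = N , λ m n Nm Nn → begin
    ℚ.∣ ℚ.- x m ℚ.- ℚ.- x n ∣ ≡⟨ cong ℚ.∣_∣ (≡.sym (ℚP.neg-distrib-+ (x m) (ℚ.- x n))) ⟩
    ℚ.∣ ℚ.- (x m ℚ.- x n) ∣   ≡⟨ ℚP.∣-p∣≡∣p∣ (x m ℚ.- x n) ⟩
    ℚ.∣ x m ℚ.- x n ∣         ≤⟨ h m n Nm Nn ⟩
    ε ∎

  bounded : ∀ {x} → IsCauchy x →
    ∃ λ B → ℚ.Positive B × ∃ λ N → ∀ n → N ℕ.≤ n → ℚ.∣ x n ∣ ℚ.≤ B
  bounded {x} cx with cx 1ℚ (ℚP.positive⁻¹ 1ℚ)
  ... | N , h =
    1ℚ ℚ.+ ℚ.∣ x N ∣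
    , ℚP.pos+nonNeg⇒pos 1ℚ ℚ.∣ x N ∣ {{ℚ.nonNegative (ℚP.0≤∣p∣ (x N))}}
    , N , λ n Nn → begin
    ℚ.∣ x n ∣                          ≡⟨ cong ℚ.∣_∣ (split (x n) (x N)) ⟩
    ℚ.∣ (x n ℚ.- x N) ℚ.+ x N ∣        ≤⟨ ℚP.∣p+q∣≤∣p∣+∣q∣ (x n ℚ.- x N) (x N) ⟩
    ℚ.∣ x n ℚ.- x N ∣ ℚ.+ ℚ.∣ x N ∣    ≤⟨ ℚP.+-monoˡ-≤ ℚ.∣ x N ∣ (h n N Nn ℕP.≤-refl) ⟩
    1ℚ ℚ.+ ℚ.∣ x N ∣ ∎

  *-cauchy : ∀ {x y} → IsCauchy x → IsCauchy y → IsCauchy (λ n → x n ℚ.* y n)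
  *-cauchy {x} {y} cx cy ε ε>0 with bounded {x} cx | bounded {y} cy
  ... | B , B>0 , N₁ , hB | C , C>0 , N₂ , hC = step
    where
    instance
      _ = B>0
      _ = C>0
      _ = ℚP.pos+pos⇒pos B C
      _ = ℚP.pos⇒nonZero (B ℚ.+ C)
      _ = ℚP.1/pos⇒pos (B ℚ.+ C)
      _ = ℚ.positive ε>0
      _ = ℚP.pos⇒nonNeg B
      _ = ℚP.pos⇒nonNeg C
    B+C⁻¹ = ℚ.1/ (B ℚ.+ C)
    δ = ε ℚ.* B+C⁻¹
    δ>0 : 0ℚ ℚ.< δ
    δ>0 = ℚP.positive⁻¹ δ {{ℚP.pos*pos⇒pos ε B+C⁻¹}}
    regroup : ∀ a b c d → a ℚ.* b ℚ.- c ℚ.* d ≡ a ℚ.* (b ℚ.- d) ℚ.+ (a ℚ.- c) ℚ.* d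
    regroup a b c d = ≡.sym (begin-equality
      a ℚ.* (b ℚ.- d) ℚ.+ (a ℚ.- c) ℚ.* d
        ≡⟨ cong₂ ℚ._+_ (ℚP.*-distribˡ-+ a b (ℚ.- d)) (ℚP.*-distribʳ-+ d a (ℚ.- c)) ⟩
      (a ℚ.* b ℚ.+ a ℚ.* ℚ.- d) ℚ.+ (a ℚ.* d ℚ.+ ℚ.- c ℚ.* d)
        ≡⟨ cong₂ (λ u v → (a ℚ.* b ℚ.+ u) ℚ.+ (a ℚ.* d ℚ.+ v))
             (ℚP.neg-distribʳ-* a d) (ℚP.neg-distribˡ-* c d) ⟨
      (a ℚ.* b ℚ.- a ℚ.* d) ℚ.+ (a ℚ.* d ℚ.- c ℚ.* d)
        ≡⟨ ℚP.+-assoc (a ℚ.* b ℚ.- a ℚ.* d) (a ℚ.* d) (ℚ.- (c ℚ.* d)) ⟨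
      (a ℚ.* b ℚ.- a ℚ.* d) ℚ.+ a ℚ.* d ℚ.- c ℚ.* d
        ≡⟨ cong (ℚ._- c ℚ.* d) (split (a ℚ.* b) (a ℚ.* d)) ⟨
      a ℚ.* b ℚ.- c ℚ.* d ∎)
    total : B ℚ.* δ ℚ.+ δ ℚ.* C ≡ ε
    total = begin-equality
      B ℚ.* δ ℚ.+ δ ℚ.* C             ≡⟨ cong (ℚ._+ δ ℚ.* C) (ℚP.*-comm B δ) ⟩
      δ ℚ.* B ℚ.+ δ ℚ.* C             ≡⟨ ℚP.*-distribˡ-+ δ B C ⟨
      ε ℚ.* B+C⁻¹ ℚ.* (B ℚ.+ C)       ≡⟨ ℚP.*-assoc ε B+C⁻¹ (B ℚ.+ C) ⟩
      ε ℚ.* (B+C⁻¹ ℚ.* (B ℚ.+ C))     ≡⟨ cong (ε ℚ.*_) (ℚP.*-inverseˡ (B ℚ.+ C)) ⟩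
      ε ℚ.* 1ℚ                        ≡⟨ ℚP.*-identityʳ ε ⟩
      ε ∎
    *-mono : ∀ {a b c d} → 0ℚ ℚ.≤ c → 0ℚ ℚ.≤ b → a ℚ.≤ b → c ℚ.≤ d → a ℚ.* c ℚ.≤ b ℚ.* d
    *-mono {a} {b} {c} {d} c≥0 b≥0 a≤b c≤d = ℚP.≤-trans
      (ℚP.*-monoʳ-≤-nonNeg c {{ℚ.nonNegative c≥0}} a≤b)
      (ℚP.*-monoˡ-≤-nonNeg b {{ℚ.nonNegative b≥0}} c≤d)
    step : ∃ λ N → ∀ m n → N ℕ.≤ m → N ℕ.≤ n → ℚ.∣ x m ℚ.* y m ℚ.- x n ℚ.* y n ∣ ℚ.≤ ε
    step with cx δ δ>0 | cy δ δ>0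
    ... | N₃ , hx | N₄ , hy = (N₁ ℕ.⊔ N₂) ℕ.⊔ (N₃ ℕ.⊔ N₄) , λ m n Nm Nn →
      let Nm₁₂ = ⊔≤⇒≤ˡ (N₁ ℕ.⊔ N₂) (N₃ ℕ.⊔ N₄) Nm ; Nm₃₄ = ⊔≤⇒≤ʳ (N₁ ℕ.⊔ N₂) (N₃ ℕ.⊔ N₄) Nm
          Nn₁₂ = ⊔≤⇒≤ˡ (N₁ ℕ.⊔ N₂) (N₃ ℕ.⊔ N₄) Nn ; Nn₃₄ = ⊔≤⇒≤ʳ (N₁ ℕ.⊔ N₂) (N₃ ℕ.⊔ N₄) Nn
          m₁ = ⊔≤⇒≤ˡ N₁ N₂ Nm₁₂
          n₂ = ⊔≤⇒≤ʳ N₁ N₂ Nn₁₂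
          m₃ = ⊔≤⇒≤ˡ N₃ N₄ Nm₃₄ ; n₃ = ⊔≤⇒≤ˡ N₃ N₄ Nn₃₄
          m₄ = ⊔≤⇒≤ʳ N₃ N₄ Nm₃₄ ; n₄ = ⊔≤⇒≤ʳ N₃ N₄ Nn₃₄
      in begin
      ℚ.∣ x m ℚ.* y m ℚ.- x n ℚ.* y n ∣
        ≡⟨ cong ℚ.∣_∣ (regroup (x m) (y m) (x n) (y n)) ⟩
      ℚ.∣ x m ℚ.* (y m ℚ.- y n) ℚ.+ (x m ℚ.- x n) ℚ.* y n ∣
        ≤⟨ ℚP.∣p+q∣≤∣p∣+∣q∣ (x m ℚ.* (y m ℚ.- y n)) ((x m ℚ.- x n) ℚ.* y n) ⟩
      ℚ.∣ x m ℚ.* (y m ℚ.- y n) ∣ ℚ.+ ℚ.∣ (x m ℚ.- x n) ℚ.* y n ∣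
        ≡⟨ cong₂ ℚ._+_ (ℚP.∣p*q∣≡∣p∣*∣q∣ (x m) (y m ℚ.- y n)) (ℚP.∣p*q∣≡∣p∣*∣q∣ (x m ℚ.- x n) (y n)) ⟩
      ℚ.∣ x m ∣ ℚ.* ℚ.∣ y m ℚ.- y n ∣ ℚ.+ ℚ.∣ x m ℚ.- x n ∣ ℚ.* ℚ.∣ y n ∣
        ≤⟨ ℚP.+-mono-≤
             (*-mono (ℚP.0≤∣p∣ (y m ℚ.- y n)) (ℚP.<⇒≤ (ℚP.positive⁻¹ B)) (hB m m₁) (hy m n m₄ n₄))
             (*-mono (ℚP.0≤∣p∣ (y n)) (ℚP.<⇒≤ δ>0) (hx m n m₃ n₃) (hC n n₂)) ⟩
      B ℚ.* δ ℚ.+ δ ℚ.* C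
        ≡⟨ total ⟩
      ε ∎

infixl 6 _+ℝ_ _-ℝ_
infixl 7 _*ℝ_
infix  8 -ℝ_

-ℝ_ : ℝ → ℝ
(-ℝ x) .seq n = ℚ.- seq x n
(-ℝ x) .cauchy = neg-cauchy {seq x} (cauchy x)

_+ℝ_ _*ℝ_ _-ℝ_ : ℝ → ℝ → ℝ
(x +ℝ y) .seq n = seq x n ℚ.+ seq y n
(x +ℝ y) .cauchy = +-cauchy {seq x} {seq y} (cauchy x) (cauchy y)
(x *ℝ y) .seq n = seq x n ℚ.* seq y n
(x *ℝ y) .cauchy = *-cauchy {seq x} {seq y} (cauchy x) (cauchy y)
x -ℝ y = x +ℝ (-ℝ y)

infixl 6 _+i_

record ℂ : Set where
  constructor _+i_
  field
    re im : ℝ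

open ℂ

infix  4 _≈ℂ_
infixl 6 _+ℂ_ _-ℂ_
infixl 7 _*ℂ_
infix  8 -ℂ_
infixr 8 _^ℂ_

_≈ℂ_ : ℂ → ℂ → Set
z ≈ℂ w = re z ≈ℝ re w × im z ≈ℝ im w

-ℂ_ : ℂ → ℂ
-ℂ z = (-ℝ re z) +i (-ℝ im z)

_+ℂ_ _*ℂ_ _-ℂ_ : ℂ → ℂ → ℂ
z +ℂ w = (re z +ℝ re w) +i (im z +ℝ im w)
z *ℂ w = (re z *ℝ re w -ℝ im z *ℝ im w) +i (re z *ℝ im w +ℝ im z *ℝ re w)
z -ℂ w = z +ℂ (-ℂ w)

ℝ→ℂ : ℝ → ℂ
ℝ→ℂ x = x +i fromℚ 0ℚ

ℚ→ℂ : ℚ → ℂ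
ℚ→ℂ q = ℝ→ℂ (fromℚ q)

ℤ→ℂ : ℤ → ℂ
ℤ→ℂ k = ℚ→ℂ (k ℚ./ 1)

ℕ→ℂ : ℕ → ℂ
ℕ→ℂ n = ℤ→ℂ (+ n)

0ℂ 1ℂ : ℂ
0ℂ = ℕ→ℂ 0
1ℂ = ℕ→ℂ 1

_^ℂ_ : ℂ → ℕ → ℂ
z ^ℂ zero  = 1ℂ
z ^ℂ suc n = z *ℂ z ^ℂ n

∣_∣² : ℂ → ℝ
∣ z ∣² = re z *ℝ re z +ℝ im z *ℝ im z

Converges : (ℕ → ℂ) → ℂ → Set
Converges u w = ∀ ε → 0ℚ ℚ.< ε →
  ∃ λ N → ∀ n → N ℕ.≤ n → ∣ u n -ℂ w ∣² ≤ℝ fromℚ (ε ℚ.* ε)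

partialSum : (ℕ → ℂ) → ℕ → ℂ
partialSum u zero    = 0ℂ
partialSum u (suc n) = partialSum u n +ℂ u n

HasSum : (ℕ → ℂ) → ℂ → Set
HasSum u w = Converges (partialSum u) w

-- zᵏ / k!
expTerm : ℂ → ℕ → ℂ
expTerm z zero    = 1ℂ
expTerm z (suc k) = expTerm z k *ℂ z *ℂ ℚ→ℂ (+ 1 ℚ./ suc k)

IsExp : ℂ → ℂ → Set
IsExp z w = HasSum (expTerm z) w

-- w = nˢ, that is, w = exp (s · log n) with log n the real logarithm
IsPower : ℕ → ℂ → ℂ → Set
IsPower n s w = ∃ λ ℓ → IsExp (ℝ→ℂ ℓ) (ℕ→ℂ n) × IsExp (s *ℂ ℝ→ℂ ℓ) w

-- w = ∑_{n ≥ 1} aₙ n⁻ˢ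
IsDirichletSum : (ℕ → ℕ) → ℂ → ℂ → Set
IsDirichletSum a s w = Σ (ℕ → ℂ) λ t →
  (∀ k → IsPower (suc k) (-ℂ s) (t k)) ×
  HasSum (λ k → ℕ→ℂ (a (suc k)) *ℂ t k) w

ComplexDifferentiableAt : (ℂ → ℂ) → ℂ → Set
ComplexDifferentiableAt f s = ∃ λ L → ∀ ε → 0ℚ ℚ.< ε → ∃ λ δ → 0ℚ ℚ.< δ ×
  (∀ h → ∣ h ∣² ≤ℝ fromℚ (δ ℚ.* δ) →
    ∣ f (s +ℂ h) -ℂ f s -ℂ L *ℂ h ∣² ≤ℝ fromℚ (ε ℚ.* ε) *ℝ ∣ h ∣²)

-- ℚ(ᵐ√1, ᵐ√p)
data RadicalField (m p : ℕ) : Pred ℂ 0ℓ where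
  rational : ∀ q → RadicalField m p (ℚ→ℂ q)
  root-1   : ∀ {z} → z ^ℂ m ≈ℂ 1ℂ → RadicalField m p z
  root-p   : ∀ {z} → z ^ℂ m ≈ℂ ℕ→ℂ p → RadicalField m p z
  add      : ∀ {z w} → RadicalField m p z → RadicalField m p w → RadicalField m p (z +ℂ w)
  mul      : ∀ {z w} → RadicalField m p z → RadicalField m p w → RadicalField m p (z *ℂ w)
  inverse  : ∀ {z w} → RadicalField m p z → z *ℂ w ≈ℂ 1ℂ → RadicalField m p w
  respects : ∀ {z w} → z ≈ℂ w → RadicalField m p z → RadicalField m p w

-- The value at z of the monic polynomial c₀ + c₁ X + … + c_{d-1} X^{d-1} + X^d.
monicEval : List ℤ → ℂ → ℂ
monicEval cs z = foldr (λ c v → ℤ→ℂ c +ℂ z *ℂ v) 1ℂ cs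

module NumberField (K : Pred ℂ 0ℓ) where

  𝓞 : Pred ℂ 0ℓ
  𝓞 z = K z × ∃ λ cs → monicEval cs z ≈ℂ 0ℂ

  record Ideal : Set (lsuc 0ℓ) where
    field
      _∈I      : Pred ℂ 0ℓ
      ⊆𝓞       : ∀ {z} → z ∈I → 𝓞 z
      ∈I-resp  : ∀ {z w} → z ≈ℂ w → z ∈I → w ∈I
      0∈       : 0ℂ ∈I
      +-closed : ∀ {z w} → z ∈I → w ∈I → (z +ℂ w) ∈I
      *-closed : ∀ {a z} → 𝓞 a → z ∈I → (a *ℂ z) ∈I

  open Ideal

  -- N(I) = [𝓞 : I] = n, witnessed by a transversal of 𝓞 / I.  The zero ideal has
  -- infinite index, so it has no norm in this sense.
  HasNorm : Ideal → ℕ → Set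
  HasNorm I n = Σ (Fin n → ℂ) λ r →
    (∀ i → 𝓞 (r i)) ×
    (∀ {z} → 𝓞 z → ∃ λ i → _∈I I (z -ℂ r i)) ×
    (∀ i j → _∈I I (r i -ℂ r j) → i ≡ j)

  IdealCount : ℕ → ℕ → Set (lsuc 0ℓ)
  IdealCount n k = Σ (Fin k → Ideal) λ J →
    (∀ i → HasNorm (J i) n) ×
    (∀ i j → _∈I (J i) ≐ _∈I (J j) → i ≡ j) ×
    (∀ I → HasNorm I n → ∃ λ i → _∈I I ≐ _∈I (J i))

  -- Z is the Dedekind zeta function of K: the sum of N(I)⁻ˢ over the nonzero ideals
  -- (grouped by norm) for Re s > 1, continued holomorphically to ℂ ∖ {1}.  For a number
  -- field Z exists (Hecke) and is unique up to its arbitrary value at the pole 1.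
  record IsDedekindZeta (Z : ℂ → ℂ) : Set (lsuc 0ℓ) where
    field
      Z-cong      : ∀ {s t} → s ≈ℂ t → Z s ≈ℂ Z t
      coefficient : ℕ → ℕ
      counts      : ∀ n → IdealCount (suc n) (coefficient (suc n))
      series      : ∀ s → fromℚ 1ℚ <ℝ re s → IsDirichletSum coefficient s (Z s)
      holomorphic : ∀ s → ¬ s ≈ℂ 1ℂ → ComplexDifferentiableAt Z s

  GRH : Set (lsuc 0ℓ)
  GRH = ∀ Z → IsDedekindZeta Z →
    ∀ s → fromℚ 0ℚ <ℝ re s → re s <ℝ fromℚ 1ℚ → Z s ≈ℂ 0ℂ → re s ≈ℝ fromℚ ½

open NumberField public using (GRH)

SquareFree : ℕ → Set
SquareFree n = ∀ d → d ℕ.* d ℕ∣.∣ n → d ≡ 1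

-- A Heyting field is a commutative ring with a tight apartness relation for which
-- x # 0 iff x is invertible; classically this is precisely a field (0 ≠ 1 included).
module MonoidRing (F : HeytingField 0ℓ 0ℓ 0ℓ) (Γ : CommutativeMonoid 0ℓ 0ℓ) where

  private
    module F = HeytingField F
    module Γ = CommutativeMonoid Γ

  Poly : Set
  Poly = List (F.Carrier × Γ.Carrier)

  infix 4 _≈ₚ_

  -- Formal sums ∑ aᵢ X^αᵢ, up to the congruence presenting the free F-module on Γ.
  -- (Comparing coefficients directly would need decidable equality on Γ.)
  data _≈ₚ_ : Poly → Poly → Set where
    ≈-refl  : ∀ {f} → f ≈ₚ f
    ≈-sym   : ∀ {f g} → f ≈ₚ g → g ≈ₚ f
    ≈-trans : ∀ {f g h} → f ≈ₚ g → g ≈ₚ h → f ≈ₚ h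
    prep    : ∀ {a b α β f g} → a F.≈ b → α Γ.≈ β → f ≈ₚ g → (a , α) ∷ f ≈ₚ (b , β) ∷ g
    swap    : ∀ {s t f} → s ∷ t ∷ f ≈ₚ t ∷ s ∷ f
    collect : ∀ {a b α f} → (a , α) ∷ (b , α) ∷ f ≈ₚ (a F.+ b , α) ∷ f
    drop-0  : ∀ {α f} → (F.0# , α) ∷ f ≈ₚ f

  _*ₚ_ : Poly → Poly → Poly
  _*ₚ_ = cartesianProductWith λ (a , α) (b , β) → a F.* b , α Γ.∙ β

  rawSemiring : RawSemiring 0ℓ 0ℓ
  rawSemiring = record
    { Carrier = Poly
    ; _≈_     = _≈ₚ_
    ; _+_     = _++_
    ; _*_     = _*ₚ_
    ; 0#      = []
    ; 1#      = (F.1# , Γ.ε) ∷ []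
    }

  X^_-𝟏 : Γ.Carrier → Poly
  X^ α -𝟏 = (F.1# , α) ∷ (F.- F.1# , Γ.ε) ∷ []

  open Divisibility rawSemiring public using (Irreducible; _∣_)

  IsUnit : Poly → Set
  IsUnit f = f ∣ RawSemiring.1# rawSemiring

  Reducible : Poly → Set
  Reducible f = ¬ IsUnit f × ¬ Irreducible f

HasCharacteristic : HeytingField 0ℓ 0ℓ 0ℓ → ℕ → Set
HasCharacteristic F p = ∀ n → (n ·1) ≈ 0# ⇔ p ℕ∣.∣ n
  where
  open HeytingCommutativeRing (HeytingField.heytingCommutativeRing F) using (commutativeRing)
  open CommutativeRing commutativeRing using (Carrier; _≈_; 0#; 1#; +-rawMonoid)
  _·1 : ℕ → Carrier
  n ·1 = Multiples._×_ +-rawMonoid n 1#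

module _ (Γ : CommutativeMonoid 0ℓ 0ℓ) where

  open CommutativeMonoid Γ
  open Multiples rawMonoid using () renaming (_×_ to _·_)

  TorsionFree : Set
  TorsionFree = ∀ n → 0 ℕ.< n → ∀ α β → n · α ≈ n · β → α ≈ β

  Indivisible : Carrier → Set
  Indivisible π = ∀ n → 0 ℕ.< n → ∀ x → n · x ≈ π → n ≡ 1 × x ≈ π

  record IsMatsuda (p : ℕ) : Set (lsuc 0ℓ) where
    field
      torsionFree  : TorsionFree
      cancellative : AlgDefs.Cancellative _≈_ _∙_
      irreducible  : ∀ (F : HeytingField 0ℓ 0ℓ 0ℓ) → HasCharacteristic F p →
                     ∀ π → Indivisible π →
                     let open MonoidRing F Γ in Irreducible (X^ π -𝟏)

_∈⟨2,3⟩ : ℕ → Set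
n ∈⟨2,3⟩ = ∃₂ λ a b → n ≡ a ℕ.* 2 ℕ.+ b ℕ.* 3

private
  +-∈⟨2,3⟩ : ∀ {m n} → m ∈⟨2,3⟩ → n ∈⟨2,3⟩ → (m ℕ.+ n) ∈⟨2,3⟩
  +-∈⟨2,3⟩ (a , b , refl) (c , d , refl) = a ℕ.+ c , b ℕ.+ d ,
    solve 4 (λ a b c d → (a :* con 2 :+ b :* con 3) :+ (c :* con 2 :+ d :* con 3)
                      := (a :+ c) :* con 2 :+ (b :+ d) :* con 3) refl a b c d
    where
    open import Data.Nat.Solver
    open +-*-Solver

2+n∈⟨2,3⟩ : ∀ n → (2 ℕ.+ n) ∈⟨2,3⟩
2+n∈⟨2,3⟩ 0 = 1 , 0 , refl
2+n∈⟨2,3⟩ 1 = 0 , 1 , refl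
2+n∈⟨2,3⟩ (suc (suc n)) with 2+n∈⟨2,3⟩ n
... | a , b , eq = suc a , b , cong (2 ℕ.+_) eq

prime∈⟨2,3⟩ : ∀ {q} → Prime q → q ∈⟨2,3⟩
prime∈⟨2,3⟩ {0} pq = contradiction pq Primality.¬prime[0]
prime∈⟨2,3⟩ {1} pq = contradiction pq Primality.¬prime[1]
prime∈⟨2,3⟩ {suc (suc n)} _ = 2+n∈⟨2,3⟩ n

⟨2,3⟩ : CommutativeMonoid 0ℓ 0ℓ
⟨2,3⟩ = record
  { Carrier = ∃ _∈⟨2,3⟩
  ; _≈_     = λ x y → proj₁ x ≡ proj₁ y
  ; _∙_     = λ (m , hm) (n , hn) → m ℕ.+ n , +-∈⟨2,3⟩ hm hn
  ; ε       = 0 , 0 , 0 , refl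
  ; isCommutativeMonoid = record
    { isMonoid = record
      { isSemigroup = record
        { isMagma = record
          { isEquivalence = record { refl = refl ; sym = ≡.sym ; trans = ≡.trans }
          ; ∙-cong = cong₂ ℕ._+_
          }
        ; assoc = λ x y z → ℕP.+-assoc (proj₁ x) (proj₁ y) (proj₁ z)
        }
      ; identity = (λ _ → refl) , (λ x → ℕP.+-identityʳ (proj₁ x))
      }
    ; comm = λ x y → ℕP.+-comm (proj₁ x) (proj₁ y)
    }
  }

-- 𝔽 is the field with p elements, presented as ℤ with equality modulo p.
module _ (p : ℕ) (p-prime : Prime p) where

  private
    open ℤ∣ using (_∣_; divides; ∣m⇒∣-m; ∣m∣n⇒∣m+n; ∣m∣n⇒∣m-n; ∣n⇒∣m*n)
    open ℤS.+-*-Solver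

    P : ℤ
    P = + p

    infix 4 _≋_
    _≋_ : ℤ → ℤ → Set
    x ≋ y = P ∣ x ℤ.- y

    by : ∀ {x y} → x ≡ y → P ∣ x → P ∣ y
    by = ≡.subst (P ∣_)

    ≋-reflexive : ∀ {x y} → x ≡ y → x ≋ y
    ≋-reflexive {x} refl = by (≡.sym (ℤP.+-inverseʳ x)) (divides (+ 0) refl)

    ≋-sym : ∀ {x y} → x ≋ y → y ≋ x
    ≋-sym {x} {y} h =
      by (solve 2 (λ x y → :- (x :- y) := y :- x) refl x y) (∣m⇒∣-m h)

    ≋-trans : ∀ {x y z} → x ≋ y → y ≋ z → x ≋ z
    ≋-trans {x} {y} {z} h k =
      by (solve 3 (λ x y z → (x :- y) :+ (y :- z) := x :- z) refl x y z) (∣m∣n⇒∣m+n h k)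

    +-≋ : ∀ {x y u v} → x ≋ y → u ≋ v → (x ℤ.+ u) ≋ (y ℤ.+ v)
    +-≋ {x} {y} {u} {v} h k =
      by (solve 4 (λ x y u v → (x :- y) :+ (u :- v) := (x :+ u) :- (y :+ v)) refl x y u v)
         (∣m∣n⇒∣m+n h k)

    *-≋ : ∀ {x y u v} → x ≋ y → u ≋ v → (x ℤ.* u) ≋ (y ℤ.* v)
    *-≋ {x} {y} {u} {v} h k =
      by (solve 4 (λ x y u v → u :* (x :- y) :+ y :* (u :- v) := x :* u :- y :* v) refl x y u v)
         (∣m∣n⇒∣m+n (∣n⇒∣m*n u h) (∣n⇒∣m*n y k))

    neg-≋ : ∀ {x y} → x ≋ y → (ℤ.- x) ≋ (ℤ.- y)
    neg-≋ {x} {y} h =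
      by (solve 2 (λ x y → :- (x :- y) := (:- x) :- (:- y)) refl x y) (∣m⇒∣-m h)

    P∤1 : ¬ P ∣ + 1
    P∤1 h with ℕ∣.∣1⇒≡1 (ℤ∣.∣⇒∣ᵤ h)
    ... | refl = Primality.¬prime[1] p-prime

    ℕ-inverse : ∀ n → ¬ P ∣ + n → ∃ λ u → (u ℤ.* + n) ≋ + 1
    ℕ-inverse n p∤n = fromBézout (ℕC.coprime-Bézout coprime)
      where
      coprime : ℕC.Coprime p n
      coprime {d} (d∣p , d∣n) with Primality.prime⇒irreducible p-prime d∣p
      ... | inj₁ d≡1  = d≡1
      ... | inj₂ refl = ⊥-elim (p∤n (ℤ∣.∣ᵤ⇒∣ d∣n))
      lift : ∀ a b c d → 1 ℕ.+ a ℕ.* b ≡ c ℕ.* d → + 1 ℤ.+ + a ℤ.* + b ≡ + c ℤ.* + d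
      lift a b c d eq = ≡.trans (cong (λ t → + 1 ℤ.+ t) (≡.sym (ℤP.pos-* a b)))
                        (≡.trans (cong +_ eq) (ℤP.pos-* c d))
      fromBézout : Bézout.Identity 1 p n → ∃ λ u → (u ℤ.* + n) ≋ + 1
      fromBézout (Bézout.+- x y eq) = ℤ.- + y , divides (ℤ.- + x)
        (≡.trans (solve 2 (λ y n → (:- y) :* n :- con (+ 1) := :- (con (+ 1) :+ y :* n)) refl (+ y) (+ n))
        (≡.trans (cong ℤ.-_ (lift y n x p eq)) (ℤP.neg-distribˡ-* (+ x) P)))
      fromBézout (Bézout.-+ x y eq) = + y , divides (+ x)
        (≡.trans (cong (λ t → t ℤ.- + 1) (≡.sym (lift x p y n eq)))
        (solve 2 (λ x P → con (+ 1) :+ x :* P :- con (+ 1) := x :* P) refl (+ x) P))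

    ℤ-inverse : ∀ a → ¬ P ∣ a → ∃ λ u → (u ℤ.* a) ≋ + 1
    ℤ-inverse (+ n) p∤a = ℕ-inverse n p∤a
    ℤ-inverse a@(-[1+ n ]) p∤a with ℕ-inverse (suc n) (λ h → p∤a (∣m⇒∣-m h))
    ... | u , h = ℤ.- u , by
      (solve 2 (λ u b → u :* b :- con (+ 1) := (:- u) :* (:- b) :- con (+ 1)) refl u (+ suc n)) h

  𝔽 : HeytingField 0ℓ 0ℓ 0ℓ
  𝔽 = record
    { Carrier = ℤ
    ; _≈_     = _≋_
    ; _#_     = λ x y → ¬ x ≋ y
    ; _+_     = ℤ._+_
    ; _*_     = ℤ._*_
    ; -_      = ℤ.-_
    ; 0#      = + 0
    ; 1#      = + 1
    ; isHeytingField = record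
      { isHeytingCommutativeRing = record
        { isCommutativeRing = record
          { isRing = record
            { +-isAbelianGroup = record
              { isGroup = record
                { isMonoid = record
                  { isSemigroup = record
                    { isMagma = record
                      { isEquivalence = record
                        { refl  = λ {x} → ≋-reflexive {x} refl
                        ; sym   = λ {x y} → ≋-sym {x} {y}
                        ; trans = λ {x y z} → ≋-trans {x} {y} {z}
                        }
                      ; ∙-cong = λ {x y u v} → +-≋ {x} {y} {u} {v}
                      }
                    ; assoc = λ x y z → ≋-reflexive (ℤP.+-assoc x y z)
                    }
                  ; identity = (λ x → ≋-reflexive (ℤP.+-identityˡ x))
                             , (λ x → ≋-reflexive (ℤP.+-identityʳ x))
                  }
                ; inverse = (λ x → ≋-reflexive (ℤP.+-inverseˡ x))
                          , (λ x → ≋-reflexive (ℤP.+-inverseʳ x))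
                ; ⁻¹-cong = λ {x y} → neg-≋ {x} {y}
                }
              ; comm = λ x y → ≋-reflexive (ℤP.+-comm x y)
              }
            ; *-cong = λ {x y u v} → *-≋ {x} {y} {u} {v}
            ; *-assoc = λ x y z → ≋-reflexive (ℤP.*-assoc x y z)
            ; *-identity = (λ x → ≋-reflexive (ℤP.*-identityˡ x))
                         , (λ x → ≋-reflexive (ℤP.*-identityʳ x))
            ; distrib = (λ x y z → ≋-reflexive (ℤP.*-distribˡ-+ x y z))
                      , (λ x y z → ≋-reflexive (ℤP.*-distribʳ-+ x y z))
            }
          ; *-comm = λ x y → ≋-reflexive (ℤP.*-comm x y)
          }
        ; isApartnessRelation = record
          { irrefl  = λ x≋y x#y → x#y x≋y
          ; sym     = λ {x y} x#y h → x#y (≋-sym {y} {x} h)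
          ; cotrans = λ {x} {y} x#y z → cotrans {x} {y} x#y z
          }
        ; #⇒invertible = λ {x} {y} x#y → invert (x ℤ.- y) x#y
        ; invertible⇒# = λ {x} {y} (u , h , _) x≋y → P∤1
            (by (solve 1 (λ t → t :- (t :- con (+ 1)) := con (+ 1)) refl (u ℤ.* (x ℤ.- y)))
                (∣m∣n⇒∣m-n (∣n⇒∣m*n u x≋y) h))
        }
      ; tight = λ x y → decidable-stable (P ℤ∣.∣? (x ℤ.- y)) , (λ x≋y x#y → x#y x≋y)
      }
    }
    where
    open import Relation.Nullary.Decidable using (decidable-stable)
    open import Data.Sum.Base using (_⊎_)
    cotrans : ∀ {x y} → ¬ x ≋ y → ∀ z → ¬ x ≋ z ⊎ ¬ z ≋ y
    cotrans {x} {y} x#y z with P ℤ∣.∣? (x ℤ.- z)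
    ... | yes x≋z = inj₂ (λ z≋y → x#y (≋-trans {x} {z} {y} x≋z z≋y))
    ... | no  x#z = inj₁ x#z
    invert : ∀ a → ¬ P ∣ a →
      ∃ λ u → (u ℤ.* a) ≋ + 1 × (a ℤ.* u) ≋ + 1
    invert a p∤a with ℤ-inverse a p∤a
    ... | u , h = u , h , ≡.subst (λ t → t ≋ + 1) (ℤP.*-comm u a) h

E : (p : ℕ) → Prime p → Pred ℕ 0ℓ
E p p-prime q = Σ (Prime q) λ q-prime →
  let open MonoidRing (𝔽 p p-prime) ⟨2,3⟩ in Reducible (X^ (q , prime∈⟨2,3⟩ q-prime) -𝟏)

Infinite : Pred ℕ 0ℓ → Set
Infinite A = ∀ N → ∃ λ n → N ℕ.< n × A n

{-# OPTIONS --safe #-}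

-- Let q ≡ 1 (mod 4p) be prime, and let N = ∑ X^s over the quadratic nonresidues s
-- modulo q.  With G = ∑ χ(s) X^s and U = ∑ X^s, the relations G² = q - U and GU = 0 in ℤ[X]/(X^q - 1)
-- give 4(N² + N) = (q - 1)(U + 1), so N(N + 1) vanishes in 𝔽_p[X]/(X^q - 1).  Put f = gcd(N, X^q - 1)
-- and fg = X^q - 1.  Differentiating, W = X f′ g satisfies W + X f g′ ≡ q ≡ 1; as N W ≡ 0 and
-- (1 + N) f ≡ 0, it follows that W ≡ 1 + N modulo X^q - 1.  Since deg W ≤ q, both sides have the same
-- coefficient at X, which is 0 because 1 is a residue.  Hence f, and then g, has no linear term, and
-- X^q - 1 = fg is a nontrivial factorisation in 𝔽_p[X; ⟨2,3⟩].  Infinitely many such q are found among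
-- the prime divisors of 1 + u + … + u^{p-1}, where u = -x² (u = x⁴ if p = 2) with x highly divisible.

module Submission where

open import Level using (0ℓ)
open import Algebra.Apartness.Bundles using (HeytingField; HeytingCommutativeRing)
open import Algebra.Bundles using (CommutativeMonoid; CommutativeRing; RawSemiring)
import Algebra.Definitions.RawMonoid as Multiples
open import Algebra.Definitions.RawMagma using (module _∣ʳ_)
import Algebra.Definitions.RawSemiring as Divisibility
import Algebra.Solver.Ring.NaturalCoefficients.Default as NatSolver
open import Data.Fin.Base as Fin using (Fin; toℕ; fromℕ<)
import Data.Fin.Permutation as Perm
import Data.Fin.Properties as FinP
open import Data.Integer.Base as ℤ using (ℤ; +_; -[1+_]; ∣_∣)
import Data.Integer.Divisibility.Signed as ℤ∣
import Data.Integer.DivMod as ℤD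
import Data.Integer.Properties as ℤP
import Data.Integer.Solver as ℤS
open import Data.List.Base using (List; []; _∷_; _++_; applyUpTo; drop; length; map; replicate)
import Data.List.Properties as ListP
open import Data.List.Relation.Unary.All using (All; _∷_)
open import Data.Nat.Base as ℕ using (ℕ; zero; suc; _!)
import Data.Nat.Coprimality as ℕC
import Data.Nat.Divisibility as ℕ∣
import Data.Nat.GCD as ℕGCD
open import Data.Nat.ListAction using (product)
open import Data.Nat.Primality as Primality using (Prime; euclidsLemma; prime⇒irreducible; ¬prime[0]; ¬prime[1])
open import Data.Nat.Primality.Factorisation using (PrimeFactorisation; factorise)
import Data.Nat.Properties as ℕP
open import Data.Product.Base using (∃; ∃₂; _×_; _,_; proj₁; proj₂)
open import Data.Sum.Base using (_⊎_; inj₁; inj₂; [_,_]′)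
open import Function.Bundles using (mk⇔)
open import Relation.Binary.Definitions using (tri<; tri≈; tri>)
open import Relation.Binary.PropositionalEquality as ≡ using (_≡_; cong; cong₂; module ≡-Reasoning)
import Relation.Binary.Reasoning.Setoid as SetoidReasoning
open import Relation.Nullary using (¬_; Dec; yes; no; contradiction)
open import Relation.Nullary.Decidable using (map′)
open import Defs

-- Over an algebraic closure of 𝔽_p, a factorisation X^q - 1 = f g is a choice of a set of q-th
-- roots of unity, and f has no linear term exactly when the inverses of its roots add up to 0. The
-- obstacle is to find a proper nonempty set of roots, stable under Frobenius, with this vanishing
-- sum. Idempotents of 𝔽_p[X]/(X^q - 1) encode such sets: if e is 1 on the roots of f and 0 on those
-- of g, then its coefficient at X is the sum of the inverse roots of f, because q ≡ 1 in 𝔽_p. It is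
-- therefore enough to have an explicit nontrivial idempotent with coefficient 0 at X. The relation
-- N(N + 1) = 0 makes 1 + N one, and f = gcd(N, X^q - 1) collects the roots at which N is 0 rather
-- than -1. The modulus 4p has two sources. That 4 divides q - 1 makes the quadratic character even,
-- which fixes the sign in G² = q - U. That p divides (q - 1)/4, and not only q - 1, lets the
-- relation for N survive the division by 4 when p = 2 as well.

-- Quotient of a commutative ring by a principal ideal.

module Quotient (R : CommutativeRing 0ℓ 0ℓ) (m : CommutativeRing.Carrier R) where

  open CommutativeRing R
  open NatSolver commutativeSemiring
  open SetoidReasoning setoid

  infix 4 _≈ₘ_
  -- The cofactor is kept as data because later arguments modulo X^q - 1 examine its degree. Two
  -- instances occur: 𝔽_p[X] modulo X^q - 1 and ℤ modulo q.
  record _≈ₘ_ (x y : Carrier) : Set where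
    constructor multiple
    field
      factor     : Carrier
      difference : x ≈ y + factor * m

  open _≈ₘ_ public

  ≈⇒≈ₘ : ∀ {x y} → x ≈ y → x ≈ₘ y
  ≈⇒≈ₘ {x} {y} x≈y = multiple 0# (trans x≈y (solve 2 (λ y m → y := y :+ con 0 :* m) refl y m))

  private
    ≈ₘ-sym : ∀ {x y} → x ≈ₘ y → y ≈ₘ x
    ≈ₘ-sym {x} {y} (multiple h x≈) = multiple (- h) (begin
      y                      ≈⟨ solve 2 (λ y m → y := y :+ con 0 :* m) refl y m ⟩
      y + 0# * m             ≈⟨ +-congˡ (*-congʳ (-‿inverseʳ h)) ⟨
      y + (h + - h) * m      ≈⟨ solve 4 (λ y h k m → y :+ (h :+ k) :* m := (y :+ h :* m) :+ k :* m) refl y h (- h) m ⟩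
      (y + h * m) + - h * m  ≈⟨ +-congʳ x≈ ⟨
      x + - h * m            ∎)

    ≈ₘ-trans : ∀ {x y z} → x ≈ₘ y → y ≈ₘ z → x ≈ₘ z
    ≈ₘ-trans {x} {y} {z} (multiple h x≈) (multiple k y≈) = multiple (k + h) (begin
      x                     ≈⟨ x≈ ⟩
      y + h * m             ≈⟨ +-congʳ y≈ ⟩
      (z + k * m) + h * m   ≈⟨ solve 4 (λ z k h m → (z :+ k :* m) :+ h :* m := z :+ (k :+ h) :* m) refl z k h m ⟩
      z + (k + h) * m       ∎)

    +-congₘ : ∀ {x y u v} → x ≈ₘ y → u ≈ₘ v → x + u ≈ₘ y + v
    +-congₘ {x} {y} {u} {v} (multiple h x≈) (multiple k u≈) = multiple (h + k) (begin
      x + u                       ≈⟨ +-cong x≈ u≈ ⟩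
      (y + h * m) + (v + k * m)
        ≈⟨ solve 5 (λ y v k h m → (y :+ h :* m) :+ (v :+ k :* m) := (y :+ v) :+ (h :+ k) :* m) refl y v k h m ⟩
      (y + v) + (h + k) * m       ∎)

    *-congₘ : ∀ {x y u v} → x ≈ₘ y → u ≈ₘ v → x * u ≈ₘ y * v
    *-congₘ {x} {y} {u} {v} (multiple h x≈) (multiple k u≈) = multiple (y * k + h * u) (begin
      x * u                         ≈⟨ *-congʳ x≈ ⟩
      (y + h * m) * u               ≈⟨ solve 4 (λ y u h m → (y :+ h :* m) :* u := y :* u :+ h :* u :* m) refl y u h m ⟩
      y * u + h * u * m             ≈⟨ +-congʳ (*-congˡ u≈) ⟩
      y * (v + k * m) + h * u * m
        ≈⟨ solve 6 (λ y u v k h m → y :* (v :+ k :* m) :+ h :* u :* m := y :* v :+ (y :* k :+ h :* u) :* m) refl y u v k h m ⟩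
      y * v + (y * k + h * u) * m   ∎)

    neg-congₘ : ∀ {x y} → x ≈ₘ y → - x ≈ₘ - y
    neg-congₘ {x} {y} (multiple h x≈) = multiple (- h) (begin
      - x                  ≈⟨ -‿cong x≈ ⟩
      - (y + h * m)        ≈⟨ -‿+-comm y (h * m) ⟨
      - y + - (h * m)      ≈⟨ +-congˡ (-‿distribˡ-* h m) ⟩
      - y + - h * m        ∎)
      where open import Algebra.Properties.Ring ring

  quotientRing : CommutativeRing 0ℓ 0ℓ
  quotientRing = record
    { Carrier = Carrier ; _≈_ = _≈ₘ_ ; _+_ = _+_ ; _*_ = _*_ ; -_ = -_ ; 0# = 0# ; 1# = 1#
    ; isCommutativeRing = record
      { isRing = record
        { +-isAbelianGroup = record
          { isGroup = record
            { isMonoid = record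
              { isSemigroup = record
                { isMagma = record
                  { isEquivalence = record { refl = ≈⇒≈ₘ refl ; sym = ≈ₘ-sym ; trans = ≈ₘ-trans }
                  ; ∙-cong = +-congₘ
                  }
                ; assoc = λ x y z → ≈⇒≈ₘ (+-assoc x y z)
                }
              ; identity = (λ x → ≈⇒≈ₘ (+-identityˡ x)) , (λ x → ≈⇒≈ₘ (+-identityʳ x))
              }
            ; inverse = (λ x → ≈⇒≈ₘ (-‿inverseˡ x)) , (λ x → ≈⇒≈ₘ (-‿inverseʳ x))
            ; ⁻¹-cong = neg-congₘ
            }
          ; comm = λ x y → ≈⇒≈ₘ (+-comm x y)
          }
        ; *-cong = *-congₘ
        ; *-assoc = λ x y z → ≈⇒≈ₘ (*-assoc x y z)
        ; *-identity = (λ x → ≈⇒≈ₘ (*-identityˡ x)) , (λ x → ≈⇒≈ₘ (*-identityʳ x))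
        ; distrib = (λ x y z → ≈⇒≈ₘ (distribˡ x y z)) , (λ x y z → ≈⇒≈ₘ (distribʳ x y z))
        }
      ; *-comm = λ x y → ≈⇒≈ₘ (*-comm x y)
      }
    }

-- The polynomial ring, with lists of coefficients.

module Polynomial (R : CommutativeRing 0ℓ 0ℓ) where

  open CommutativeRing R
  open NatSolver commutativeSemiring
  open SetoidReasoning setoid

  -- Constant term first; trailing zeros are allowed, so equality is coefficientwise.
  Poly : Set
  Poly = List Carrier

  coeff : Poly → ℕ → Carrier
  coeff []      _       = 0#
  coeff (a ∷ f) zero    = a
  coeff (a ∷ f) (suc n) = coeff f n

  infix 4 _≈ₚ_
  record _≈ₚ_ (f g : Poly) : Set where
    constructor coeffwise
    field at : ∀ n → coeff f n ≈ coeff g n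

  open _≈ₚ_ public

  infixl 6 _+ₚ_
  infixl 7 _*ₚ_ _·_

  _+ₚ_ : Poly → Poly → Poly
  []      +ₚ g       = g
  (a ∷ f) +ₚ []      = a ∷ f
  (a ∷ f) +ₚ (b ∷ g) = a + b ∷ f +ₚ g

  _·_ : Carrier → Poly → Poly
  a · f = map (a *_) f

  -ₚ_ : Poly → Poly
  -ₚ f = map (λ a → - a) f

  _*ₚ_ : Poly → Poly → Poly
  []      *ₚ g = []
  (a ∷ f) *ₚ g = a · g +ₚ (0# ∷ f *ₚ g)

  coeff-+ : ∀ f g n → coeff (f +ₚ g) n ≈ coeff f n + coeff g n
  coeff-+ []      g       n       = sym (+-identityˡ _)
  coeff-+ (a ∷ f) []      n       = sym (+-identityʳ _)
  coeff-+ (a ∷ f) (b ∷ g) zero    = refl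
  coeff-+ (a ∷ f) (b ∷ g) (suc n) = coeff-+ f g n

  coeff-· : ∀ a f n → coeff (a · f) n ≈ a * coeff f n
  coeff-· a []      n       = sym (zeroʳ a)
  coeff-· a (b ∷ f) zero    = refl
  coeff-· a (b ∷ f) (suc n) = coeff-· a f n

  coeff-neg : ∀ f n → coeff (-ₚ f) n ≈ - coeff f n
  coeff-neg []      n       = sym -0#≈0#
    where open import Algebra.Properties.Ring ring
  coeff-neg (a ∷ f) zero    = refl
  coeff-neg (a ∷ f) (suc n) = coeff-neg f n

  infixr 5 _∷-cong_
  _∷-cong_ : ∀ {a b f g} → a ≈ b → f ≈ₚ g → a ∷ f ≈ₚ b ∷ g
  (a≈b ∷-cong f≈g) .at zero    = a≈b
  (a≈b ∷-cong f≈g) .at (suc n) = at f≈g n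

  head≈ : ∀ {a b f g} → a ∷ f ≈ₚ b ∷ g → a ≈ b
  head≈ e = at e 0

  tail≈ : ∀ {a b f g} → a ∷ f ≈ₚ b ∷ g → f ≈ₚ g
  tail≈ e .at n = at e (suc n)

  tail≈[] : ∀ {a f} → a ∷ f ≈ₚ [] → f ≈ₚ []
  tail≈[] e .at n = at e (suc n)

  ∷≈[] : ∀ {a f} → a ≈ 0# → f ≈ₚ [] → a ∷ f ≈ₚ []
  ∷≈[] a≈0 f≈0 .at zero    = a≈0
  ∷≈[] a≈0 f≈0 .at (suc n) = at f≈0 n

  private
    ≈ₚ-refl : ∀ {f} → f ≈ₚ f
    ≈ₚ-refl .at n = refl

    ≈ₚ-sym : ∀ {f g} → f ≈ₚ g → g ≈ₚ f
    ≈ₚ-sym e .at n = sym (at e n)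

    ≈ₚ-trans : ∀ {f g h} → f ≈ₚ g → g ≈ₚ h → f ≈ₚ h
    ≈ₚ-trans d e .at n = trans (at d n) (at e n)

    +ₚ-cong : ∀ {f g h k} → f ≈ₚ g → h ≈ₚ k → f +ₚ h ≈ₚ g +ₚ k
    +ₚ-cong {f} {g} {h} {k} d e .at n =
      trans (coeff-+ f h n) (trans (+-cong (at d n) (at e n)) (sym (coeff-+ g k n)))

    +ₚ-assoc : ∀ f g h → (f +ₚ g) +ₚ h ≈ₚ f +ₚ (g +ₚ h)
    +ₚ-assoc f g h .at n = begin
      coeff ((f +ₚ g) +ₚ h) n               ≈⟨ coeff-+ (f +ₚ g) h n ⟩
      coeff (f +ₚ g) n + coeff h n          ≈⟨ +-congʳ (coeff-+ f g n) ⟩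
      (coeff f n + coeff g n) + coeff h n   ≈⟨ +-assoc _ _ _ ⟩
      coeff f n + (coeff g n + coeff h n)   ≈⟨ +-congˡ (coeff-+ g h n) ⟨
      coeff f n + coeff (g +ₚ h) n          ≈⟨ coeff-+ f (g +ₚ h) n ⟨
      coeff (f +ₚ (g +ₚ h)) n               ∎

    +ₚ-comm : ∀ f g → f +ₚ g ≈ₚ g +ₚ f
    +ₚ-comm f g .at n = trans (coeff-+ f g n) (trans (+-comm _ _) (sym (coeff-+ g f n)))

    +ₚ-inverseˡ : ∀ f → -ₚ f +ₚ f ≈ₚ []
    +ₚ-inverseˡ f .at n =
      trans (coeff-+ (-ₚ f) f n) (trans (+-congʳ (coeff-neg f n)) (-‿inverseˡ _))

    neg-cong : ∀ {f g} → f ≈ₚ g → -ₚ f ≈ₚ -ₚ g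
    neg-cong {f} {g} e .at n = trans (coeff-neg f n) (trans (-‿cong (at e n)) (sym (coeff-neg g n)))

    +ₚ-identityʳ : ∀ f → f +ₚ [] ≈ₚ f
    +ₚ-identityʳ []      = ≈ₚ-refl
    +ₚ-identityʳ (a ∷ f) = ≈ₚ-refl

    +-interchange : ∀ w x y z → (w + x) + (y + z) ≈ (w + y) + (x + z)
    +-interchange = solve 4 (λ w x y z → (w :+ x) :+ (y :+ z) := (w :+ y) :+ (x :+ z)) refl

    +ₚ-interchange : ∀ f g h k → (f +ₚ g) +ₚ (h +ₚ k) ≈ₚ (f +ₚ h) +ₚ (g +ₚ k)
    +ₚ-interchange f g h k .at n = begin
      coeff ((f +ₚ g) +ₚ (h +ₚ k)) n                          ≈⟨ coeff-+ (f +ₚ g) (h +ₚ k) n ⟩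
      coeff (f +ₚ g) n + coeff (h +ₚ k) n                     ≈⟨ +-cong (coeff-+ f g n) (coeff-+ h k n) ⟩
      (coeff f n + coeff g n) + (coeff h n + coeff k n)       ≈⟨ +-interchange _ _ _ _ ⟩
      (coeff f n + coeff h n) + (coeff g n + coeff k n)       ≈⟨ +-cong (coeff-+ f h n) (coeff-+ g k n) ⟨
      coeff (f +ₚ h) n + coeff (g +ₚ k) n                     ≈⟨ coeff-+ (f +ₚ h) (g +ₚ k) n ⟨
      coeff ((f +ₚ h) +ₚ (g +ₚ k)) n                          ∎

  ·-cong : ∀ {a b f g} → a ≈ b → f ≈ₚ g → a · f ≈ₚ b · g
  ·-cong {a} {b} {f} {g} a≈b e .at n =
    trans (coeff-· a f n) (trans (*-cong a≈b (at e n)) (sym (coeff-· b g n)))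

  ·-zeroˡ : ∀ {a} f → a ≈ 0# → a · f ≈ₚ []
  ·-zeroˡ {a} f a≈0 .at n = trans (coeff-· a f n) (trans (*-congʳ a≈0) (zeroˡ _))

  ·-distribˡ : ∀ a f g → a · (f +ₚ g) ≈ₚ a · f +ₚ a · g
  ·-distribˡ a f g .at n = begin
    coeff (a · (f +ₚ g)) n              ≈⟨ coeff-· a (f +ₚ g) n ⟩
    a * coeff (f +ₚ g) n                ≈⟨ *-congˡ (coeff-+ f g n) ⟩
    a * (coeff f n + coeff g n)         ≈⟨ distribˡ _ _ _ ⟩
    a * coeff f n + a * coeff g n       ≈⟨ +-cong (coeff-· a f n) (coeff-· a g n) ⟨
    coeff (a · f) n + coeff (a · g) n   ≈⟨ coeff-+ (a · f) (a · g) n ⟨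
    coeff (a · f +ₚ a · g) n            ∎

  ·-assoc : ∀ a b f → a · (b · f) ≈ₚ (a * b) · f
  ·-assoc a b f .at n = begin
    coeff (a · (b · f)) n   ≈⟨ coeff-· a (b · f) n ⟩
    a * coeff (b · f) n     ≈⟨ *-congˡ (coeff-· b f n) ⟩
    a * (b * coeff f n)     ≈⟨ *-assoc a b _ ⟨
    a * b * coeff f n       ≈⟨ coeff-· (a * b) f n ⟨
    coeff ((a * b) · f) n   ∎

  private
    *ₚ-zeroˡ : ∀ {f} g → f ≈ₚ [] → f *ₚ g ≈ₚ []
    *ₚ-zeroˡ {[]}    g e = ≈ₚ-refl
    *ₚ-zeroˡ {a ∷ f} g e = ≈ₚ-trans
      (+ₚ-cong (·-zeroˡ g (at e 0)) (∷≈[] refl (*ₚ-zeroˡ g (tail≈[] e)))) ≈ₚ-refl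

    *ₚ-congˡ : ∀ f {g h} → g ≈ₚ h → f *ₚ g ≈ₚ f *ₚ h
    *ₚ-congˡ []      e = ≈ₚ-refl
    *ₚ-congˡ (a ∷ f) e = +ₚ-cong (·-cong refl e) (refl ∷-cong *ₚ-congˡ f e)

    *ₚ-congʳ : ∀ {f g} h → f ≈ₚ g → f *ₚ h ≈ₚ g *ₚ h
    *ₚ-congʳ {[]}    {g}     h e = ≈ₚ-sym (*ₚ-zeroˡ h (≈ₚ-sym e))
    *ₚ-congʳ {a ∷ f} {[]}    h e = *ₚ-zeroˡ h e
    *ₚ-congʳ {a ∷ f} {b ∷ g} h e =
      +ₚ-cong (·-cong (head≈ e) ≈ₚ-refl) (refl ∷-cong *ₚ-congʳ h (tail≈ e))

    *ₚ-cong : ∀ {f g h k} → f ≈ₚ g → h ≈ₚ k → f *ₚ h ≈ₚ g *ₚ k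
    *ₚ-cong {g = g} {h = h} d e = ≈ₚ-trans (*ₚ-congʳ h d) (*ₚ-congˡ g e)

    *ₚ-zeroʳ : ∀ f → f *ₚ [] ≈ₚ []
    *ₚ-zeroʳ []      = ≈ₚ-refl
    *ₚ-zeroʳ (a ∷ f) = ∷≈[] refl (*ₚ-zeroʳ f)

    -- The recursion that defines the product, mirrored to the right factor; commutativity then
    -- follows by induction.
    *ₚ-∷ : ∀ f b g → f *ₚ (b ∷ g) ≈ₚ b · f +ₚ (0# ∷ f *ₚ g)
    *ₚ-∷ []      b g = ≈ₚ-sym (∷≈[] refl ≈ₚ-refl)
    *ₚ-∷ (a ∷ f) b g = (trans (+-identityʳ _) (trans (*-comm a b) (sym (+-identityʳ _)))) ∷-cong
      ≈ₚ-trans (+ₚ-cong (≈ₚ-refl {a · g}) (*ₚ-∷ f b g))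
      (≈ₚ-trans (≈ₚ-sym (+ₚ-assoc (a · g) (b · f) _))
      (≈ₚ-trans (+ₚ-cong (+ₚ-comm (a · g) (b · f)) ≈ₚ-refl)
      (+ₚ-assoc (b · f) (a · g) _)))

    *ₚ-comm : ∀ f g → f *ₚ g ≈ₚ g *ₚ f
    *ₚ-comm []      g = ≈ₚ-sym (*ₚ-zeroʳ g)
    *ₚ-comm (a ∷ f) g = ≈ₚ-trans (+ₚ-cong (≈ₚ-refl {a · g}) (refl ∷-cong *ₚ-comm f g)) (≈ₚ-sym (*ₚ-∷ g a f))

    *ₚ-distribˡ : ∀ f g h → f *ₚ (g +ₚ h) ≈ₚ f *ₚ g +ₚ f *ₚ h
    *ₚ-distribˡ []      g h = ≈ₚ-refl
    *ₚ-distribˡ (a ∷ f) g h = ≈ₚ-trans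
      (+ₚ-cong (·-distribˡ a g h) (sym (+-identityʳ 0#) ∷-cong *ₚ-distribˡ f g h))
      (+ₚ-interchange (a · g) (a · h) (0# ∷ f *ₚ g) (0# ∷ f *ₚ h))

    *ₚ-distribʳ : ∀ f g h → (g +ₚ h) *ₚ f ≈ₚ g *ₚ f +ₚ h *ₚ f
    *ₚ-distribʳ f g h = ≈ₚ-trans (*ₚ-comm (g +ₚ h) f)
      (≈ₚ-trans (*ₚ-distribˡ f g h) (+ₚ-cong (*ₚ-comm f g) (*ₚ-comm f h)))

  ·-*ₚ : ∀ a f g → (a · f) *ₚ g ≈ₚ a · (f *ₚ g)
  ·-*ₚ a []      g = ≈ₚ-refl
  ·-*ₚ a (b ∷ f) g = ≈ₚ-trans
    (+ₚ-cong (≈ₚ-sym (·-assoc a b g)) (sym (zeroʳ a) ∷-cong ·-*ₚ a f g))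
    (≈ₚ-sym (·-distribˡ a (b · g) (0# ∷ f *ₚ g)))

  0∷-*ₚ : ∀ f g → (0# ∷ f) *ₚ g ≈ₚ 0# ∷ f *ₚ g
  0∷-*ₚ f g = +ₚ-cong (·-zeroˡ g refl) ≈ₚ-refl

  private
    *ₚ-assoc : ∀ f g h → (f *ₚ g) *ₚ h ≈ₚ f *ₚ (g *ₚ h)
    *ₚ-assoc []      g h = ≈ₚ-refl
    *ₚ-assoc (a ∷ f) g h = ≈ₚ-trans (*ₚ-distribʳ h (a · g) (0# ∷ f *ₚ g))
      (+ₚ-cong (·-*ₚ a g h) (≈ₚ-trans (0∷-*ₚ (f *ₚ g) h) (refl ∷-cong *ₚ-assoc f g h)))

  1ₚ : Poly
  1ₚ = 1# ∷ []

  private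
    *ₚ-identityˡ : ∀ f → 1ₚ *ₚ f ≈ₚ f
    *ₚ-identityˡ f .at n = begin
      coeff (1# · f +ₚ (0# ∷ [])) n           ≈⟨ coeff-+ (1# · f) (0# ∷ []) n ⟩
      coeff (1# · f) n + coeff (0# ∷ []) n    ≈⟨ +-cong (coeff-· 1# f n) (at (∷≈[] refl ≈ₚ-refl) n) ⟩
      1# * coeff f n + 0#                     ≈⟨ trans (+-identityʳ _) (*-identityˡ _) ⟩
      coeff f n                               ∎

  polynomialRing : CommutativeRing 0ℓ 0ℓ
  polynomialRing = record
    { Carrier = Poly ; _≈_ = _≈ₚ_ ; _+_ = _+ₚ_ ; _*_ = _*ₚ_ ; -_ = -ₚ_ ; 0# = [] ; 1# = 1ₚ
    ; isCommutativeRing = record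
      { isRing = record
        { +-isAbelianGroup = record
          { isGroup = record
            { isMonoid = record
              { isSemigroup = record
                { isMagma = record
                  { isEquivalence = record { refl = ≈ₚ-refl ; sym = ≈ₚ-sym ; trans = ≈ₚ-trans }
                  ; ∙-cong = +ₚ-cong
                  }
                ; assoc = +ₚ-assoc
                }
              ; identity = (λ f → ≈ₚ-refl) , +ₚ-identityʳ
              }
            ; inverse = +ₚ-inverseˡ , λ f → ≈ₚ-trans (+ₚ-comm f (-ₚ f)) (+ₚ-inverseˡ f)
            ; ⁻¹-cong = neg-cong
            }
          ; comm = +ₚ-comm
          }
        ; *-cong = *ₚ-cong
        ; *-assoc = *ₚ-assoc
        ; *-identity = *ₚ-identityˡ , λ f → ≈ₚ-trans (*ₚ-comm f 1ₚ) (*ₚ-identityˡ f)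
        ; distrib = *ₚ-distribˡ , *ₚ-distribʳ
        }
      ; *-comm = *ₚ-comm
      }
    }

-- Degree bounds, the Euler operator X d/dX and Bézout data.

module PolynomialProperties (R : CommutativeRing 0ℓ 0ℓ) where

  open CommutativeRing R hiding (zero)
  open Polynomial R public
  private module R-Reasoning = SetoidReasoning setoid
  open import Algebra.Definitions.RawMonoid +-rawMonoid using () renaming (_×_ to _⊛_)

  private
    module P = CommutativeRing polynomialRing
    module P-Reasoning = SetoidReasoning P.setoid
    module PS = NatSolver P.commutativeSemiring

  shift : ℕ → Poly → Poly
  shift zero    f = f
  shift (suc k) f = 0# ∷ shift k f

  monomial : Carrier → ℕ → Poly
  monomial a k = shift k (a ∷ [])

  coeff-shift : ∀ k f i → coeff (shift k f) (k ℕ.+ i) ≡ coeff f i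
  coeff-shift zero    f i = ≡.refl
  coeff-shift (suc k) f i = coeff-shift k f i

  coeff-shift-< : ∀ k f {i} → i ℕ.< k → coeff (shift k f) i ≡ 0#
  coeff-shift-< (suc k) f {zero}  _           = ≡.refl
  coeff-shift-< (suc k) f {suc i} (ℕ.s≤s i<k) = coeff-shift-< k f i<k

  shift-cong : ∀ k {f g} → f ≈ₚ g → shift k f ≈ₚ shift k g
  shift-cong zero    e = e
  shift-cong (suc k) e = refl ∷-cong shift-cong k e

  shift-* : ∀ k f g → shift k f *ₚ g ≈ₚ shift k (f *ₚ g)
  shift-* zero    f g = P.refl
  shift-* (suc k) f g = P.trans (0∷-*ₚ (shift k f) g) (refl ∷-cong shift-* k f g)

  constant-* : ∀ a f → (a ∷ []) *ₚ f ≈ₚ a · f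
  constant-* a f = P.trans (P.+-congˡ (∷≈[] refl P.refl)) (P.+-identityʳ _)

  monomial-* : ∀ a k f → monomial a k *ₚ f ≈ₚ shift k (a · f)
  monomial-* a k f = P.trans (shift-* k (a ∷ []) f) (shift-cong k (constant-* a f))

  coeff-*-0 : ∀ f g → coeff (f *ₚ g) 0 ≈ coeff f 0 * coeff g 0
  coeff-*-0 []      g = sym (zeroˡ _)
  coeff-*-0 (a ∷ f) g = trans (coeff-+ (a · g) (0# ∷ f *ₚ g) 0) (trans (+-identityʳ _) (coeff-· a g 0))

  coeff-*-1 : ∀ f g → coeff (f *ₚ g) 1 ≈ coeff f 0 * coeff g 1 + coeff f 1 * coeff g 0
  coeff-*-1 []      g = sym (trans (+-cong (zeroˡ _) (zeroˡ _)) (+-identityʳ _))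
  coeff-*-1 (a ∷ f) g = trans (coeff-+ (a · g) (0# ∷ f *ₚ g) 1) (+-cong (coeff-· a g 1) (coeff-*-0 f g))

  -- A bound in place of a degree: trailing zeros are allowed and equality with `0#` need not be
  -- decidable here, so no degree can be read off the list.
  Deg< : ℕ → Poly → Set
  Deg< n f = ∀ i → n ℕ.≤ i → coeff f i ≈ 0#

  Deg<-0 : ∀ {f} → Deg< 0 f → f ≈ₚ []
  Deg<-0 d .at n = d n ℕ.z≤n

  Deg<-mono : ∀ {m n f} → m ℕ.≤ n → Deg< m f → Deg< n f
  Deg<-mono m≤n d i n≤i = d i (ℕP.≤-trans m≤n n≤i)

  Deg<-+ : ∀ {n} f g → Deg< n f → Deg< n g → Deg< n (f +ₚ g)
  Deg<-+ f g df dg i n≤i = trans (coeff-+ f g i) (trans (+-cong (df i n≤i) (dg i n≤i)) (+-identityʳ _))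

  Deg<-suc : ∀ {n} f → Deg< (suc n) f → coeff f n ≈ 0# → Deg< n f
  Deg<-suc {n} f d e i n≤i with n ℕP.≟ i
  ... | yes ≡.refl = e
  ... | no  n≢i    = d i (ℕP.≤∧≢⇒< n≤i n≢i)

  Deg<-* : ∀ {a b} f g → Deg< (suc a) f → Deg< (suc b) g → Deg< (suc (a ℕ.+ b)) (f *ₚ g)
  Deg<-* []      g df dg i _ = refl
  Deg<-* {a} {b} (c ∷ f) g df dg (suc j) (ℕ.s≤s a+b≤j) = begin
    coeff (c · g +ₚ (0# ∷ f *ₚ g)) (suc j)      ≈⟨ coeff-+ (c · g) (0# ∷ f *ₚ g) (suc j) ⟩
    coeff (c · g) (suc j) + coeff (f *ₚ g) j    ≈⟨ +-cong (coeff-· c g (suc j)) (rest a df a+b≤j) ⟩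
    c * coeff g (suc j) + 0#                    ≈⟨ +-identityʳ _ ⟩
    c * coeff g (suc j)                         ≈⟨ *-congˡ (dg (suc j) (ℕ.s≤s (ℕP.m+n≤o⇒n≤o a a+b≤j))) ⟩
    c * 0#                                      ≈⟨ zeroʳ c ⟩
    0#                                          ∎
    where
    open R-Reasoning
    rest : ∀ a → Deg< (suc a) (c ∷ f) → a ℕ.+ b ℕ.≤ j → coeff (f *ₚ g) j ≈ 0#
    rest zero     df _     = at (P.trans (P.*-congʳ {g} {f} {[]} (Deg<-0 (λ i _ → df (suc i) (ℕ.s≤s ℕ.z≤n)))) P.refl) j
    rest (suc a′) df a+b≤j = Deg<-* {a′} f g (λ i a<i → df (suc i) (ℕ.s≤s a<i)) dg j a+b≤j

  leading-* : ∀ {a b} f g → Deg< (suc a) f → Deg< (suc b) g →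
              coeff (f *ₚ g) (a ℕ.+ b) ≈ coeff f a * coeff g b
  leading-* []      g df dg = sym (zeroˡ _)
  leading-* {zero} {b} (c ∷ f) g df dg = begin
    coeff (c · g +ₚ (0# ∷ f *ₚ g)) b                 ≈⟨ at (P.+-congˡ {c · g} (∷≈[] refl f*g≈0)) b ⟩
    coeff (c · g +ₚ []) b                            ≈⟨ at (P.+-identityʳ (c · g)) b ⟩
    coeff (c · g) b                                  ≈⟨ coeff-· c g b ⟩
    c * coeff g b                                    ∎
    where
    open R-Reasoning
    f*g≈0 : f *ₚ g ≈ₚ []
    f*g≈0 = P.*-congʳ {g} {f} {[]} (Deg<-0 (λ i _ → df (suc i) (ℕ.s≤s ℕ.z≤n)))
  leading-* {suc a} {b} (c ∷ f) g df dg = begin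
    coeff (c · g +ₚ (0# ∷ f *ₚ g)) (suc (a ℕ.+ b))              ≈⟨ coeff-+ (c · g) (0# ∷ f *ₚ g) (suc (a ℕ.+ b)) ⟩
    coeff (c · g) (suc (a ℕ.+ b)) + coeff (f *ₚ g) (a ℕ.+ b)    ≈⟨ +-congʳ (coeff-· c g (suc (a ℕ.+ b))) ⟩
    c * coeff g (suc (a ℕ.+ b)) + coeff (f *ₚ g) (a ℕ.+ b)
      ≈⟨ +-cong (trans (*-congˡ (dg _ (ℕ.s≤s (ℕP.m≤n+m b a)))) (zeroʳ c)) (leading-* {a} f g (λ i a<i → df (suc i) (ℕ.s≤s a<i)) dg) ⟩
    0# + coeff f a * coeff g b                                  ≈⟨ +-identityˡ _ ⟩
    coeff f a * coeff g b                                       ∎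
    where open R-Reasoning

  -- X d/dX
  θ : Poly → Poly
  θ []      = []
  θ (a ∷ f) = 0# ∷ f +ₚ θ f

  coeff-θ : ∀ f n → coeff (θ f) n ≈ n ⊛ coeff f n
  coeff-θ []      zero    = refl
  coeff-θ []      (suc n) = sym (trans (+-identityˡ _) (sym (coeff-θ [] n)))
  coeff-θ (a ∷ f) zero    = refl
  coeff-θ (a ∷ f) (suc n) = trans (coeff-+ f (θ f) n) (+-congˡ (coeff-θ f n))

  θ-cong : ∀ {f g} → f ≈ₚ g → θ f ≈ₚ θ g
  θ-cong {f} {g} e .at n = trans (coeff-θ f n) (trans (×-congʳ n (at e n)) (sym (coeff-θ g n)))
    where open import Algebra.Properties.Monoid.Mult +-monoid

  Deg<-θ : ∀ {n} f → Deg< n f → Deg< n (θ f)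
  Deg<-θ f d i n≤i = trans (coeff-θ f i) (trans (×-congʳ i (d i n≤i)) (sym (coeff-θ [] i)))
    where open import Algebra.Properties.Monoid.Mult +-monoid

  private
    θ-+ : ∀ f g → θ (f +ₚ g) ≈ₚ θ f +ₚ θ g
    θ-+ []      g       = P.refl
    θ-+ (a ∷ f) []      = P.refl
    θ-+ (a ∷ f) (b ∷ g) = sym (+-identityʳ 0#) ∷-cong
      P.trans (P.+-congˡ (θ-+ f g))
      (PS.solve 4 (λ f g h k → (f PS.:+ g) PS.:+ (h PS.:+ k) PS.:= (f PS.:+ h) PS.:+ (g PS.:+ k)) P.refl f g (θ f) (θ g))

    θ-· : ∀ a f → θ (a · f) ≈ₚ a · θ f
    θ-· a []      = P.refl
    θ-· a (b ∷ f) = sym (zeroʳ a) ∷-cong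
      P.trans (P.+-congˡ {a · f} (θ-· a f)) (P.sym (·-distribˡ a f (θ f)))

  θ-* : ∀ f g → θ (f *ₚ g) ≈ₚ θ f *ₚ g +ₚ f *ₚ θ g
  θ-* []      g = P.refl
  θ-* (a ∷ f) g = begin
    θ (a · g +ₚ (0# ∷ f *ₚ g))                                    ≈⟨ θ-+ (a · g) (0# ∷ f *ₚ g) ⟩
    θ (a · g) +ₚ (0# ∷ f *ₚ g +ₚ θ (f *ₚ g))
      ≈⟨ P.+-cong (θ-· a g) (refl ∷-cong P.+-congˡ {f *ₚ g} (θ-* f g)) ⟩
    a · θ g +ₚ (0# ∷ f *ₚ g +ₚ (θ f *ₚ g +ₚ f *ₚ θ g))            ≈⟨ P.+-congˡ {a · θ g} (sym (+-identityʳ 0#) ∷-cong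
      PS.solve 4 (λ f g t s → f PS.:* g PS.:+ (t PS.:* g PS.:+ f PS.:* s) PS.:= (f PS.:+ t) PS.:* g PS.:+ f PS.:* s) P.refl f g (θ f) (θ g)) ⟩
    a · θ g +ₚ ((0# ∷ (f +ₚ θ f) *ₚ g) +ₚ (0# ∷ f *ₚ θ g))        ≈⟨ P.+-congˡ {a · θ g} (P.+-congʳ (0∷-*ₚ (f +ₚ θ f) g)) ⟨
    a · θ g +ₚ ((0# ∷ f +ₚ θ f) *ₚ g +ₚ (0# ∷ f *ₚ θ g))
      ≈⟨ PS.solve 3 (λ x y z → x PS.:+ (y PS.:+ z) PS.:= y PS.:+ (x PS.:+ z)) P.refl (a · θ g) ((0# ∷ f +ₚ θ f) *ₚ g) (0# ∷ f *ₚ θ g) ⟩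
    (0# ∷ f +ₚ θ f) *ₚ g +ₚ (a ∷ f) *ₚ θ g                        ∎
    where open P-Reasoning

  -- Both cofactors are stored since `b/gcd` becomes the second factor g of X^q - 1, while
  -- `combination` expresses the first factor modulo X^q - 1 as a multiple of N.
  record Bézout (a b : Poly) : Set where
    field
      gcd u v a/gcd b/gcd : Poly
      combination : gcd ≈ₚ u *ₚ a +ₚ v *ₚ b
      gcd∣a       : a ≈ₚ gcd *ₚ a/gcd
      gcd∣b       : b ≈ₚ gcd *ₚ b/gcd

  Bézout-sym : ∀ {a b} → Bézout a b → Bézout b a
  Bézout-sym {a} {b} B = record
    { gcd = gcd ; u = v ; v = u ; a/gcd = b/gcd ; b/gcd = a/gcd
    ; combination = P.trans combination (P.+-comm (u *ₚ a) (v *ₚ b)) ; gcd∣a = gcd∣b ; gcd∣b = gcd∣a }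
    where open Bézout B

  Bézout-congˡ : ∀ {a a′ b} → a ≈ₚ a′ → Bézout a b → Bézout a′ b
  Bézout-congˡ e B = record
    { Bézout B
    ; combination = P.trans combination (P.+-congʳ (P.*-congˡ {u} e)) ; gcd∣a = P.trans (P.sym e) gcd∣a }
    where open Bézout B

  Bézout-0ʳ : ∀ {a b} → b ≈ₚ [] → Bézout a b
  Bézout-0ʳ {a} {b} b≈0 = record
    { gcd = a ; u = 1ₚ ; v = [] ; a/gcd = 1ₚ ; b/gcd = []
    ; combination = PS.solve 1 (λ a → a PS.:= PS.con 1 PS.:* a PS.:+ PS.con 0) P.refl a
    ; gcd∣a = P.sym (P.*-identityʳ a) ; gcd∣b = P.trans b≈0 (P.sym (P.zeroʳ a)) }

  -- One Euclidean step undone: the ideal generated by a and b does not change when k b is added to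
  -- a, and subtracting u k from v compensates.
  Bézout-step : ∀ {a b} k → Bézout a b → Bézout (a +ₚ k *ₚ b) b
  Bézout-step {a} {b} k B = record
    { gcd = gcd ; u = u ; v = v +ₚ -ₚ (u *ₚ k) ; a/gcd = a/gcd +ₚ k *ₚ b/gcd ; b/gcd = b/gcd
    ; combination = begin
        gcd                                                            ≈⟨ combination ⟩
        u *ₚ a +ₚ v *ₚ b
          ≈⟨ PS.solve 4 (λ u a v b → u PS.:* a PS.:+ v PS.:* b PS.:= u PS.:* a PS.:+ (v PS.:+ PS.con 0) PS.:* b) P.refl u a v b ⟩
        u *ₚ a +ₚ (v +ₚ []) *ₚ b
          ≈⟨ P.+-congˡ {u *ₚ a} (P.*-congʳ {b} (P.+-congˡ {v} (P.-‿inverseʳ (u *ₚ k)))) ⟨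
        u *ₚ a +ₚ (v +ₚ (u *ₚ k +ₚ -ₚ (u *ₚ k))) *ₚ b
          ≈⟨ PS.solve 6 (λ u a v b k w → u PS.:* a PS.:+ (v PS.:+ (u PS.:* k PS.:+ w)) PS.:* b PS.:= u PS.:* (a PS.:+ k PS.:* b) PS.:+ (v PS.:+ w) PS.:* b) P.refl u a v b k (-ₚ (u *ₚ k)) ⟩
        u *ₚ (a +ₚ k *ₚ b) +ₚ (v +ₚ -ₚ (u *ₚ k)) *ₚ b                  ∎
    ; gcd∣a = begin
        a +ₚ k *ₚ b                               ≈⟨ P.+-cong gcd∣a (P.*-congˡ {k} gcd∣b) ⟩
        gcd *ₚ a/gcd +ₚ k *ₚ (gcd *ₚ b/gcd)
          ≈⟨ PS.solve 4 (λ f x k y → f PS.:* x PS.:+ k PS.:* (f PS.:* y) PS.:= f PS.:* (x PS.:+ k PS.:* y)) P.refl gcd a/gcd k b/gcd ⟩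
        gcd *ₚ (a/gcd +ₚ k *ₚ b/gcd)              ∎
    ; gcd∣b = gcd∣b }
    where
    open Bézout B
    open P-Reasoning

  X^_-𝟏 : ℕ → Poly
  X^ q -𝟏 = shift q 1ₚ +ₚ (- 1# ∷ [])

  module _ (k : ℕ) where
    -- With the exponent in this form the constant and linear coefficients of X^q - 1 compute, and
    -- the linear one is visibly zero.
    private q = 2 ℕ.+ k

    coeff-X^q-1-0 : coeff X^ q -𝟏 0 ≈ - 1#
    coeff-X^q-1-0 = +-identityˡ _

    coeff-X^q-1-1 : coeff X^ q -𝟏 1 ≈ 0#
    coeff-X^q-1-1 = reflexive (≡.cong (λ f → coeff f 1) {x = X^ q -𝟏} {y = (0# + - 1#) ∷ 0# ∷ shift k 1ₚ} ≡.refl)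

    coeff-X^q-1-q : coeff X^ q -𝟏 q ≈ 1#
    coeff-X^q-1-q = reflexive (≡.trans (≡.cong (coeff (shift k 1ₚ)) (≡.sym (ℕP.+-identityʳ k))) (coeff-shift k 1ₚ 0))

    Deg<-X^q-1 : Deg< (suc q) X^ q -𝟏
    Deg<-X^q-1 (suc (suc i)) (ℕ.s≤s (ℕ.s≤s k<i)) =
      reflexive (≡.trans (≡.cong (coeff (shift k 1ₚ)) (≡.trans (≡.sym (ℕP.m+[n∸m]≡n k<i)) (≡.sym (ℕP.+-suc k (i ℕ.∸ suc k))))) (coeff-shift k 1ₚ (suc (i ℕ.∸ suc k))))

    -- The constant term gets the factor 0 and the top term the factor q, which is 1 in the ring.
    -- Since X d/dX preserves exponents, the result is X^q, hence 1 modulo X^q - 1.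
    θ-X^q-1 : q ⊛ 1# ≈ 1# → θ X^ q -𝟏 ≈ₚ shift q 1ₚ
    θ-X^q-1 q≈1 .at n = trans (coeff-θ X^ q -𝟏 n) (go n)
      where
      open import Algebra.Properties.Monoid.Mult +-monoid
      go : ∀ n → n ⊛ coeff X^ q -𝟏 n ≈ coeff (shift q 1ₚ) n
      go 0 = refl
      go 1 = +-identityʳ _
      go (suc (suc n)) with ℕP.<-cmp n k
      ... | tri< n<k _ _ = trans (×-congʳ (2 ℕ.+ n) e) (trans (sym (coeff-θ [] (2 ℕ.+ n))) (sym e))
        where
        e : coeff (shift k 1ₚ) n ≈ 0#
        e = reflexive (coeff-shift-< k 1ₚ n<k)
      ... | tri≈ _ ≡.refl _ = trans (×-congʳ q coeff-X^q-1-q) (trans q≈1 (sym coeff-X^q-1-q))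
      ... | tri> _ _ k<n = trans (×-congʳ (2 ℕ.+ n) e) (trans (sym (coeff-θ [] (2 ℕ.+ n))) (sym e))
        where
        e : coeff (shift k 1ₚ) n ≈ 0#
        e = Deg<-X^q-1 (2 ℕ.+ n) (ℕ.s≤s (ℕ.s≤s k<n))

-- The Euclidean algorithm over a field with decidable equality.

record IsDiscreteField (R : CommutativeRing 0ℓ 0ℓ) : Set where
  open CommutativeRing R
  field
    ≈0?           : ∀ x → Dec (x ≈ 0#)
    ≉0⇒invertible : ∀ x → ¬ x ≈ 0# → ∃ λ y → y * x ≈ 1#
    1≉0           : ¬ 1# ≈ 0#

module FieldPolynomial (R : CommutativeRing 0ℓ 0ℓ) (R-field : IsDiscreteField R) where

  open IsDiscreteField R-field
  open CommutativeRing R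
  open PolynomialProperties R public
  open SetoidReasoning setoid

  private
    module P = CommutativeRing polynomialRing

  cancelˡ-0 : ∀ {x y} → ¬ x ≈ 0# → x * y ≈ 0# → y ≈ 0#
  cancelˡ-0 {x} {y} x≉0 xy≈0 with ≉0⇒invertible x x≉0
  ... | z , zx≈1 = begin
    y             ≈⟨ *-identityˡ y ⟨
    1# * y        ≈⟨ *-congʳ zx≈1 ⟨
    z * x * y     ≈⟨ *-assoc z x y ⟩
    z * (x * y)   ≈⟨ *-congˡ xy≈0 ⟩
    z * 0#        ≈⟨ zeroʳ z ⟩
    0#            ∎

  *-≉0 : ∀ {x y} → ¬ x ≈ 0# → ¬ y ≈ 0# → ¬ x * y ≈ 0#
  *-≉0 x≉0 y≉0 xy≈0 = y≉0 (cancelˡ-0 x≉0 xy≈0)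

  HasDegree : Poly → ℕ → Set
  HasDegree f d = Deg< (suc d) f × ¬ coeff f d ≈ 0#

  zero⊎degree : ∀ f → f ≈ₚ [] ⊎ ∃ (HasDegree f)
  zero⊎degree []      = inj₁ P.refl
  zero⊎degree (a ∷ f) with zero⊎degree f
  ... | inj₂ (d , d< , ≉0) = inj₂ (suc d , (λ { (suc i) (ℕ.s≤s d<i) → d< i d<i }) , ≉0)
  ... | inj₁ f≈0 with ≈0? a
  ...   | yes a≈0 = inj₁ (∷≈[] a≈0 f≈0)
  ...   | no  a≉0 = inj₂ (0 , (λ { (suc i) _ → at f≈0 i }) , a≉0)

  private
    -- One step of long division: b is multiplied by the monomial of degree m - n whose coefficient
    -- is the quotient of the top coefficients, and the difference loses its coefficient at m.
    eliminate : ∀ m n {a b} → n ℕ.≤ m → Deg< (suc m) a → Deg< (suc n) b → ¬ coeff b n ≈ 0# →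
                ∃ λ k → ∃ λ r → Deg< m r × a ≈ₚ r +ₚ k *ₚ b
    eliminate m n {a} {b} n≤m da db b≉0 with ≉0⇒invertible (coeff b n) b≉0
    ... | z , z*b≈1 = k , a +ₚ -ₚ (k *ₚ b) , dr , P.sym (P.trans (P.+-assoc a _ _) (P.trans (P.+-congˡ (P.-‿inverseˡ (k *ₚ b))) (P.+-identityʳ a)))
      where
      j = m ℕ.∸ n
      c = coeff a m * z
      k = monomial c j
      coeff-kb : ∀ i → coeff (k *ₚ b) (j ℕ.+ i) ≈ c * coeff b i
      coeff-kb i = trans (at (monomial-* c j b) (j ℕ.+ i)) (trans (reflexive (coeff-shift j (c · b) i)) (coeff-· c b i))
      j+n≡m : j ℕ.+ n ≡ m
      j+n≡m = ℕP.m∸n+n≡m n≤m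
      top : coeff (k *ₚ b) m ≈ coeff a m
      top = begin
        coeff (k *ₚ b) m           ≡⟨ ≡.cong (coeff (k *ₚ b)) j+n≡m ⟨
        coeff (k *ₚ b) (j ℕ.+ n)   ≈⟨ coeff-kb n ⟩
        coeff a m * z * coeff b n  ≈⟨ *-assoc _ _ _ ⟩
        coeff a m * (z * coeff b n) ≈⟨ *-congˡ z*b≈1 ⟩
        coeff a m * 1#             ≈⟨ *-identityʳ _ ⟩
        coeff a m                  ∎
      above : Deg< (suc m) (k *ₚ b)
      above i m<i = begin
        coeff (k *ₚ b) i                  ≡⟨ ≡.cong (coeff (k *ₚ b)) j+[i∸j]≡i ⟨
        coeff (k *ₚ b) (j ℕ.+ (i ℕ.∸ j))  ≈⟨ coeff-kb (i ℕ.∸ j) ⟩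
        c * coeff b (i ℕ.∸ j)             ≈⟨ *-congˡ (db (i ℕ.∸ j) n<i∸j) ⟩
        c * 0#                            ≈⟨ zeroʳ c ⟩
        0#                                ∎
        where
        j+[i∸j]≡i : j ℕ.+ (i ℕ.∸ j) ≡ i
        j+[i∸j]≡i = ℕP.m+[n∸m]≡n (ℕP.≤-trans (ℕP.m∸n≤m m n) (ℕP.<⇒≤ m<i))
        n<i∸j : n ℕ.< i ℕ.∸ j
        n<i∸j = ℕP.+-cancelˡ-< j n (i ℕ.∸ j)
          (≡.subst₂ ℕ._<_ (≡.sym j+n≡m) (≡.sym j+[i∸j]≡i) m<i)
      coeff-r : ∀ i → coeff (a +ₚ -ₚ (k *ₚ b)) i ≈ coeff a i + - coeff (k *ₚ b) i
      coeff-r i = trans (coeff-+ a (-ₚ (k *ₚ b)) i) (+-congˡ (coeff-neg (k *ₚ b) i))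
      dr : Deg< m (a +ₚ -ₚ (k *ₚ b))
      dr = Deg<-suc (a +ₚ -ₚ (k *ₚ b))
        (λ i m<i → trans (coeff-r i) (trans (+-cong (da i m<i) (-‿cong (above i m<i))) (-‿inverseʳ 0#)))
        (trans (coeff-r m) (trans (+-congˡ (-‿cong top)) (-‿inverseʳ _)))

    -- The recursion runs over two degree bounds rather than over remainders. In every case one
    -- bound drops by exactly one, because a top coefficient is zero or because `eliminate` removes
    -- it, so termination is structural.
    bézout′ : ∀ m n {a b} → Deg< m a → Deg< n b → Bézout a b
    bézout′ zero    n       da db = Bézout-sym (Bézout-0ʳ (Deg<-0 da))
    bézout′ (suc m) zero    da db = Bézout-0ʳ (Deg<-0 db)
    bézout′ (suc m) (suc n) {a} {b} da db with ≈0? (coeff a m) | ≈0? (coeff b n)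
    ... | yes a≈0 | _       = bézout′ m (suc n) (Deg<-suc a da a≈0) db
    ... | no  a≉0 | yes b≈0 = bézout′ (suc m) n da (Deg<-suc b db b≈0)
    ... | no  a≉0 | no  b≉0 with ℕP.≤-total n m
    ...   | inj₁ n≤m = let k , r , dr , a≈ = eliminate m n n≤m da db b≉0
                       in Bézout-congˡ (P.sym a≈) (Bézout-step k (bézout′ m (suc n) dr db))
    ...   | inj₂ m≤n = let k , r , dr , b≈ = eliminate n m m≤n db da a≉0
                       in Bézout-sym (Bézout-congˡ (P.sym b≈) (Bézout-step k (Bézout-sym (bézout′ (suc m) n da dr))))

    bounded : ∀ f → ∃ λ n → Deg< n f
    bounded f with zero⊎degree f
    ... | inj₁ f≈0            = 0 , λ i _ → at f≈0 i
    ... | inj₂ (d , d< , _)   = suc d , d<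

  bézout : ∀ a b → Bézout a b
  bézout a b = bézout′ _ _ (proj₂ (bounded a)) (proj₂ (bounded b))

  Unit : Poly → Set
  Unit f = ∃ λ k → k *ₚ f ≈ₚ 1ₚ

-- Factors of X^q - 1 without linear term, from an idempotent.

module Factorisation (R : CommutativeRing 0ℓ 0ℓ) (R-field : IsDiscreteField R) (k : ℕ) where

  open IsDiscreteField R-field using (1≉0)
  open CommutativeRing R
  open FieldPolynomial R R-field
  open import Algebra.Definitions.RawMonoid +-rawMonoid using () renaming (_×_ to _⊛_)
  open import Algebra.Properties.Ring ring using (-0#≈0#; -‿involutive)

  private
    q = 2 ℕ.+ k
    Z = X^ q -𝟏
    module P = CommutativeRing polynomialRing
    module Q where
      open Quotient polynomialRing Z public
      open CommutativeRing quotientRing public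
      open NatSolver (CommutativeRing.commutativeSemiring quotientRing) public

  private module S = SetoidReasoning setoid

  degree-multiple : ∀ c {d} → HasDegree c d → ¬ coeff (c *ₚ Z) (d ℕ.+ q) ≈ 0#
  degree-multiple c (d< , ≉0) e =
    *-≉0 ≉0 (λ h → 1≉0 (trans (sym (coeff-X^q-1-q k)) h)) (trans (sym (leading-* c Z d< (Deg<-X^q-1 k))) e)

  -- X^q - 1 is monic of degree q, so a nonzero multiple has degree at least q. This turns
  -- congruences between reduced polynomials into equalities.
  multiple-small : ∀ {f c} → Deg< q f → f ≈ₚ c *ₚ Z → f ≈ₚ []
  multiple-small {f} {c} f< f≈cZ with zero⊎degree c
  ... | inj₁ c≈0      = P.trans f≈cZ (P.*-congʳ {Z} {c} {[]} c≈0)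
  ... | inj₂ (d , hd) = contradiction
    (trans (sym (at f≈cZ (d ℕ.+ q))) (f< _ (ℕP.m≤n+m q d))) (degree-multiple c hd)

  Z-nonunit : ¬ Unit Z
  Z-nonunit (c , cZ≈1) = 1≉0 (at (multiple-small {1ₚ} {c} (λ { (suc i) _ → refl }) (P.sym cZ≈1)) 0)

  -- The degrees force c to be constant, and a constant multiple of X^q - 1 has no linear term
  -- because q ≥ 2. The bound on f admits degree exactly q, which `W` may reach.
  mod-Z : ∀ f g c → Deg< (suc q) f → Deg< q g → f ≈ₚ g +ₚ c *ₚ Z → coeff f 1 ≈ coeff g 1
  mod-Z f g c f< g< e = begin
    coeff f 1                                                 ≈⟨ at e 1 ⟩
    coeff (g +ₚ c *ₚ Z) 1                                     ≈⟨ coeff-+ g (c *ₚ Z) 1 ⟩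
    coeff g 1 + coeff (c *ₚ Z) 1                              ≈⟨ +-congˡ (coeff-*-1 c Z) ⟩
    coeff g 1 + (coeff c 0 * coeff Z 1 + coeff c 1 * coeff Z 0) ≈⟨ +-congˡ (+-cong (*-congˡ (coeff-X^q-1-1 k)) (*-congʳ c₁≈0)) ⟩
    coeff g 1 + (coeff c 0 * 0# + 0# * coeff Z 0)             ≈⟨ +-congˡ (+-cong (zeroʳ _) (zeroˡ _)) ⟩
    coeff g 1 + (0# + 0#)                                     ≈⟨ trans (+-congˡ (+-identityʳ 0#)) (+-identityʳ _) ⟩
    coeff g 1                                                 ∎
    where
    open S
    c₁≈0 : coeff c 1 ≈ 0#
    c₁≈0 with zero⊎degree c
    ... | inj₁ c≈0               = at c≈0 1
    ... | inj₂ (zero  , c< , _)  = c< 1 ℕP.≤-refl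
    ... | inj₂ (suc d , hd) = contradiction (begin
      coeff (c *ₚ Z) n               ≈⟨ +-identityˡ _ ⟨
      0# + coeff (c *ₚ Z) n          ≈⟨ +-congʳ (g< n (ℕP.m≤n+m q (suc d))) ⟨
      coeff g n + coeff (c *ₚ Z) n   ≈⟨ coeff-+ g (c *ₚ Z) n ⟨
      coeff (g +ₚ c *ₚ Z) n          ≈⟨ at e n ⟨
      coeff f n                      ≈⟨ f< n (ℕ.s≤s (ℕP.m≤n+m q d)) ⟩
      0#                             ∎) (degree-multiple c hd)
      where n = suc d ℕ.+ q

  Z≉0 : ¬ Z ≈ₚ []
  Z≉0 Z≈0 = 1≉0 (trans (sym (coeff-X^q-1-q k)) (at Z≈0 q))

  factor-degrees : ∀ f g → f *ₚ g ≈ₚ Z → ∃₂ λ a b → Deg< (suc a) f × Deg< (suc b) g × a ℕ.+ b ℕ.≤ q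
  factor-degrees f g fg≈Z with zero⊎degree f | zero⊎degree g
  ... | inj₁ f≈0 | _        = contradiction (P.trans (P.sym fg≈Z) (P.*-congʳ {g} {f} {[]} f≈0)) Z≉0
  ... | inj₂ _   | inj₁ g≈0 = contradiction (P.trans (P.sym fg≈Z) (P.trans (P.*-congˡ {f} g≈0) (P.zeroʳ f))) Z≉0
  ... | inj₂ (a , f< , f≉0) | inj₂ (b , g< , g≉0) = a , b , f< , g< , ℕP.≮⇒≥ λ q<a+b →
    *-≉0 f≉0 g≉0 (trans (sym (leading-* f g f< g<)) (trans (at fg≈Z (a ℕ.+ b)) (Deg<-X^q-1 k _ q<a+b)))

  module _
    (q≈1 : q ⊛ 1# ≈ 1#) (N : Poly) (N< : Deg< q N)
    (N₀≈0 : coeff N 0 ≈ 0#) (N₁≈0 : coeff N 1 ≈ 0#) (N≉0 : ¬ N ≈ₚ [])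
    (N[1+N]≈0 : N *ₚ (1ₚ +ₚ N) Q.≈ₘ []) (B : Bézout N Z) where

    open Bézout B renaming (gcd to f; a/gcd to N/f; b/gcd to g; combination to f≈; gcd∣a to N≈; gcd∣b to Z≈)

    private
      Z≈ₘ0 : Z Q.≈ₘ []
      Z≈ₘ0 = Q.multiple 1ₚ (P.sym (P.*-identityˡ Z))

      f≈ₘuN : f Q.≈ₘ u *ₚ N
      f≈ₘuN = Q.multiple v f≈

      fg≈ₘ0 : f *ₚ g Q.≈ₘ []
      fg≈ₘ0 = Q.trans (Q.≈⇒≈ₘ (P.sym Z≈)) Z≈ₘ0

      X^q≈ₘ1 : shift q 1ₚ Q.≈ₘ 1ₚ
      X^q≈ₘ1 = Q.multiple 1ₚ (begin
        shift q 1ₚ                              ≈⟨ P.+-identityʳ _ ⟨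
        shift q 1ₚ +ₚ []                        ≈⟨ P.+-congˡ {shift q 1ₚ} (P.-‿inverseˡ 1ₚ) ⟨
        shift q 1ₚ +ₚ ((- 1# ∷ []) +ₚ 1ₚ)       ≈⟨ P.+-assoc (shift q 1ₚ) (- 1# ∷ []) 1ₚ ⟨
        Z +ₚ 1ₚ                                 ≈⟨ P.+-comm Z 1ₚ ⟩
        1ₚ +ₚ Z                                 ≈⟨ P.+-congˡ {1ₚ} (P.*-identityˡ Z) ⟨
        1ₚ +ₚ 1ₚ *ₚ Z                           ∎)
        where open SetoidReasoning P.setoid

      -- Modulo X^q - 1 this is the idempotent of the roots of f: it vanishes at the roots of g, and
      -- `W+fθg≈ₘ1` gives it the value 1 at the roots of f.
      W = θ f *ₚ g

      W+fθg≈ₘ1 : W +ₚ f *ₚ θ g Q.≈ₘ 1ₚ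
      W+fθg≈ₘ1 = Q.trans (Q.≈⇒≈ₘ (P.trans (P.sym (θ-* f g)) (P.trans (θ-cong (P.sym Z≈)) (θ-X^q-1 k q≈1)))) X^q≈ₘ1

      [1+N]f≈ₘ0 : (1ₚ +ₚ N) *ₚ f Q.≈ₘ []
      [1+N]f≈ₘ0 = begin
        (1ₚ +ₚ N) *ₚ f          ≈⟨ Q.*-congˡ {1ₚ +ₚ N} f≈ₘuN ⟩
        (1ₚ +ₚ N) *ₚ (u *ₚ N)   ≈⟨ Q.solve 3 (λ m u n → m Q.:* (u Q.:* n) Q.:= u Q.:* (n Q.:* m)) Q.refl (1ₚ +ₚ N) u N ⟩
        u *ₚ (N *ₚ (1ₚ +ₚ N))   ≈⟨ Q.*-congˡ {u} N[1+N]≈0 ⟩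
        u *ₚ []                 ≈⟨ Q.zeroʳ u ⟩
        []                      ∎
        where open SetoidReasoning Q.setoid

      -- N carries the factor f and `W` carries the factor g.
      NW≈ₘ0 : N *ₚ W Q.≈ₘ []
      NW≈ₘ0 = begin
        N *ₚ (θ f *ₚ g)            ≈⟨ Q.*-congʳ (Q.≈⇒≈ₘ N≈) ⟩
        f *ₚ N/f *ₚ (θ f *ₚ g)
          ≈⟨ Q.solve 4 (λ f n t g → f Q.:* n Q.:* (t Q.:* g) Q.:= (n Q.:* t) Q.:* (f Q.:* g)) Q.refl f N/f (θ f) g ⟩
        (N/f *ₚ θ f) *ₚ (f *ₚ g)   ≈⟨ Q.*-congˡ {N/f *ₚ θ f} fg≈ₘ0 ⟩
        (N/f *ₚ θ f) *ₚ []         ≈⟨ Q.zeroʳ (N/f *ₚ θ f) ⟩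
        []                         ∎
        where open SetoidReasoning Q.setoid

      -- Two vanishing products, N W and (1 + N) f θ(g), are added to W; the sum is (1 + N)(W + f
      -- θ(g)), whose second factor is 1.
      W≈ₘ1+N : W Q.≈ₘ 1ₚ +ₚ N
      W≈ₘ1+N = begin
        W                                            ≈⟨ Q.+-identityʳ W ⟨
        W +ₚ []                                      ≈⟨ Q.+-congˡ NW≈ₘ0 ⟨
        W +ₚ N *ₚ W
          ≈⟨ Q.solve 2 (λ w n → w Q.:+ n Q.:* w Q.:= (Q.con 1 Q.:+ n) Q.:* w Q.:+ Q.con 0) Q.refl W N ⟩
        (1ₚ +ₚ N) *ₚ W +ₚ []                         ≈⟨ Q.+-congˡ (Q.zeroˡ (θ g)) ⟨
        (1ₚ +ₚ N) *ₚ W +ₚ [] *ₚ θ g                  ≈⟨ Q.+-congˡ (Q.*-congʳ [1+N]f≈ₘ0) ⟨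
        (1ₚ +ₚ N) *ₚ W +ₚ (1ₚ +ₚ N) *ₚ f *ₚ θ g
          ≈⟨ Q.solve 4 (λ m w f t → m Q.:* w Q.:+ m Q.:* f Q.:* t Q.:= m Q.:* (w Q.:+ f Q.:* t)) Q.refl (1ₚ +ₚ N) W f (θ g) ⟩
        (1ₚ +ₚ N) *ₚ (W +ₚ f *ₚ θ g)                 ≈⟨ Q.*-congˡ {1ₚ +ₚ N} W+fθg≈ₘ1 ⟩
        (1ₚ +ₚ N) *ₚ 1ₚ                              ≈⟨ Q.*-identityʳ (1ₚ +ₚ N) ⟩
        1ₚ +ₚ N                                      ∎
        where open SetoidReasoning Q.setoid

      1+N< : Deg< q (1ₚ +ₚ N)
      1+N< = Deg<-+ 1ₚ N (λ { zero () ; (suc i) _ → refl }) N<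

      W< : Deg< (suc q) W
      W< = let a , b , f< , g< , a+b≤q = factor-degrees f g (P.sym Z≈)
           in Deg<-mono {f = W} (ℕ.s≤s a+b≤q) (Deg<-* (θ f) g (Deg<-θ f f<) g<)

      W₁≈0 : coeff W 1 ≈ 0#
      W₁≈0 = trans (mod-Z W (1ₚ +ₚ N) (Q.factor W≈ₘ1+N) W< 1+N< (Q.difference W≈ₘ1+N))
                   (trans (coeff-+ 1ₚ N 1) (trans (+-identityˡ _) N₁≈0))

      f₀g₀≈-1 : coeff f 0 * coeff g 0 ≈ - 1#
      f₀g₀≈-1 = trans (sym (coeff-*-0 f g)) (trans (sym (at Z≈ 0)) (coeff-X^q-1-0 k))

      -1≉0 : ¬ - 1# ≈ 0#
      -1≉0 -1≈0 = 1≉0 (trans (sym (-‿involutive 1#)) (trans (-‿cong -1≈0) -0#≈0#))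

      f₀≉0 : ¬ coeff f 0 ≈ 0#
      f₀≉0 f₀≈0 = -1≉0 (trans (sym f₀g₀≈-1) (trans (*-congʳ f₀≈0) (zeroˡ _)))

      g₀≉0 : ¬ coeff g 0 ≈ 0#
      g₀≉0 g₀≈0 = -1≉0 (trans (sym f₀g₀≈-1) (trans (*-congˡ g₀≈0) (zeroʳ _)))

      -- `θ f` has constant term 0 and the same linear coefficient as f, so the coefficient of `W`
      -- at X is f₁ g₀. Here g₀ is nonzero, since f₀ g₀ = -1.
      f₁≈0 : coeff f 1 ≈ 0#
      f₁≈0 = cancelˡ-0 g₀≉0 (begin
        coeff g 0 * coeff f 1                                       ≈⟨ *-comm _ _ ⟩
        coeff f 1 * coeff g 0                                       ≈⟨ *-congʳ (trans (coeff-θ f 1) (+-identityʳ _)) ⟨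
        coeff (θ f) 1 * coeff g 0                                   ≈⟨ +-identityˡ _ ⟨
        0# + coeff (θ f) 1 * coeff g 0                              ≈⟨ +-congʳ (trans (*-congʳ (coeff-θ f 0)) (zeroˡ _)) ⟨
        coeff (θ f) 0 * coeff g 1 + coeff (θ f) 1 * coeff g 0       ≈⟨ coeff-*-1 (θ f) g ⟨
        coeff W 1                                                   ≈⟨ W₁≈0 ⟩
        0#                                                          ∎)
        where open S

      g₁≈0 : coeff g 1 ≈ 0#
      g₁≈0 = cancelˡ-0 f₀≉0 (begin
        coeff f 0 * coeff g 1                               ≈⟨ +-identityʳ _ ⟨
        coeff f 0 * coeff g 1 + 0#                          ≈⟨ +-congˡ (trans (*-congʳ f₁≈0) (zeroˡ _)) ⟨
        coeff f 0 * coeff g 1 + coeff f 1 * coeff g 0       ≈⟨ coeff-*-1 f g ⟨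
        coeff (f *ₚ g) 1                                    ≈⟨ at Z≈ 1 ⟨
        coeff Z 1                                           ≈⟨ coeff-X^q-1-1 k ⟩
        0#                                                  ∎)
        where open S

      ≈ₘ0⇒≈0 : ∀ {h} → Deg< q h → h Q.≈ₘ [] → h ≈ₚ []
      ≈ₘ0⇒≈0 h< h≈0 = multiple-small {c = Q.factor h≈0} h< (Q.difference h≈0)

      -- If f were invertible, (1 + N) f ≡ 0 would give 1 + N = 0, but N has constant term 0, so
      -- that of 1 + N is 1.
      f-nonunit : ¬ Unit f
      f-nonunit (c , cf≈1) = 1≉0 (begin
        1#                             ≈⟨ +-identityʳ 1# ⟨
        1# + 0#                        ≈⟨ +-congˡ N₀≈0 ⟨
        1# + coeff N 0                 ≈⟨ coeff-+ 1ₚ N 0 ⟨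
        coeff (1ₚ +ₚ N) 0              ≈⟨ at (≈ₘ0⇒≈0 1+N< 1+N≈ₘ0) 0 ⟩
        0#                             ∎)
        where
        open S
        1+N≈ₘ0 : 1ₚ +ₚ N Q.≈ₘ []
        1+N≈ₘ0 = Q.trans (Q.sym (Q.*-identityʳ (1ₚ +ₚ N))) (Q.trans (Q.*-congˡ {1ₚ +ₚ N} (Q.≈⇒≈ₘ (P.sym cf≈1)))
          (Q.trans (Q.solve 3 (λ m c f → m Q.:* (c Q.:* f) Q.:= c Q.:* (m Q.:* f)) Q.refl (1ₚ +ₚ N) c f)
          (Q.trans (Q.*-congˡ {c} [1+N]f≈ₘ0) (Q.zeroʳ c))))

      -- If g were invertible, f g ≡ 0 would make f, and with it the multiple N of f, vanish.
      g-nonunit : ¬ Unit g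
      g-nonunit (c , cg≈1) = N≉0 (≈ₘ0⇒≈0 N< N≈ₘ0)
        where
        N≈ₘ0 : N Q.≈ₘ []
        N≈ₘ0 = Q.trans (Q.sym (Q.*-identityʳ N)) (Q.trans (Q.*-cong (Q.≈⇒≈ₘ N≈) (Q.≈⇒≈ₘ (P.sym cg≈1)))
          (Q.trans (Q.solve 4 (λ f n c g → f Q.:* n Q.:* (c Q.:* g) Q.:= (n Q.:* c) Q.:* (f Q.:* g)) Q.refl f N/f c g)
          (Q.trans (Q.*-congˡ {N/f *ₚ c} fg≈ₘ0) (Q.zeroʳ (N/f *ₚ c)))))

    linear-free-factors : ∃₂ λ f g → f *ₚ g ≈ₚ Z × (coeff f 1 ≈ 0# × coeff g 1 ≈ 0#) × ¬ Unit f × ¬ Unit g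
    linear-free-factors = f , g , P.sym Z≈ , (f₁≈0 , g₁≈0) , f-nonunit , g-nonunit

-- Multiplication modulo X^q - 1 as cyclic convolution.

module CyclicConvolution (R : CommutativeRing 0ℓ 0ℓ) (m : ℕ) where

  open CommutativeRing R hiding (zero)
  open PolynomialProperties R
  open import Algebra.Properties.Semiring.Sum semiring using (sum; sum-cong-≋)
  open import Algebra.Properties.Ring ring using (-‿distribʳ-*)

  private
    q = suc m
    Z = X^ q -𝟏
    module P = CommutativeRing polynomialRing
    module Q where
      open Quotient polynomialRing Z public
      open CommutativeRing quotientRing public

  coeff-applyUpTo : ∀ h {n i} → i ℕ.< n → coeff (applyUpTo h n) i ≡ h i
  coeff-applyUpTo h {suc n} {zero}  _           = ≡.refl
  coeff-applyUpTo h {suc n} {suc i} (ℕ.s≤s i<n) = coeff-applyUpTo (λ j → h (suc j)) i<n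

  Deg<-applyUpTo : ∀ h n → Deg< n (applyUpTo h n)
  Deg<-applyUpTo h zero    i       _           = refl
  Deg<-applyUpTo h (suc n) (suc i) (ℕ.s≤s n≤i) = Deg<-applyUpTo (λ j → h (suc j)) n i n≤i

  applyUpTo-cong : ∀ {h h′} n → (∀ i → h i ≈ h′ i) → applyUpTo h n ≈ₚ applyUpTo h′ n
  applyUpTo-cong zero    e = P.refl
  applyUpTo-cong (suc n) e = e 0 ∷-cong applyUpTo-cong n (λ i → e (suc i))

  applyUpTo-0 : ∀ {h} n → (∀ i → h i ≈ 0#) → applyUpTo h n ≈ₚ []
  applyUpTo-0 zero    e = P.refl
  applyUpTo-0 (suc n) e = ∷≈[] (e 0) (applyUpTo-0 n (λ i → e (suc i)))

  applyUpTo-+ : ∀ h h′ n → applyUpTo h n +ₚ applyUpTo h′ n ≈ₚ applyUpTo (λ i → h i + h′ i) n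
  applyUpTo-+ h h′ zero    = P.refl
  applyUpTo-+ h h′ (suc n) = refl ∷-cong applyUpTo-+ (λ i → h (suc i)) (λ i → h′ (suc i)) n

  applyUpTo-· : ∀ a h n → a · applyUpTo h n ≈ₚ applyUpTo (λ i → a * h i) n
  applyUpTo-· a h zero    = P.refl
  applyUpTo-· a h (suc n) = refl ∷-cong applyUpTo-· a (λ i → h (suc i)) n

  applyUpTo-suc : ∀ h n → applyUpTo h (suc n) ≈ₚ applyUpTo h n +ₚ monomial (h n) n
  applyUpTo-suc h zero    = P.refl
  applyUpTo-suc h (suc n) = sym (+-identityʳ _) ∷-cong applyUpTo-suc (λ i → h (suc i)) n

  -- Functions on the cyclic group of order q are modelled by periodic functions on ℤ, so that an
  -- index such as x - i needs no reduction.
  Periodic : (ℤ → Carrier) → Set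
  Periodic ψ = ∀ x → ψ (x ℤ.+ + q) ≈ ψ x

  ⟦_⟧ : (ℤ → Carrier) → Poly
  ⟦ ψ ⟧ = applyUpTo (λ i → ψ (+ i)) q

  ⟦⟧-+ : ∀ φ ψ → ⟦ φ ⟧ +ₚ ⟦ ψ ⟧ ≈ₚ ⟦ (λ x → φ x + ψ x) ⟧
  ⟦⟧-+ φ ψ = applyUpTo-+ (λ i → φ (+ i)) (λ i → ψ (+ i)) q

  ⟦⟧-· : ∀ a ψ → a · ⟦ ψ ⟧ ≈ₚ ⟦ (λ x → a * ψ x) ⟧
  ⟦⟧-· a ψ = applyUpTo-· a (λ i → ψ (+ i)) q

  constant-*-Z : ∀ c → (c ∷ []) *ₚ Z ≈ₚ monomial c q +ₚ (- c ∷ [])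
  constant-*-Z c = begin
    (c ∷ []) *ₚ (shift q 1ₚ +ₚ (- 1# ∷ []))                     ≈⟨ P.distribˡ (c ∷ []) (shift q 1ₚ) (- 1# ∷ []) ⟩
    (c ∷ []) *ₚ shift q 1ₚ +ₚ (c ∷ []) *ₚ (- 1# ∷ [])           ≈⟨ P.+-cong X^q c*-1 ⟩
    monomial c q +ₚ (- c ∷ [])                                  ∎
    where
    open SetoidReasoning P.setoid
    X^q : (c ∷ []) *ₚ shift q 1ₚ ≈ₚ monomial c q
    X^q = P.trans (P.*-comm (c ∷ []) (shift q 1ₚ)) (P.trans (shift-* q 1ₚ (c ∷ [])) (shift-cong q (P.*-identityˡ (c ∷ []))))
    c*-1 : (c ∷ []) *ₚ (- 1# ∷ []) ≈ₚ - c ∷ []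
    c*-1 = P.trans (constant-* c (- 1# ∷ []))
      (trans (sym (-‿distribʳ-* c 1#)) (-‿cong (*-identityʳ c)) ∷-cong P.refl)

  -- Multiplication by X rotates the coefficients: the top one, ψ(q - 1), overflows to X^q ≡ 1 and
  -- returns as the constant term ψ(-1).
  X-* : ∀ {ψ} → Periodic ψ → 0# ∷ ⟦ ψ ⟧ Q.≈ₘ ⟦ (λ x → ψ (x ℤ.- + 1)) ⟧
  X-* {ψ} per = Q.multiple (c ∷ []) (begin
    0# ∷ ⟦ ψ ⟧                                     ≈⟨ sym (+-identityʳ 0#) ∷-cong applyUpTo-suc (λ i → ψ (+ i)) m ⟩
    (0# ∷ T) +ₚ monomial (ψ (+ m)) q               ≈⟨ P.+-cong first (shift-cong q (trans ψm≈c refl ∷-cong P.refl)) ⟩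
    ((c ∷ T) +ₚ (- c ∷ [])) +ₚ monomial c q        ≈⟨ P.+-assoc (c ∷ T) (- c ∷ []) (monomial c q) ⟩
    (c ∷ T) +ₚ ((- c ∷ []) +ₚ monomial c q)
      ≈⟨ P.+-congˡ {c ∷ T} (P.trans (P.+-comm (- c ∷ []) (monomial c q)) (P.sym (constant-*-Z c))) ⟩
    (c ∷ T) +ₚ (c ∷ []) *ₚ Z                       ∎)
    where
    open SetoidReasoning P.setoid
    c = ψ (ℤ.- + 1)
    T = applyUpTo (λ i → ψ (+ i)) m
    ψm≈c : ψ (+ m) ≈ c
    ψm≈c = per (ℤ.- + 1)
    first : 0# ∷ T ≈ₚ (c ∷ T) +ₚ (- c ∷ [])
    first = sym (-‿inverseʳ c) ∷-cong P.sym (P.+-identityʳ T)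

  -- Only the first n values of h enter, so that the induction in `applyUpTo-*` can split off the
  -- constant term of the left factor. For n = q this is the full cyclic convolution.
  convolve : ℕ → (ℕ → Carrier) → (ℤ → Carrier) → ℤ → Carrier
  convolve n h ψ x = sum {n} (λ i → h (toℕ i) * ψ (x ℤ.- + toℕ i))

  convolve-periodic : ∀ n h {ψ} → Periodic ψ → Periodic (convolve n h ψ)
  convolve-periodic n h {ψ} per x = sum-cong-≋ {n} λ i → *-congˡ
    (trans (reflexive (≡.cong ψ (rearrange x (+ q) (+ toℕ i)))) (per (x ℤ.- + toℕ i)))
    where
    rearrange : ∀ x y z → (x ℤ.+ y) ℤ.- z ≡ (x ℤ.- z) ℤ.+ y
    rearrange = solve 3 (λ x y z → (x :+ y) :- z := (x :- z) :+ y) ≡.refl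
      where open ℤS.+-*-Solver

  applyUpTo-* : ∀ n h {ψ} → Periodic ψ → applyUpTo h n *ₚ ⟦ ψ ⟧ Q.≈ₘ ⟦ convolve n h ψ ⟧
  applyUpTo-* zero    h per = Q.≈⇒≈ₘ (P.sym (applyUpTo-0 q (λ i → refl)))
  applyUpTo-* (suc n) h {ψ} per = begin
    h 0 · ⟦ ψ ⟧ +ₚ (0# ∷ applyUpTo h⁺ n *ₚ ⟦ ψ ⟧)
      ≈⟨ Q.+-congˡ {h 0 · ⟦ ψ ⟧} (∷-congₘ (applyUpTo-* n h⁺ per)) ⟩
    h 0 · ⟦ ψ ⟧ +ₚ (0# ∷ ⟦ convolve n h⁺ ψ ⟧)
      ≈⟨ Q.+-congˡ {h 0 · ⟦ ψ ⟧} (X-* (convolve-periodic n h⁺ per)) ⟩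
    h 0 · ⟦ ψ ⟧ +ₚ ⟦ (λ x → convolve n h⁺ ψ (x ℤ.- + 1)) ⟧
      ≈⟨ Q.≈⇒≈ₘ (P.trans (P.+-congʳ {⟦ (λ x → convolve n h⁺ ψ (x ℤ.- + 1)) ⟧} (⟦⟧-· (h 0) ψ)) (⟦⟧-+ (λ x → h 0 * ψ x) (λ x → convolve n h⁺ ψ (x ℤ.- + 1)))) ⟩
    ⟦ (λ x → h 0 * ψ x + convolve n h⁺ ψ (x ℤ.- + 1)) ⟧                 ≈⟨ Q.≈⇒≈ₘ (applyUpTo-cong q (λ i → reindex (+ i))) ⟩
    ⟦ convolve (suc n) h ψ ⟧                                            ∎
    where
    open SetoidReasoning Q.setoid
    h⁺ : ℕ → Carrier
    h⁺ i = h (suc i)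
    ∷-congₘ : ∀ {f g} → f Q.≈ₘ g → 0# ∷ f Q.≈ₘ 0# ∷ g
    ∷-congₘ {f} {g} e = Q.trans (Q.sym (Q.≈⇒≈ₘ (X*f≈ f))) (Q.trans (Q.*-congˡ {0# ∷ 1ₚ} e) (Q.≈⇒≈ₘ (X*f≈ g)))
      where
      X*f≈ : ∀ f → (0# ∷ 1ₚ) *ₚ f ≈ₚ 0# ∷ f
      X*f≈ f = P.trans (0∷-*ₚ 1ₚ f) (refl ∷-cong P.*-identityˡ f)
    rearrange : ∀ x i → (x ℤ.- + 1) ℤ.- i ≡ x ℤ.- (+ 1 ℤ.+ i)
    rearrange = solve 2 (λ x i → (x :- con (+ 1)) :- i := x :- (con (+ 1) :+ i)) ≡.refl
      where open ℤS.+-*-Solver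
    reindex : ∀ x → h 0 * ψ x + convolve n h⁺ ψ (x ℤ.- + 1) ≈ convolve (suc n) h ψ x
    reindex x = +-cong (*-congˡ (reflexive (≡.cong ψ (≡.sym (ℤP.+-identityʳ x)))))
      (sum-cong-≋ {n} λ i → *-congˡ (reflexive (≡.cong ψ (rearrange x (+ toℕ i)))))

  -- Reduces the relation N(1 + N) ≡ 0 to one identity per coefficient, the form in which the
  -- character sums supply it.
  ⟦⟧-idempotent : ∀ ν → Periodic ν → (∀ x → ν x + convolve q (λ i → ν (+ i)) ν x ≈ 0#) →
                  ⟦ ν ⟧ *ₚ (1ₚ +ₚ ⟦ ν ⟧) Q.≈ₘ []
  ⟦⟧-idempotent ν per e = begin
    N *ₚ (1ₚ +ₚ N)                 ≈⟨ Q.distribˡ N 1ₚ N ⟩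
    N *ₚ 1ₚ +ₚ N *ₚ N              ≈⟨ Q.+-cong (Q.*-identityʳ N) (applyUpTo-* q (λ i → ν (+ i)) per) ⟩
    N +ₚ ⟦ convolve q (λ i → ν (+ i)) ν ⟧   ≈⟨ Q.≈⇒≈ₘ (⟦⟧-+ ν (convolve q (λ i → ν (+ i)) ν)) ⟩
    ⟦ (λ x → ν x + convolve q (λ i → ν (+ i)) ν x) ⟧ ≈⟨ Q.≈⇒≈ₘ (applyUpTo-0 q (λ i → e (+ i))) ⟩
    []                             ∎
    where
    open SetoidReasoning Q.setoid
    N = ⟦ ν ⟧

-- Monic integer polynomials and rules for powers.

-- The polynomials here are monic: eval (c₀ ∷ … ∷ c_{n-1} ∷ []) is the polynomial c₀ + … + c_{n-1} X^{n-1} + X^n.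
module MonicPolynomial where

  eval : List ℤ → ℤ → ℤ
  eval []       x = + 1
  eval (c ∷ cs) x = c ℤ.+ x ℤ.* eval cs x

  -- Horner's synthetic division by X - r: the coefficients are the values at r of the successive
  -- tails. The leading 1 is implicit, so the length is the degree and drops by one.
  quotient : List ℤ → ℤ → List ℤ
  quotient []           r = []
  quotient (c ∷ [])     r = []
  quotient (c ∷ d ∷ cs) r = eval (d ∷ cs) r ∷ quotient (d ∷ cs) r

  length-quotient : ∀ c cs r → length (quotient (c ∷ cs) r) ≡ length cs
  length-quotient c []       r = ≡.refl
  length-quotient c (d ∷ cs) r = cong suc (length-quotient d cs r)

  eval-quotient : ∀ c cs r x → eval (c ∷ cs) x ℤ.- eval (c ∷ cs) r ≡ (x ℤ.- r) ℤ.* eval (quotient (c ∷ cs) r) x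
  eval-quotient c [] r x = solve 3 (λ c r x → (c :+ x :* con (+ 1)) :- (c :+ r :* con (+ 1)) := (x :- r) :* con (+ 1)) ≡.refl c r x
    where open ℤS.+-*-Solver
  eval-quotient c (d ∷ cs) r x = begin
    (c ℤ.+ x ℤ.* P x) ℤ.- (c ℤ.+ r ℤ.* P r)
      ≡⟨ solve 5 (λ c x r p s → (c :+ x :* p) :- (c :+ r :* s) := (x :- r) :* s :+ x :* (p :- s)) ≡.refl c x r (P x) (P r) ⟩
    (x ℤ.- r) ℤ.* P r ℤ.+ x ℤ.* (P x ℤ.- P r)           ≡⟨ cong (λ t → (x ℤ.- r) ℤ.* P r ℤ.+ x ℤ.* t) (eval-quotient d cs r x) ⟩
    (x ℤ.- r) ℤ.* P r ℤ.+ x ℤ.* ((x ℤ.- r) ℤ.* Q x)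
      ≡⟨ solve 4 (λ x r p q → (x :- r) :* p :+ x :* ((x :- r) :* q) := (x :- r) :* (p :+ x :* q)) ≡.refl x r (P r) (Q x) ⟩
    (x ℤ.- r) ℤ.* (P r ℤ.+ x ℤ.* Q x)                   ∎
    where
    open ≡-Reasoning
    open ℤS.+-*-Solver
    P = eval (d ∷ cs)
    Q = eval (quotient (d ∷ cs) r)

  eval-X^n+c : ∀ c n x → eval (c ∷ replicate n (+ 0)) x ≡ c ℤ.+ x ℤ.^ suc n
  eval-X^n+c c n x = cong (λ t → c ℤ.+ x ℤ.* t) (eval-X^n n)
    where
    eval-X^n : ∀ n → eval (replicate n (+ 0)) x ≡ x ℤ.^ n
    eval-X^n zero    = ≡.refl
    eval-X^n (suc n) = ≡.trans (ℤP.+-identityˡ _) (cong (λ t → x ℤ.* t) (eval-X^n n))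

^-distribʳ-* : ∀ x y k → (x ℤ.* y) ℤ.^ k ≡ x ℤ.^ k ℤ.* y ℤ.^ k
^-distribʳ-* x y zero    = ≡.refl
^-distribʳ-* x y (suc k) = ≡.trans (cong ((x ℤ.* y) ℤ.*_) (^-distribʳ-* x y k))
  (solve 4 (λ x y a b → (x :* y) :* (a :* b) := (x :* a) :* (y :* b)) ≡.refl x y (x ℤ.^ k) (y ℤ.^ k))
  where open ℤS.+-*-Solver

^-double : ∀ x k → x ℤ.^ (k ℕ.+ k) ≡ (x ℤ.* x) ℤ.^ k
^-double x k = ≡.trans (ℤP.^-distribˡ-+-* x k k) (≡.sym (^-distribʳ-* x x k))

-- The field of residues modulo the prime q = m + 1.

module Residues (m : ℕ) (q-prime : Prime (suc m)) where

  q : ℕ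
  q = suc m

  private
    ℤ-ring : CommutativeRing 0ℓ 0ℓ
    ℤ-ring = ℤP.+-*-commutativeRing

  open Quotient ℤ-ring (+ q) public
  module K = CommutativeRing quotientRing

  private
    module ≈-Reasoning = SetoidReasoning K.setoid

  ≈⇒∣ : ∀ {x y} → x ≈ₘ y → q ℕ∣.∣ ∣ x ℤ.- y ∣
  ≈⇒∣ {x} {y} (multiple h ≡.refl) = ℕ∣.divides ∣ h ∣ (begin
    ∣ y ℤ.+ h ℤ.* + q ℤ.- y ∣   ≡⟨ cong ∣_∣ (solve 2 (λ y t → y :+ t :- y := t) ≡.refl y (h ℤ.* + q)) ⟩
    ∣ h ℤ.* + q ∣               ≡⟨ ℤP.abs-* h (+ q) ⟩
    ∣ h ∣ ℕ.* q                 ∎)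
    where
    open ≡-Reasoning
    open ℤS.+-*-Solver

  ∣⇒≈0 : ∀ {x} → q ℕ∣.∣ ∣ x ∣ → x ≈ₘ + 0
  ∣⇒≈0 {+ n}      (ℕ∣.divides h eq) = multiple (+ h) (≡.trans (cong +_ eq) (≡.trans (ℤP.pos-* h q) (≡.sym (ℤP.+-identityˡ _))))
  ∣⇒≈0 { -[1+ n ]} (ℕ∣.divides h eq) = multiple (ℤ.- + h)
    (≡.trans (cong (λ t → ℤ.- + t) eq) (≡.trans (cong ℤ.-_ (ℤP.pos-* h q)) (≡.trans (ℤP.neg-distribˡ-* (+ h) (+ q)) (≡.sym (ℤP.+-identityˡ _)))))

  -≈0⇒≈ : ∀ {x y} → x ℤ.- y ≈ₘ + 0 → x ≈ₘ y
  -≈0⇒≈ {x} {y} (multiple h e) = multiple h (begin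
    x                     ≡⟨ solve 2 (λ x y → x := y :+ (x :- y)) ≡.refl x y ⟩
    y ℤ.+ (x ℤ.- y)       ≡⟨ cong (λ t → y ℤ.+ t) e ⟩
    y ℤ.+ (+ 0 ℤ.+ h ℤ.* + q)   ≡⟨ cong (λ t → y ℤ.+ t) (ℤP.+-identityˡ _) ⟩
    y ℤ.+ h ℤ.* + q       ∎)
    where
    open ≡-Reasoning
    open ℤS.+-*-Solver

  ≈⇒-≈0 : ∀ {x y} → x ≈ₘ y → x ℤ.- y ≈ₘ + 0
  ≈⇒-≈0 e = ∣⇒≈0 (≈⇒∣ e)

  ≈0⇒∣ : ∀ {x} → x ≈ₘ + 0 → q ℕ∣.∣ ∣ x ∣
  ≈0⇒∣ {x} e = ≡.subst (λ t → q ℕ∣.∣ ∣ t ∣) (ℤP.+-identityʳ x) (≈⇒∣ e)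

  infix 4 _≈?_
  abstract
    _≈?_ : ∀ x y → Dec (x ≈ₘ y)
    x ≈? y = map′ (λ d → -≈0⇒≈ (∣⇒≈0 d)) ≈⇒∣ (q ℕ∣.∣? ∣ x ℤ.- y ∣)

  abstract
    *-≈0 : ∀ {x y} → x ℤ.* y ≈ₘ + 0 → x ≈ₘ + 0 ⊎ y ≈ₘ + 0
    *-≈0 {x} {y} e with euclidsLemma ∣ x ∣ ∣ y ∣ q-prime (≡.subst (q ℕ∣.∣_) (ℤP.abs-* x y) (≈0⇒∣ e))
    ... | inj₁ d = inj₁ (∣⇒≈0 d)
    ... | inj₂ d = inj₂ (∣⇒≈0 d)

  -- A multiple of q with absolute value below q is 0. This lifts congruences to equalities in ℤ,
  -- both for representatives below q and for values of the quadratic character.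
  close⇒≡ : ∀ {x y} → x ≈ₘ y → ∣ x ℤ.- y ∣ ℕ.< q → x ≡ y
  close⇒≡ {x} {y} e <q with ∣ x ℤ.- y ∣ in eq | ≈⇒∣ e
  ... | zero  | _ = ℤP.i-j≡0⇒i≡j x y (ℤP.∣i∣≡0⇒i≡0 eq)
  ... | suc d | q∣ = contradiction q∣ (ℕ∣.>⇒∤ <q)

  private
    ∣+a-+b∣< : ∀ {a b} → a ℕ.< q → b ℕ.< q → ∣ + a ℤ.- + b ∣ ℕ.< q
    ∣+a-+b∣< {a} {b} a<q b<q with ℕP.≤-total a b
    ... | inj₁ a≤b = ≡.subst (ℕ._< q) (≡.sym (≡.trans (cong ∣_∣ (ℤP.m-n≡m⊖n a b)) (ℤP.∣⊖∣-≤ a≤b))) (ℕP.≤-<-trans (ℕP.m∸n≤m b a) b<q)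
    ... | inj₂ b≤a = ≡.subst (ℕ._< q) (≡.sym (≡.trans (ℤP.∣i-j∣≡∣j-i∣ (+ a) (+ b)) (≡.trans (cong ∣_∣ (ℤP.m-n≡m⊖n b a)) (ℤP.∣⊖∣-≤ b≤a)))) (ℕP.≤-<-trans (ℕP.m∸n≤m a b) a<q)

  small≈⇒≡ : ∀ {a b} → a ℕ.< q → b ℕ.< q → + a ≈ₘ + b → a ≡ b
  small≈⇒≡ a<q b<q e = ℤP.+-injective (close⇒≡ e (∣+a-+b∣< a<q b<q))

  1≉0 : ¬ + 1 ≈ₘ + 0
  1≉0 e with ℕ∣.∣1⇒≡1 (≈0⇒∣ e)
  ... | ≡.refl = Primality.¬prime[1] q-prime

  ι : Fin q → ℤ
  ι i = + toℕ i

  residue : ℤ → Fin q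
  residue x = fromℕ< (ℤD.n%ℕd<d x q)

  ι-residue : ∀ x → ι (residue x) ≈ₘ x
  ι-residue x = K.sym (multiple (x ℤD./ℕ q)
    (≡.trans (ℤD.a≡a%ℕn+[a/ℕn]*n x q) (cong (λ t → + t ℤ.+ (x ℤD./ℕ q) ℤ.* + q) (≡.sym (FinP.toℕ-fromℕ< (ℤD.n%ℕd<d x q))))))

  ι-injective : ∀ {i j} → ι i ≈ₘ ι j → i ≡ j
  ι-injective {i} {j} e = FinP.toℕ-injective (small≈⇒≡ (FinP.toℕ<n i) (FinP.toℕ<n j) e)

  -- Lagrange's bound on roots. Dividing by X minus the first root lowers the degree, and each other
  -- root is a root of the quotient because there are no zero divisors modulo q.
  few-roots : ∀ n cs → length cs ≡ n → (r : Fin (suc n) → ℤ) → (∀ {i j} → r i ≈ₘ r j → i ≡ j) →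
              ¬ (∀ i → MonicPolynomial.eval cs (r i) ≈ₘ + 0)
  few-roots zero    []       _  r inj roots = 1≉0 (roots Fin.zero)
  few-roots (suc n) (c ∷ cs) eq r inj roots =
    few-roots n Q (≡.trans (length-quotient c cs r₀) (ℕP.suc-injective eq)) (λ i → r (Fin.suc i))
      (λ e → FinP.suc-injective (inj e)) quotient-root
    where
    open MonicPolynomial
    r₀ = r Fin.zero
    Q = quotient (c ∷ cs) r₀
    quotient-root : ∀ i → eval Q (r (Fin.suc i)) ≈ₘ + 0
    quotient-root i with *-≈0 (K.trans (K.sym (≈⇒≈ₘ (eval-quotient c cs r₀ (r (Fin.suc i)))))
      (≈⇒-≈0 (K.trans (roots (Fin.suc i)) (K.sym (roots Fin.zero)))))
    ... | inj₁ e = contradiction (inj (-≈0⇒≈ e)) λ ()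
    ... | inj₂ e = e

  ∣⇒≈ : ∀ {x y} → + q ℤ∣.∣ x ℤ.- y → x ≈ₘ y
  ∣⇒≈ d = -≈0⇒≈ (∣⇒≈0 (ℤ∣.∣⇒∣ᵤ d))

  abstract
    ≉0⇒invertible : ∀ {x} → ¬ x ≈ₘ + 0 → ∃ λ y → y ℤ.* x ≈ₘ + 1
    ≉0⇒invertible {x} x≉0 with HeytingField.#⇒invertible (𝔽 q q-prime) {x} {+ 0} (λ d → x≉0 (∣⇒≈ d))
    ... | y , yx≈1 , _ = y , ≡.subst (λ t → y ℤ.* t ≈ₘ + 1) (ℤP.+-identityʳ x) (∣⇒≈ yx≈1)

  cancelˡ : ∀ {x y} → ¬ x ≈ₘ + 0 → x ℤ.* y ≈ₘ x → y ≈ₘ + 1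
  cancelˡ {x} {y} x≉0 xy≈x with *-≈0 (K.trans (≈⇒≈ₘ (solve 2 (λ x y → x :* (y :- con (+ 1)) := x :* y :- x) ≡.refl x y)) (≈⇒-≈0 xy≈x))
    where open ℤS.+-*-Solver
  ... | inj₁ x≈0   = contradiction x≈0 x≉0
  ... | inj₂ y-1≈0 = -≈0⇒≈ y-1≈0

  ^-cong : ∀ n {x y} → x ≈ₘ y → x ℤ.^ n ≈ₘ y ℤ.^ n
  ^-cong zero    e = K.refl
  ^-cong (suc n) e = K.*-cong e (^-cong n e)

  module Reindexing (M : CommutativeMonoid 0ℓ 0ℓ) where

    open CommutativeMonoid M using (Carrier; _≈_; sym; trans)
    open import Algebra.Properties.CommutativeMonoid.Sum M using (sum; ∑-permute; sum-cong-≋)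

    -- A bijection of residue classes becomes a permutation of `Fin q` by taking representatives.
    -- The commutative monoid is a parameter because `fermat` needs products and the character sums
    -- need sums.
    reindex : ∀ (F : ℤ → Carrier) → (∀ {x y} → x ≈ₘ y → F x ≈ F y) →
              ∀ (g g⁻¹ : ℤ → ℤ) → (∀ {x y} → x ≈ₘ y → g x ≈ₘ g y) → (∀ {x y} → x ≈ₘ y → g⁻¹ x ≈ₘ g⁻¹ y) →
              (∀ x → g (g⁻¹ x) ≈ₘ x) → (∀ x → g⁻¹ (g x) ≈ₘ x) →
              sum {q} (λ i → F (g (ι i))) ≈ sum {q} (λ i → F (ι i))
    reindex F F-cong g g⁻¹ g-cong g⁻¹-cong gg⁻¹ g⁻¹g =
      trans (sum-cong-≋ {q} (λ i → F-cong (K.sym (ι-residue (g (ι i))))))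
            (sym (∑-permute (λ i → F (ι i)) π))
      where
      π : Perm.Permutation q q
      π = Perm.permutation (λ i → residue (g (ι i))) (λ i → residue (g⁻¹ (ι i)))
        (λ i → ι-injective (K.trans (ι-residue _) (K.trans (g-cong (ι-residue _)) (gg⁻¹ (ι i)))))
        (λ i → ι-injective (K.trans (ι-residue _) (K.trans (g⁻¹-cong (ι-residue _)) (g⁻¹g (ι i)))))

    reindex-scale : ∀ (F : ℤ → Carrier) → (∀ {x y} → x ≈ₘ y → F x ≈ F y) → ∀ {a} → ¬ a ≈ₘ + 0 →
                    sum {q} (λ i → F (a ℤ.* ι i)) ≈ sum {q} (λ i → F (ι i))
    reindex-scale F F-cong {a} a≉0 = let b , ba≈1 = ≉0⇒invertible a≉0 in
      reindex F F-cong (a ℤ.*_) (b ℤ.*_) (K.*-congˡ {a}) (K.*-congˡ {b})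
        (λ x → K.trans (≈⇒≈ₘ (solve 3 (λ a b x → a :* (b :* x) := (b :* a) :* x) ≡.refl a b x)) (K.trans (K.*-congʳ ba≈1) (K.*-identityˡ x)))
        (λ x → K.trans (≈⇒≈ₘ (≡.sym (ℤP.*-assoc b a x))) (K.trans (K.*-congʳ ba≈1) (K.*-identityˡ x)))
      where open ℤS.+-*-Solver

    reindex-reflect : ∀ (F : ℤ → Carrier) → (∀ {x y} → x ≈ₘ y → F x ≈ F y) → ∀ c →
                      sum {q} (λ i → F (c ℤ.- ι i)) ≈ sum {q} (λ i → F (ι i))
    reindex-reflect F F-cong c = reindex F F-cong (λ x → c ℤ.- x) (λ x → c ℤ.- x) reflect-cong reflect-cong involutive involutive
      where
      open ℤS.+-*-Solver
      reflect-cong : ∀ {x y} → x ≈ₘ y → c ℤ.- x ≈ₘ c ℤ.- y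
      reflect-cong e = K.+-congˡ {c} (K.-‿cong e)
      involutive : ∀ x → c ℤ.- (c ℤ.- x) ≈ₘ x
      involutive x = ≈⇒≈ₘ (solve 2 (λ c x → c :- (c :- x) := x) ≡.refl c x)

  abstract
    -- Multiplication by a permutes the residues. So that the product may run over all of them, `w`
    -- replaces 0 by 1, and `e` records the factor gained, 1 at 0 and a at the m other residues.
    -- Comparing the products and cancelling gives the claim.
    fermat : ∀ {a} → ¬ a ≈ₘ + 0 → a ℤ.^ m ≈ₘ + 1
    fermat {a} a≉0 = cancelˡ (∏≉0 (λ i → w≉0 (ι i))) (begin
      ∏ (λ i → w (ι i)) ℤ.* a ℤ.^ m                  ≈⟨ K.*-comm (∏ (λ i → w (ι i))) (a ℤ.^ m) ⟩
      a ℤ.^ m ℤ.* ∏ (λ i → w (ι i))                  ≈⟨ K.*-congʳ ∏e ⟨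
      ∏ (λ i → e (ι i)) ℤ.* ∏ (λ i → w (ι i))        ≈⟨ ∑-distrib-+ (λ i → e (ι i)) (λ i → w (ι i)) ⟨
      ∏ (λ i → e (ι i) ℤ.* w (ι i))                  ≈⟨ sum-cong-≋ {q} (λ i → w-scale (ι i)) ⟨
      ∏ (λ i → w (a ℤ.* ι i))                        ≈⟨ Reindexing.reindex-scale K.*-commutativeMonoid w w-cong a≉0 ⟩
      ∏ (λ i → w (ι i))                              ∎)
      where
      open ≈-Reasoning
      open import Algebra.Properties.CommutativeMonoid.Sum K.*-commutativeMonoid using (∑-distrib-+; sum-cong-≋) renaming (sum to ∏)
      w : ℤ → ℤ
      w x with x ≈? + 0
      ... | yes _ = + 1
      ... | no  _ = x
      w-cong : ∀ {x y} → x ≈ₘ y → w x ≈ₘ w y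
      w-cong {x} {y} x≈y with x ≈? + 0 | y ≈? + 0
      ... | yes _   | yes _   = K.refl
      ... | yes x≈0 | no  y≉0 = contradiction (K.trans (K.sym x≈y) x≈0) y≉0
      ... | no  x≉0 | yes y≈0 = contradiction (K.trans x≈y y≈0) x≉0
      ... | no  _   | no  _   = x≈y
      w≉0 : ∀ x → ¬ w x ≈ₘ + 0
      w≉0 x with x ≈? + 0
      ... | yes _   = 1≉0
      ... | no  x≉0 = x≉0
      e : ℤ → ℤ
      e x with x ≈? + 0
      ... | yes _ = + 1
      ... | no  _ = a
      w-scale : ∀ x → w (a ℤ.* x) ≈ₘ e x ℤ.* w x
      w-scale x with x ≈? + 0 | (a ℤ.* x) ≈? + 0
      ... | yes _   | yes _    = K.refl
      ... | yes x≈0 | no  ax≉0 = contradiction (K.trans (K.*-congˡ {a} x≈0) (K.zeroʳ a)) ax≉0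
      ... | no  x≉0 | no  _    = K.refl
      ... | no  x≉0 | yes ax≈0 with *-≈0 ax≈0
      ...   | inj₁ a≈0 = contradiction a≈0 a≉0
      ...   | inj₂ x≈0 = contradiction x≈0 x≉0
      ∏≉0 : ∀ {n} {t : Fin n → ℤ} → (∀ i → ¬ t i ≈ₘ + 0) → ¬ ∏ t ≈ₘ + 0
      ∏≉0 {zero}  t≉0 = 1≉0
      ∏≉0 {suc n} t≉0 ∏≈0 with *-≈0 ∏≈0
      ... | inj₁ h = t≉0 Fin.zero h
      ... | inj₂ h = ∏≉0 (λ i → t≉0 (Fin.suc i)) h
      e-suc : ∀ (i : Fin m) → e (ι (Fin.suc i)) ≡ a
      e-suc i with ι (Fin.suc i) ≈? + 0
      ... | yes h = contradiction (ι-injective {Fin.suc i} {Fin.zero} h) λ ()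
      ... | no  _ = ≡.refl
      e-zero : e (+ 0) ≡ + 1
      e-zero with + 0 ≈? + 0
      ... | yes _ = ≡.refl
      ... | no  h = contradiction K.refl h
      ∏-constant : ∀ {n} {t : Fin n → ℤ} → (∀ i → t i ≡ a) → ∏ t ≈ₘ a ℤ.^ n
      ∏-constant {zero}  t≡a = K.refl
      ∏-constant {suc n} t≡a = K.*-cong (≈⇒≈ₘ (t≡a Fin.zero)) (∏-constant (λ i → t≡a (Fin.suc i)))
      ∏e : ∏ (λ i → e (ι i)) ≈ₘ a ℤ.^ m
      ∏e = K.trans (K.*-cong (≈⇒≈ₘ e-zero) (∏-constant e-suc)) (K.*-identityˡ _)

-- The quadratic character modulo q = 4n + 1 and its autocorrelation.

module QuadraticCharacter (m : ℕ) (q-prime : Prime (suc m)) (n h : ℕ)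
  (1≤h : 1 ℕ.≤ h) (h≡ : h ≡ n ℕ.+ n) (m≡ : m ≡ h ℕ.+ h) where

  open Residues m q-prime
  open ≡-Reasoning
  open ℤS.+-*-Solver
  open import Algebra.Properties.Semiring.Sum ℤP.+-*-semiring using (sum; sum-cong-≗; ∑-distrib-+; *-distribˡ-sum; ∑-comm)

  ^h-square : ∀ {x} → ¬ x ≈ₘ + 0 → x ℤ.^ h ℤ.* x ℤ.^ h ≈ₘ + 1
  ^h-square {x} x≉0 = ≡.subst (_≈ₘ + 1) (≡.trans (cong (x ℤ.^_) m≡) (ℤP.^-distribˡ-+-* x h h)) (fermat x≉0)

  abstract
    ^h≈±1 : ∀ {x} → ¬ x ≈ₘ + 0 → x ℤ.^ h ≈ₘ + 1 ⊎ x ℤ.^ h ≈ₘ -[1+ 0 ]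
    ^h≈±1 {x} x≉0 with *-≈0 (K.trans (≈⇒≈ₘ (solve 1 (λ y → (y :- con (+ 1)) :* (y :- con -[1+ 0 ]) := y :* y :- con (+ 1)) ≡.refl (x ℤ.^ h))) (≈⇒-≈0 (^h-square x≉0)))
    ... | inj₁ e = inj₁ (-≈0⇒≈ e)
    ... | inj₂ e = inj₂ (-≈0⇒≈ e)

  -- The quadratic character modulo q, computed by Euler's criterion.
  χ : ℤ → ℤ
  χ x with x ≈? + 0 | x ℤ.^ h ≈? + 1
  ... | yes _ | _     = + 0
  ... | no  _ | yes _ = + 1
  ... | no  _ | no  _ = -[1+ 0 ]

  δ : ℤ → ℤ
  δ x with x ≈? + 0
  ... | yes _ = + 1
  ... | no  _ = + 0

  δ-0 : ∀ {x} → x ≈ₘ + 0 → δ x ≡ + 1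
  δ-0 {x} x≈0 with x ≈? + 0
  ... | yes _   = ≡.refl
  ... | no  x≉0 = contradiction x≈0 x≉0

  δ-≉0 : ∀ {x} → ¬ x ≈ₘ + 0 → δ x ≡ + 0
  δ-≉0 {x} x≉0 with x ≈? + 0
  ... | yes x≈0 = contradiction x≈0 x≉0
  ... | no  _   = ≡.refl

  δ-cong : ∀ {x y} → x ≈ₘ y → δ x ≡ δ y
  δ-cong {x} {y} x≈y with x ≈? + 0
  ... | yes x≈0 = ≡.sym (δ-0 (K.trans (K.sym x≈y) x≈0))
  ... | no  x≉0 = ≡.sym (δ-≉0 (λ y≈0 → x≉0 (K.trans x≈y y≈0)))

  -- Source of the formal properties of `χ`: congruence classes, products and signs are handled by
  -- x^h, and two values among -1, 0, 1 that agree modulo q are equal because q > 2.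
  χ≈^h : ∀ x → χ x ≈ₘ x ℤ.^ h
  χ≈^h x with x ≈? + 0 | x ℤ.^ h ≈? + 1
  ... | yes x≈0 | _     = K.sym (K.trans (^-cong h x≈0) (≈⇒≈ₘ (0^h h 1≤h)))
    where
    0^h : ∀ h → 1 ℕ.≤ h → (+ 0) ℤ.^ h ≡ + 0
    0^h (suc h) _ = ≡.refl
  ... | no  _   | yes e = K.sym e
  ... | no  x≉0 | no ≢1 with ^h≈±1 x≉0
  ...   | inj₁ e = contradiction e ≢1
  ...   | inj₂ e = K.sym e

  ∣χ∣≤1 : ∀ x → ∣ χ x ∣ ℕ.≤ 1
  ∣χ∣≤1 x with x ≈? + 0 | x ℤ.^ h ≈? + 1
  ... | yes _ | _     = ℕ.z≤n
  ... | no  _ | yes _ = ℕP.≤-refl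
  ... | no  _ | no  _ = ℕP.≤-refl

  private
    unit-ball⇒≡ : ∀ {x y} → ∣ x ∣ ℕ.≤ 1 → ∣ y ∣ ℕ.≤ 1 → x ≈ₘ y → x ≡ y
    unit-ball⇒≡ {x} {y} x≤1 y≤1 e = close⇒≡ e (ℕ.s≤s
      (ℕP.≤-trans (ℤP.∣i-j∣≤∣i∣+∣j∣ x y) (ℕP.≤-trans (ℕP.+-mono-≤ x≤1 y≤1) (≡.subst (2 ℕ.≤_) (≡.sym m≡) (ℕP.+-mono-≤ 1≤h 1≤h)))))

  χ-cong : ∀ {x y} → x ≈ₘ y → χ x ≡ χ y
  χ-cong {x} {y} e = unit-ball⇒≡ (∣χ∣≤1 x) (∣χ∣≤1 y) (K.trans (χ≈^h x) (K.trans (^-cong h e) (K.sym (χ≈^h y))))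

  χ-* : ∀ x y → χ (x ℤ.* y) ≡ χ x ℤ.* χ y
  χ-* x y = unit-ball⇒≡ (∣χ∣≤1 (x ℤ.* y))
    (ℕP.≤-trans (ℕP.≤-reflexive (ℤP.abs-* (χ x) (χ y))) (ℕP.*-mono-≤ (∣χ∣≤1 x) (∣χ∣≤1 y)))
    (K.trans (χ≈^h (x ℤ.* y)) (K.trans (≈⇒≈ₘ (^-distribʳ-* x y h)) (K.sym (K.*-cong (χ≈^h x) (χ≈^h y)))))

  -- The exponent h = 2n is even; this is where q ≡ 1 (mod 4) enters.
  χ-neg : ∀ x → χ (ℤ.- x) ≡ χ x
  χ-neg x = unit-ball⇒≡ (∣χ∣≤1 (ℤ.- x)) (∣χ∣≤1 x)
    (K.trans (χ≈^h (ℤ.- x)) (K.trans (≈⇒≈ₘ neg-^h) (K.sym (χ≈^h x))))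
    where
    double : ∀ y → y ℤ.^ h ≡ (y ℤ.* y) ℤ.^ n
    double y = ≡.trans (cong (y ℤ.^_) h≡) (^-double y n)
    neg-^h : (ℤ.- x) ℤ.^ h ≡ x ℤ.^ h
    neg-^h = ≡.trans (double (ℤ.- x)) (≡.trans (cong (ℤ._^ n) (solve 1 (λ x → (:- x) :* (:- x) := x :* x) ≡.refl x)) (≡.sym (double x)))

  χ² : ∀ x → χ x ℤ.* χ x ≡ + 1 ℤ.- δ x
  χ² x with x ≈? + 0 | x ℤ.^ h ≈? + 1
  ... | yes _ | _     = ≡.refl
  ... | no  _ | yes _ = ≡.refl
  ... | no  _ | no  _ = ≡.refl

  χ-1 : χ (+ 1) ≡ + 1
  χ-1 = unit-ball⇒≡ (∣χ∣≤1 (+ 1)) ℕP.≤-refl (K.trans (χ≈^h (+ 1)) (≈⇒≈ₘ (ℤP.^-zeroˡ h)))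

  χ-0 : ∀ {x} → x ≈ₘ + 0 → χ x ≡ + 0
  χ-0 {x} x≈0 with x ≈? + 0 | x ℤ.^ h ≈? + 1
  ... | yes _   | _ = ≡.refl
  ... | no  x≉0 | _ = contradiction x≈0 x≉0

  χ≢-1⇒^h≈1 : ∀ {x} → ¬ x ≈ₘ + 0 → ¬ χ x ≡ -[1+ 0 ] → x ℤ.^ h ≈ₘ + 1
  χ≢-1⇒^h≈1 {x} x≉0 χ≢ with x ≈? + 0 | x ℤ.^ h ≈? + 1
  ... | yes x≈0 | _     = contradiction x≈0 x≉0
  ... | no  _   | yes e = e
  ... | no  _   | no  _ = contradiction ≡.refl χ≢

  private
    bound : (i : Fin (suc h)) → suc (toℕ i) ℕ.< q
    bound i = ℕ.s≤s (ℕP.≤-trans (FinP.toℕ<n i) (≡.subst (suc h ℕ.≤_) (≡.sym m≡) (ℕP.+-monoˡ-≤ h 1≤h)))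

  abstract
    -- Otherwise 1, …, h + 1 would be roots of X^h - 1.
    nonresidue : ∃ λ b → b ℕ.< q × χ (+ b) ≡ -[1+ 0 ]
    nonresidue with FinP.any? {suc h} (λ i → χ (+ suc (toℕ i)) ℤP.≟ -[1+ 0 ])
    ... | yes (i , e) = suc (toℕ i) , bound i , e
    ... | no  none    = contradiction root (few-roots h cs length-cs r r-injective)
      where
      cs : List ℤ
      cs = -[1+ 0 ] ∷ replicate (ℕ.pred h) (+ 0)
      suc-pred-h : suc (ℕ.pred h) ≡ h
      suc-pred-h = ℕP.suc-pred h {{ℕ.>-nonZero 1≤h}}
      length-cs : length cs ≡ h
      length-cs = ≡.trans (cong suc (ListP.length-replicate (ℕ.pred h))) suc-pred-h
      r : Fin (suc h) → ℤ
      r i = + suc (toℕ i)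
      r-injective : ∀ {i k} → r i ≈ₘ r k → i ≡ k
      r-injective {i} {k} e = FinP.toℕ-injective (ℕP.suc-injective (small≈⇒≡ (bound i) (bound k) e))
      r≉0 : ∀ i → ¬ r i ≈ₘ + 0
      r≉0 i e = contradiction (small≈⇒≡ (bound i) (ℕ.s≤s ℕ.z≤n) e) λ ()
      root : ∀ i → MonicPolynomial.eval cs (r i) ≈ₘ + 0
      root i = K.trans (≈⇒≈ₘ (≡.trans (MonicPolynomial.eval-X^n+c -[1+ 0 ] (ℕ.pred h) (r i)) (cong (λ k → -[1+ 0 ] ℤ.+ r i ℤ.^ k) suc-pred-h)))
        (K.+-congˡ { -[1+ 0 ]} (χ≢-1⇒^h≈1 (r≉0 i) (λ e → none (i , e))))

  open Reindexing ℤP.+-0-commutativeMonoid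

  Respects : (ℤ → ℤ) → Set
  Respects F = ∀ {x y} → x ≈ₘ y → F x ≡ F y

  abstract
    -- Opaque outside this block, so that sums over residues are handled only through the rules
    -- proved here; `S≡sum` recovers the plain sum where it meets `convolve`.
    S : (ℤ → ℤ) → ℤ
    S F = sum {q} (λ i → F (ι i))

    S-cong : ∀ {F G : ℤ → ℤ} → (∀ x → F x ≡ G x) → S F ≡ S G
    S-cong {F} {G} e = sum-cong-≗ {q} (λ i → e (ι i))

    S-+ : ∀ (F G : ℤ → ℤ) → S (λ x → F x ℤ.+ G x) ≡ S F ℤ.+ S G
    S-+ F G = ∑-distrib-+ (λ i → F (ι i)) (λ i → G (ι i))

    S-* : ∀ c (F : ℤ → ℤ) → S (λ x → c ℤ.* F x) ≡ c ℤ.* S F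
    S-* c F = ≡.sym (*-distribˡ-sum c (λ i → F (ι i)))

    S-neg : ∀ (F : ℤ → ℤ) → S (λ x → ℤ.- F x) ≡ ℤ.- S F
    S-neg F = begin
      S (λ x → ℤ.- F x)             ≡⟨ S-cong (λ x → ℤP.-1*i≡-i (F x)) ⟨
      S (λ x → -[1+ 0 ] ℤ.* F x)    ≡⟨ S-* -[1+ 0 ] F ⟩
      -[1+ 0 ] ℤ.* S F              ≡⟨ ℤP.-1*i≡-i (S F) ⟩
      ℤ.- S F                       ∎

    S-1 : S (λ _ → + 1) ≡ + q
    S-1 = go q
      where
      go : ∀ k → sum {k} (λ _ → + 1) ≡ + k
      go zero    = ≡.refl
      go (suc k) = cong (λ t → + 1 ℤ.+ t) (go k)

    S-δ : ∀ (F : ℤ → ℤ) → S (λ x → δ x ℤ.* F x) ≡ F (+ 0)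
    S-δ F = begin
      δ (+ 0) ℤ.* F (+ 0) ℤ.+ sum {m} (λ i → δ (ι (Fin.suc i)) ℤ.* F (ι (Fin.suc i)))
        ≡⟨ cong₂ (λ d t → d ℤ.* F (+ 0) ℤ.+ t) (δ-0 {+ 0} K.refl) tail≡0 ⟩
      + 1 ℤ.* F (+ 0) ℤ.+ + 0
        ≡⟨ solve 1 (λ f → con (+ 1) :* f :+ con (+ 0) := f) ≡.refl (F (+ 0)) ⟩
      F (+ 0)                                                                          ∎
      where
      ι-suc≉0 : ∀ (i : Fin m) → ¬ ι (Fin.suc i) ≈ₘ + 0
      ι-suc≉0 i e = contradiction (ι-injective {Fin.suc i} {Fin.zero} e) λ ()
      sum-0 : ∀ {k} (t : Fin k → ℤ) → (∀ i → t i ≡ + 0) → sum t ≡ + 0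
      sum-0 {zero}  t t≡0 = ≡.refl
      sum-0 {suc k} t t≡0 = cong₂ ℤ._+_ (t≡0 Fin.zero) (sum-0 (λ i → t (Fin.suc i)) (λ i → t≡0 (Fin.suc i)))
      tail≡0 : sum {m} (λ i → δ (ι (Fin.suc i)) ℤ.* F (ι (Fin.suc i))) ≡ + 0
      tail≡0 = sum-0 (λ i → δ (ι (Fin.suc i)) ℤ.* F (ι (Fin.suc i))) λ i → cong (ℤ._* F (ι (Fin.suc i))) (δ-≉0 (ι-suc≉0 i))

    S-scale : ∀ {F : ℤ → ℤ} → Respects F → ∀ {a} → ¬ a ≈ₘ + 0 → S (λ x → F (a ℤ.* x)) ≡ S F
    S-scale {F} = reindex-scale F

    S-reflect : ∀ {F : ℤ → ℤ} → Respects F → ∀ c → S (λ x → F (c ℤ.- x)) ≡ S F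
    S-reflect {F} = reindex-reflect F

    S-swap : ∀ (F : ℤ → ℤ → ℤ) → S (λ x → S (F x)) ≡ S (λ y → S (λ x → F x y))
    S-swap F = ∑-comm {q} {q} (λ i k → F (ι i) (ι k))

    S≡sum : ∀ (F : ℤ → ℤ) → S F ≡ sum {q} (λ i → F (ι i))
    S≡sum F = ≡.refl

  -- Scaling the summation variable by a nonresidue b changes the sign of every term but not the
  -- sum.
  S-χ : S χ ≡ + 0
  S-χ with nonresidue
  ... | b , _ , χb≡-1 = ≡-neg⇒≡0 (begin
    S χ                              ≡⟨ S-scale χ-cong b≉0 ⟨
    S (λ x → χ (+ b ℤ.* x))          ≡⟨ S-cong (λ x → χ-* (+ b) x) ⟩
    S (λ x → χ (+ b) ℤ.* χ x)        ≡⟨ S-* (χ (+ b)) χ ⟩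
    χ (+ b) ℤ.* S χ                  ≡⟨ cong (ℤ._* S χ) χb≡-1 ⟩
    -[1+ 0 ] ℤ.* S χ                 ≡⟨ ℤP.-1*i≡-i (S χ) ⟩
    ℤ.- S χ                          ∎)
    where
    b≉0 : ¬ + b ≈ₘ + 0
    b≉0 b≈0 = contradiction (≡.trans (≡.sym χb≡-1) (χ-0 b≈0)) λ ()
    ≡-neg⇒≡0 : ∀ {x} → x ≡ ℤ.- x → x ≡ + 0
    ≡-neg⇒≡0 {+ zero} _ = ≡.refl

  S-1-δ : S (λ x → + 1 ℤ.- δ x) ≡ + m
  S-1-δ = begin
    S (λ x → + 1 ℤ.- δ x)                      ≡⟨ S-+ (λ _ → + 1) (λ x → ℤ.- δ x) ⟩
    S (λ _ → + 1) ℤ.+ S (λ x → ℤ.- δ x)        ≡⟨ cong₂ ℤ._+_ S-1 (S-neg δ) ⟩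
    + q ℤ.- S δ                                ≡⟨ cong (λ t → + q ℤ.- t) S-δ-1 ⟩
    + m                                        ∎
    where
    S-δ-1 : S δ ≡ + 1
    S-δ-1 = begin
      S δ                       ≡⟨ S-cong (λ x → ℤP.*-identityʳ (δ x)) ⟨
      S (λ x → δ x ℤ.* + 1)     ≡⟨ S-δ (λ _ → + 1) ⟩
      + 1                       ∎

  -- The coefficient at X^c of G² modulo X^q - 1, where G is the polynomial with coefficients χ(s).
  autocorrelation : ℤ → ℤ
  autocorrelation c = S (λ x → χ x ℤ.* χ (c ℤ.- x))

  autocorrelation-0 : ∀ {c} → c ≈ₘ + 0 → autocorrelation c ≡ + m
  autocorrelation-0 {c} c≈0 = ≡.trans (S-cong λ x → ≡.trans (cong (χ x ℤ.*_) (≡.trans (χ-cong (reflect x)) (χ-neg x))) (χ² x)) S-1-δ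
    where
    reflect : ∀ x → c ℤ.- x ≈ₘ ℤ.- x
    reflect x = K.trans (K.+-congʳ { ℤ.- x} c≈0) (K.+-identityˡ (ℤ.- x))

  -- Replacing x by c x pulls out the factor χ(c)² = 1.
  autocorrelation-1 : ∀ {c} → ¬ c ≈ₘ + 0 → autocorrelation c ≡ autocorrelation (+ 1)
  autocorrelation-1 {c} c≉0 = begin
    S (λ x → χ x ℤ.* χ (c ℤ.- x))
      ≡⟨ S-scale {λ x → χ x ℤ.* χ (c ℤ.- x)} (λ e → cong₂ ℤ._*_ (χ-cong e) (χ-cong (K.+-congˡ {c} (K.-‿cong e)))) c≉0 ⟨
    S (λ x → χ (c ℤ.* x) ℤ.* χ (c ℤ.- c ℤ.* x))            ≡⟨ S-cong scaled ⟩
    S (λ x → χ x ℤ.* χ (+ 1 ℤ.- x))                        ∎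
    where
    scaled : ∀ x → χ (c ℤ.* x) ℤ.* χ (c ℤ.- c ℤ.* x) ≡ χ x ℤ.* χ (+ 1 ℤ.- x)
    scaled x = begin
      χ (c ℤ.* x) ℤ.* χ (c ℤ.- c ℤ.* x)
        ≡⟨ cong₂ ℤ._*_ (χ-* c x) (≡.trans (cong χ (solve 2 (λ c x → c :- c :* x := c :* (con (+ 1) :- x)) ≡.refl c x)) (χ-* c (+ 1 ℤ.- x))) ⟩
      (χ c ℤ.* χ x) ℤ.* (χ c ℤ.* χ (+ 1 ℤ.- x))
        ≡⟨ solve 3 (λ c x y → (c :* x) :* (c :* y) := (c :* c) :* (x :* y)) ≡.refl (χ c) (χ x) (χ (+ 1 ℤ.- x)) ⟩
      (χ c ℤ.* χ c) ℤ.* (χ x ℤ.* χ (+ 1 ℤ.- x))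
        ≡⟨ cong (ℤ._* (χ x ℤ.* χ (+ 1 ℤ.- x))) (≡.trans (χ² c) (cong (λ t → + 1 ℤ.- t) (δ-≉0 c≉0))) ⟩
      + 1 ℤ.* (χ x ℤ.* χ (+ 1 ℤ.- x))                    ≡⟨ ℤP.*-identityˡ _ ⟩
      χ x ℤ.* χ (+ 1 ℤ.- x)                              ∎

  -- The coefficients of G² add up to G(1)², and G(1) = S χ vanishes.
  S-autocorrelation : S autocorrelation ≡ + 0
  S-autocorrelation = begin
    S (λ c → S (λ x → χ x ℤ.* χ (c ℤ.- x)))     ≡⟨ S-swap (λ c x → χ x ℤ.* χ (c ℤ.- x)) ⟩
    S (λ x → S (λ c → χ x ℤ.* χ (c ℤ.- x)))
      ≡⟨ S-cong (λ x → ≡.trans (S-* (χ x) (λ c → χ (c ℤ.- x))) (≡.trans (cong (χ x ℤ.*_) (S-translate x)) (ℤP.*-zeroʳ (χ x)))) ⟩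
    S (λ x → + 0)                               ≡⟨ S-* (+ 0) (λ _ → + 0) ⟩
    + 0                                         ∎
    where
    S-translate : ∀ x → S (λ c → χ (c ℤ.- x)) ≡ + 0
    S-translate x = begin
      S (λ c → χ (c ℤ.- x))
        ≡⟨ S-cong (λ c → ≡.trans (≡.sym (χ-neg (c ℤ.- x))) (cong χ (solve 2 (λ c x → :- (c :- x) := x :- c) ≡.refl c x))) ⟩
      S (λ c → χ (x ℤ.- c))   ≡⟨ S-reflect χ-cong x ⟩
      S χ                     ≡⟨ S-χ ⟩
      + 0                     ∎

  -- This is G² = q - U, coefficient by coefficient. The value is m at 0 and a constant T elsewhere;
  -- the total m + T m is 0, so T = -1.
  autocorrelation-δ : ∀ c → autocorrelation c ≡ + q ℤ.* δ c ℤ.- + 1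
  autocorrelation-δ c with c ≈? + 0
  ... | yes c≈0 = ≡.trans (autocorrelation-0 c≈0) (cong (λ t → t ℤ.- + 1) (≡.sym (ℤP.*-identityʳ (+ q))))
  ... | no  c≉0 = ≡.trans (autocorrelation-1 c≉0) (≡.trans T≡-1 (cong (λ t → t ℤ.- + 1) (≡.sym (ℤP.*-zeroʳ (+ q)))))
    where
    T = autocorrelation (+ 1)
    by-cases : ∀ c → autocorrelation c ≡ δ c ℤ.* + m ℤ.+ T ℤ.* (+ 1 ℤ.- δ c)
    by-cases c with c ≈? + 0
    ... | yes c≈0 = ≡.trans (autocorrelation-0 c≈0) (solve 2 (λ m t → m := con (+ 1) :* m :+ t :* con (+ 0)) ≡.refl (+ m) T)
    ... | no  c≉0 = ≡.trans (autocorrelation-1 c≉0) (solve 2 (λ m t → t := con (+ 0) :* m :+ t :* con (+ 1)) ≡.refl (+ m) T)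
    m+Tm≡0 : + m ℤ.+ T ℤ.* + m ≡ + 0
    m+Tm≡0 = begin
      + m ℤ.+ T ℤ.* + m
        ≡⟨ cong₂ ℤ._+_ (S-δ (λ _ → + m)) (≡.trans (S-* T (λ c → + 1 ℤ.- δ c)) (cong (T ℤ.*_) S-1-δ)) ⟨
      S (λ c → δ c ℤ.* + m) ℤ.+ S (λ c → T ℤ.* (+ 1 ℤ.- δ c))            ≡⟨ S-+ (λ c → δ c ℤ.* + m) (λ c → T ℤ.* (+ 1 ℤ.- δ c)) ⟨
      S (λ c → δ c ℤ.* + m ℤ.+ T ℤ.* (+ 1 ℤ.- δ c))                      ≡⟨ S-cong by-cases ⟨
      S autocorrelation                                                  ≡⟨ S-autocorrelation ⟩
      + 0                                                                ∎
    m≢0 : ¬ + m ≡ + 0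
    m≢0 e = ℕP.<⇒≢ (ℕP.≤-trans 1≤h (ℕP.m≤m+n h h)) (≡.trans (≡.sym (ℤP.+-injective e)) m≡)
    T≡-1 : T ≡ -[1+ 0 ]
    T≡-1 = [ (λ e → ≡.trans (solve 1 (λ t → t := (t :+ con (+ 1)) :- con (+ 1)) ≡.refl T) (cong (λ t → t ℤ.- + 1) e))
           , (λ e → contradiction e m≢0) ]′
           (ℤP.i*j≡0⇒i≡0∨j≡0 (T ℤ.+ + 1) (≡.trans (solve 2 (λ t m → (t :+ con (+ 1)) :* m := m :+ t :* m) ≡.refl T (+ m)) m+Tm≡0))

  private
    [χ≡-1] : ℤ → ℤ
    [χ≡-1] (+ _)    = + 0
    [χ≡-1] -[1+ _ ] = + 1

  -- Indicator of the nonresidues, the coefficient function of N. As `𝔽` is carried by ℤ, the same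
  -- function gives coefficients modulo p.
  ν : ℤ → ℤ
  ν x = [χ≡-1] (χ x)

  ν-cong : Respects ν
  ν-cong e = cong [χ≡-1] (χ-cong e)

  ν-0 : ν (+ 0) ≡ + 0
  ν-0 = cong [χ≡-1] (χ-0 {+ 0} K.refl)

  ν-1 : ν (+ 1) ≡ + 0
  ν-1 = cong [χ≡-1] χ-1

  ν-nonresidue : ∀ {x} → χ x ≡ -[1+ 0 ] → ν x ≡ + 1
  ν-nonresidue e = cong [χ≡-1] e

  2ν : ∀ x → + 2 ℤ.* ν x ≡ + 1 ℤ.- δ x ℤ.- χ x
  2ν x with x ≈? + 0 | x ℤ.^ h ≈? + 1
  ... | yes _ | _     = ≡.refl
  ... | no  _ | yes _ = ≡.refl
  ... | no  _ | no  _ = ≡.refl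

  private
    -- Convolution of 2ν = 1 - δ - χ with G, term by term: 1 yields the total of G and δ yields
    -- G(c). It is applied with G = 1 - δ - χ and then with G = χ, which leaves only the
    -- autocorrelation.
    S-ν-reflect : ∀ G → Respects G → ∀ c →
      S (λ x → (+ 1 ℤ.- δ x ℤ.- χ x) ℤ.* G (c ℤ.- x)) ≡ S G ℤ.- G c ℤ.- S (λ x → χ x ℤ.* G (c ℤ.- x))
    S-ν-reflect G G-cong c = begin
      S (λ x → (+ 1 ℤ.- δ x ℤ.- χ x) ℤ.* Gc x)
        ≡⟨ S-cong (λ x → solve 3 (λ d y g → (con (+ 1) :- d :- y) :* g := (g :+ :- (d :* g)) :+ :- (y :* g)) ≡.refl (δ x) (χ x) (Gc x)) ⟩
      S (λ x → (Gc x ℤ.- δ x ℤ.* Gc x) ℤ.- χ x ℤ.* Gc x)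
        ≡⟨ S-+ (λ x → Gc x ℤ.- δ x ℤ.* Gc x) (λ x → ℤ.- (χ x ℤ.* Gc x)) ⟩
      S (λ x → Gc x ℤ.- δ x ℤ.* Gc x) ℤ.+ S (λ x → ℤ.- (χ x ℤ.* Gc x))
        ≡⟨ cong₂ ℤ._+_ (S-+ Gc (λ x → ℤ.- (δ x ℤ.* Gc x))) (S-neg (λ x → χ x ℤ.* Gc x)) ⟩
      (S Gc ℤ.+ S (λ x → ℤ.- (δ x ℤ.* Gc x))) ℤ.- S (λ x → χ x ℤ.* Gc x)
        ≡⟨ cong (ℤ._- S (λ x → χ x ℤ.* Gc x)) (cong₂ ℤ._+_ (S-reflect G-cong c)
                                                                                             (≡.trans (S-neg (λ x → δ x ℤ.* Gc x)) (cong ℤ.-_ (≡.trans (S-δ Gc) (cong G (ℤP.+-identityʳ c)))))) ⟩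
      S G ℤ.- G c ℤ.- S (λ x → χ x ℤ.* Gc x)                                             ∎
      where
      Gc : ℤ → ℤ
      Gc x = G (c ℤ.- x)

  -- Stated with the factor 4 because 2ν, not ν, is an integral combination of 1, δ and χ.
  4∑νν : ∀ c → + 4 ℤ.* (ν c ℤ.+ S (λ x → ν x ℤ.* ν (c ℤ.- x))) ≡ + m ℤ.* (+ 1 ℤ.+ δ c)
  4∑νν c = begin
    + 4 ℤ.* (ν c ℤ.+ S (λ x → ν x ℤ.* ν (c ℤ.- x)))
      ≡⟨ solve 2 (λ v s → con (+ 4) :* (v :+ s) := con (+ 2) :* (con (+ 2) :* v) :+ con (+ 4) :* s) ≡.refl (ν c) (S (λ x → ν x ℤ.* ν (c ℤ.- x))) ⟩
    + 2 ℤ.* (+ 2 ℤ.* ν c) ℤ.+ + 4 ℤ.* S (λ x → ν x ℤ.* ν (c ℤ.- x))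
      ≡⟨ cong₂ ℤ._+_ (cong (+ 2 ℤ.*_) (2ν c)) (≡.trans (≡.sym (S-* (+ 4) (λ x → ν x ℤ.* ν (c ℤ.- x)))) (S-cong doubled)) ⟩
    + 2 ℤ.* u c ℤ.+ S (λ x → u x ℤ.* u (c ℤ.- x))                  ≡⟨ cong (λ t → + 2 ℤ.* u c ℤ.+ t) (S-ν-reflect u u-cong c) ⟩
    + 2 ℤ.* u c ℤ.+ (S u ℤ.- u c ℤ.- S (λ x → χ x ℤ.* u (c ℤ.- x))) ≡⟨ cong (λ t → + 2 ℤ.* u c ℤ.+ (S u ℤ.- u c ℤ.- t)) swapped ⟩
    + 2 ℤ.* u c ℤ.+ (S u ℤ.- u c ℤ.- (S χ ℤ.- χ c ℤ.- autocorrelation c))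
      ≡⟨ cong₂ (λ s t → + 2 ℤ.* u c ℤ.+ (s ℤ.- u c ℤ.- (t ℤ.- χ c ℤ.- autocorrelation c))) S-u S-χ ⟩
    + 2 ℤ.* u c ℤ.+ (+ m ℤ.- u c ℤ.- (+ 0 ℤ.- χ c ℤ.- autocorrelation c))
      ≡⟨ cong (λ t → + 2 ℤ.* u c ℤ.+ (+ m ℤ.- u c ℤ.- (+ 0 ℤ.- χ c ℤ.- t))) (autocorrelation-δ c) ⟩
    + 2 ℤ.* u c ℤ.+ (+ m ℤ.- u c ℤ.- (+ 0 ℤ.- χ c ℤ.- ((+ 1 ℤ.+ + m) ℤ.* δ c ℤ.- + 1))) ≡⟨ solve 3 (λ m d x →
      con (+ 2) :* (con (+ 1) :- d :- x) :+ (m :- (con (+ 1) :- d :- x) :- (con (+ 0) :- x :- ((con (+ 1) :+ m) :* d :- con (+ 1)))) := m :* (con (+ 1) :+ d)) ≡.refl (+ m) (δ c) (χ c) ⟩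
    + m ℤ.* (+ 1 ℤ.+ δ c)                                          ∎
    where
    u : ℤ → ℤ
    u x = + 1 ℤ.- δ x ℤ.- χ x
    u-cong : Respects u
    u-cong e = cong₂ (λ d y → + 1 ℤ.- d ℤ.- y) (δ-cong e) (χ-cong e)
    doubled : ∀ x → + 4 ℤ.* (ν x ℤ.* ν (c ℤ.- x)) ≡ u x ℤ.* u (c ℤ.- x)
    doubled x = ≡.trans (solve 2 (λ v w → con (+ 4) :* (v :* w) := (con (+ 2) :* v) :* (con (+ 2) :* w)) ≡.refl (ν x) (ν (c ℤ.- x))) (cong₂ ℤ._*_ (2ν x) (2ν (c ℤ.- x)))
    S-u : S u ≡ + m
    S-u = begin
      S u                                                  ≡⟨ S-+ (λ x → + 1 ℤ.- δ x) (λ x → ℤ.- χ x) ⟩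
      S (λ x → + 1 ℤ.- δ x) ℤ.+ S (λ x → ℤ.- χ x)          ≡⟨ cong₂ ℤ._+_ S-1-δ (≡.trans (S-neg χ) (cong ℤ.-_ S-χ)) ⟩
      + m ℤ.+ + 0                                          ≡⟨ ℤP.+-identityʳ (+ m) ⟩
      + m                                                  ∎
    swapped : S (λ x → χ x ℤ.* u (c ℤ.- x)) ≡ S χ ℤ.- χ c ℤ.- autocorrelation c
    swapped = begin
      S (λ x → χ x ℤ.* u (c ℤ.- x))
        ≡⟨ S-reflect {λ x → χ x ℤ.* u (c ℤ.- x)} (λ e → cong₂ ℤ._*_ (χ-cong e) (u-cong (K.+-congˡ {c} (K.-‿cong e)))) c ⟨
      S (λ x → χ (c ℤ.- x) ℤ.* u (c ℤ.- (c ℤ.- x)))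
        ≡⟨ S-cong (λ x → ≡.trans (ℤP.*-comm (χ (c ℤ.- x)) _) (cong (λ t → u t ℤ.* χ (c ℤ.- x)) (solve 2 (λ c x → c :- (c :- x) := x) ≡.refl c x))) ⟩
      S (λ x → u x ℤ.* χ (c ℤ.- x))            ≡⟨ S-ν-reflect χ χ-cong c ⟩
      S χ ℤ.- χ c ℤ.- autocorrelation c        ∎

  -- The division by 4 takes place in ℤ, before reduction modulo p, and leaves the coefficient n =
  -- (q - 1)/4. Hence p | n suffices for every p, including 2.
  ∑νν : ∀ c → ν c ℤ.+ S (λ x → ν x ℤ.* ν (c ℤ.- x)) ≡ + n ℤ.* (+ 1 ℤ.+ δ c)
  ∑νν c = ℤP.*-cancelˡ-≡ (+ 4) _ _ (≡.trans (4∑νν c) (≡.trans (cong (λ t → t ℤ.* (+ 1 ℤ.+ δ c)) +m≡4n) (ℤP.*-assoc (+ 4) (+ n) (+ 1 ℤ.+ δ c))))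
    where
    +m≡4n : + m ≡ + 4 ℤ.* + n
    +m≡4n = ≡.trans (cong +_ (≡.trans m≡ (cong₂ ℕ._+_ h≡ h≡))) (solve 1 (λ n → (n :+ n) :+ (n :+ n) := con (+ 4) :* n) ≡.refl (+ n))

-- Geometric sums and multiplicative orders modulo q.

halve : ∀ n → ∃ λ s → n ≡ s ℕ.+ s ⊎ n ≡ suc (s ℕ.+ s)
halve zero    = 0 , inj₁ ≡.refl
halve (suc n) with halve n
... | s , inj₁ ≡.refl = s , inj₂ ≡.refl
... | s , inj₂ ≡.refl = suc s , inj₁ (cong suc (≡.sym (ℕP.+-suc s s)))

prime-divisor : ∀ n → 2 ℕ.≤ n → ∃ λ q → Prime q × q ℕ∣.∣ n
prime-divisor n@(suc _) 2≤n = go factors isFactorisation factorsPrime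
  where
  open PrimeFactorisation (factorise n)
  go : ∀ qs → n ≡ product qs → All Prime qs → ∃ λ q → Prime q × q ℕ∣.∣ n
  go []       eq _        = contradiction (≡.sym eq) (ℕP.<⇒≢ 2≤n)
  go (q ∷ qs) eq (pq ∷ _) = q , pq , ℕ∣.divides (product qs) (≡.trans eq (ℕP.*-comm q (product qs)))

geometric : ℕ → ℤ → ℤ
geometric zero    u = + 0
geometric (suc k) u = + 1 ℤ.+ u ℤ.* geometric k u

geometric-telescope : ∀ k u → (u ℤ.- + 1) ℤ.* geometric k u ≡ u ℤ.^ k ℤ.- + 1
geometric-telescope zero    u = ℤP.*-zeroʳ (u ℤ.- + 1)
geometric-telescope (suc k) u = begin
  (u ℤ.- + 1) ℤ.* (+ 1 ℤ.+ u ℤ.* geometric k u)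
    ≡⟨ solve 2 (λ u g → (u :- con (+ 1)) :* (con (+ 1) :+ u :* g) := (u :- con (+ 1)) :+ u :* ((u :- con (+ 1)) :* g)) ≡.refl u (geometric k u) ⟩
  (u ℤ.- + 1) ℤ.+ u ℤ.* ((u ℤ.- + 1) ℤ.* geometric k u)  ≡⟨ cong (λ t → (u ℤ.- + 1) ℤ.+ u ℤ.* t) (geometric-telescope k u) ⟩
  (u ℤ.- + 1) ℤ.+ u ℤ.* (u ℤ.^ k ℤ.- + 1)
    ≡⟨ solve 2 (λ u w → (u :- con (+ 1)) :+ u :* (w :- con (+ 1)) := u :* w :- con (+ 1)) ≡.refl u (u ℤ.^ k) ⟩
  u ℤ.* u ℤ.^ k ℤ.- + 1                                  ∎
  where
  open ≡-Reasoning
  open ℤS.+-*-Solver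

geometric-1 : ∀ k → geometric k (+ 1) ≡ + k
geometric-1 zero    = ≡.refl
geometric-1 (suc k) = cong (λ t → + 1 ℤ.+ t) (≡.trans (ℤP.*-identityˡ _) (geometric-1 k))

∣geometric∣≥2 : ∀ {k u} → 2 ℕ.≤ k → 3 ℕ.≤ ∣ u ∣ → 2 ℕ.≤ ∣ geometric k u ∣
∣geometric∣≥2 {suc (suc k)} {u} (ℕ.s≤s (ℕ.s≤s _)) 3≤∣u∣ = ≥2 (geometric (2 ℕ.+ k) u) ≡.refl
  where
  no-small-multiple : ∀ g {c} → u ℤ.* g ≡ c → ∣ c ∣ ℕ.≤ 2 → ∣ g ∣ ≡ 0
  no-small-multiple g {c} ug≡c c≤2 = ∣g∣≡0 ∣ g ∣ (≡.trans (≡.sym (ℤP.abs-* u g)) (cong ∣_∣ ug≡c))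
    where
    ∣g∣≡0 : ∀ n → ∣ u ∣ ℕ.* n ≡ ∣ c ∣ → n ≡ 0
    ∣g∣≡0 zero    _ = ≡.refl
    ∣g∣≡0 (suc n) e = contradiction (ℕP.≤-trans 3≤∣u∣ (ℕP.≤-trans (ℕP.m≤m*n ∣ u ∣ (suc n)) (ℕP.≤-reflexive e))) (ℕP.≤⇒≯ c≤2)
  1+ug≢0 : ∀ g → ¬ + 1 ℤ.+ u ℤ.* g ≡ + 0
  1+ug≢0 g e = contradiction (≡.trans (≡.sym ug≡-1) (≡.trans (cong (u ℤ.*_) (ℤP.∣i∣≡0⇒i≡0 (no-small-multiple g ug≡-1 (ℕ.s≤s ℕ.z≤n)))) (ℤP.*-zeroʳ u))) λ ()
    where
    open ℤS.+-*-Solver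
    ug≡-1 : u ℤ.* g ≡ -[1+ 0 ]
    ug≡-1 = ≡.trans (solve 1 (λ t → t := (con (+ 1) :+ t) :- con (+ 1)) ≡.refl (u ℤ.* g)) (cong (λ t → t ℤ.- + 1) e)
  g₁ = geometric (suc k) u
  ug₁≡ : ∀ {c} → + 1 ℤ.+ u ℤ.* g₁ ≡ c → u ℤ.* g₁ ≡ c ℤ.- + 1
  ug₁≡ e = ≡.trans (solve 1 (λ t → t := (con (+ 1) :+ t) :- con (+ 1)) ≡.refl (u ℤ.* g₁)) (cong (λ t → t ℤ.- + 1) e)
    where open ℤS.+-*-Solver
  g₁≢0 : ¬ ∣ g₁ ∣ ≡ 0
  g₁≢0 e = 1+ug≢0 (geometric k u) (ℤP.∣i∣≡0⇒i≡0 e)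
  ≥2 : ∀ g → + 1 ℤ.+ u ℤ.* g₁ ≡ g → 2 ℕ.≤ ∣ g ∣
  ≥2 (+ 0)             e = contradiction e (1+ug≢0 g₁)
  ≥2 (+ 1)             e = contradiction (no-small-multiple g₁ (ug₁≡ e) ℕ.z≤n) g₁≢0
  ≥2 (+ suc (suc n))   e = ℕ.s≤s (ℕ.s≤s ℕ.z≤n)
  ≥2 -[1+ 0 ]          e = contradiction (no-small-multiple g₁ (ug₁≡ e) ℕP.≤-refl) g₁≢0
  ≥2 -[1+ suc n ]      e = ℕ.s≤s (ℕ.s≤s ℕ.z≤n)

module Orders (m : ℕ) (q-prime : Prime (suc m)) where

  open Residues m q-prime

  ^-trivial : ∀ {w a} t → w ℤ.^ a ≈ₘ + 1 → w ℤ.^ (t ℕ.* a) ≈ₘ + 1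
  ^-trivial {w} {a} t e = ≡.subst (_≈ₘ + 1) (≡.trans (ℤP.^-*-assoc w a t) (cong (w ℤ.^_) (ℕP.*-comm a t)))
    (K.trans (^-cong t e) (≈⇒≈ₘ (ℤP.^-zeroˡ t)))

  -- Otherwise ℓ and m are coprime, and a Bézout relation between them turns w^ℓ = 1 and w^m = 1
  -- into w = 1.
  prime-order : ∀ {ℓ w} → Prime ℓ → ¬ w ≈ₘ + 0 → w ℤ.^ ℓ ≈ₘ + 1 → ¬ w ≈ₘ + 1 → ℓ ℕ∣.∣ m
  prime-order {ℓ} {w} ℓ-prime w≉0 w^ℓ≈1 w≉1 with ℓ ℕ∣.∣? m
  ... | yes ℓ∣m = ℓ∣m
  ... | no  ℓ∤m = contradiction (w≈1 (ℕC.coprime-Bézout coprime)) w≉1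
    where
    coprime : ℕC.Coprime ℓ m
    coprime (d∣ℓ , d∣m) with prime⇒irreducible ℓ-prime d∣ℓ
    ... | inj₁ d≡1  = d≡1
    ... | inj₂ ≡.refl = contradiction d∣m ℓ∤m
    ^suc : ∀ {a b} → suc a ≡ b → w ℤ.^ a ≈ₘ + 1 → w ℤ.^ b ≈ₘ + 1 → w ≈ₘ + 1
    ^suc ≡.refl w^a≈1 w^b≈1 = K.trans (K.sym (K.trans (K.*-congˡ {w} w^a≈1) (K.*-identityʳ w))) w^b≈1
    w≈1 : ℕGCD.Bézout.Identity 1 ℓ m → w ≈ₘ + 1
    w≈1 (ℕGCD.Bézout.+- x y eq) = ^suc eq (^-trivial y (fermat w≉0)) (^-trivial x w^ℓ≈1)
    w≈1 (ℕGCD.Bézout.-+ x y eq) = ^suc eq (^-trivial x w^ℓ≈1) (^-trivial y (fermat w≉0))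

  abstract
    -- For odd t, z^m = (z^c)^t would be -1, against Fermat. Applied with c = 1, 2, 4 in turn, this
    -- extracts successive factors 2 from m.
    even-cofactor : ∀ {z c t} → ¬ + 2 ≈ₘ + 0 → ¬ z ≈ₘ + 0 → z ℤ.^ c ≈ₘ -[1+ 0 ] → m ≡ c ℕ.* t → ∃ λ s → t ≡ s ℕ.+ s
    even-cofactor {z} {c} {t} 2≉0 z≉0 z^c≈-1 m≡ct with halve t
    ... | s , inj₁ t≡ = s , t≡
    ... | s , inj₂ t≡ = contradiction (≈⇒-≈0 (K.trans (K.sym z^m≈1) z^m≈-1)) 2≉0
      where
      z^m≈1 : z ℤ.^ m ≈ₘ + 1
      z^m≈1 = fermat z≉0
      -1^t : -[1+ 0 ] ℤ.^ t ≡ -[1+ 0 ]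
      -1^t = ≡.trans (cong (-[1+ 0 ] ℤ.^_) t≡) (cong (-[1+ 0 ] ℤ.*_) (≡.trans (^-double -[1+ 0 ] s) (ℤP.^-zeroˡ s)))
      z^m≈-1 : z ℤ.^ m ≈ₘ -[1+ 0 ]
      z^m≈-1 = K.trans (≈⇒≈ₘ (≡.trans (cong (z ℤ.^_) m≡ct) (≡.sym (ℤP.^-*-assoc z c t)))) (K.trans (^-cong t z^c≈-1) (≈⇒≈ₘ -1^t))

-- The sum is 1 at u = 0 and k at u = 1. The first value excludes u ≡ 0, hence also q | x; the
-- second excludes u ≡ 1, since q | k would give q | x.
∣geometric⇒ : ∀ {m k u x} (q-prime : Prime (suc m)) → let open Residues m q-prime in
  1 ℕ.≤ k → suc m ℕ∣.∣ ∣ geometric k u ∣ → (+ x ≈ₘ + 0 → u ≈ₘ + 0) → k ℕ∣.∣ x →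
  ¬ suc m ℕ∣.∣ x × u ℤ.^ k ≈ₘ + 1 × ¬ u ≈ₘ + 1 × ¬ u ≈ₘ + 0
∣geometric⇒ {m} {suc k} {u} {x} q-prime _ q∣G x≈0⇒u≈0 p∣x = q∤x , u^p≈1 , u≉1 , u≉0
  where
  open Residues m q-prime
  G≈0 : geometric (suc k) u ≈ₘ + 0
  G≈0 = ∣⇒≈0 q∣G
  u≉0 : ¬ u ≈ₘ + 0
  u≉0 u≈0 = 1≉0 (K.trans (K.sym (K.trans (K.+-congˡ {+ 1} (K.trans (K.*-congʳ {geometric k u} u≈0) (K.zeroˡ (geometric k u)))) (K.+-identityʳ (+ 1)))) G≈0)
  q∤x : ¬ suc m ℕ∣.∣ x
  q∤x q∣x = u≉0 (x≈0⇒u≈0 (∣⇒≈0 q∣x))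
  u^p≈1 : u ℤ.^ suc k ≈ₘ + 1
  u^p≈1 = -≈0⇒≈ (K.trans (≈⇒≈ₘ (≡.sym (geometric-telescope (suc k) u))) (K.trans (K.*-congˡ {u ℤ.- + 1} G≈0) (K.zeroʳ (u ℤ.- + 1))))
  geometric-cong : ∀ j → u ≈ₘ + 1 → geometric j u ≈ₘ geometric j (+ 1)
  geometric-cong zero    e = K.refl
  geometric-cong (suc j) e = K.+-congˡ {+ 1} (K.*-cong e (geometric-cong j e))
  u≉1 : ¬ u ≈ₘ + 1
  u≉1 u≈1 = q∤x (ℕ∣.∣-trans (≈0⇒∣ (K.trans (≈⇒≈ₘ (≡.sym (geometric-1 (suc k)))) (K.trans (K.sym (geometric-cong (suc k) u≈1)) G≈0))) p∣x)

-- Primes q ≡ 1 (mod 4p) above any bound B.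

module _ (p : ℕ) (p-prime : Prime p) (B : ℕ) where

  private
    -- A prime that does not divide x is odd, different from p and larger than B.
    x = 2 ℕ.* (p ℕ.* B !)
    X = + x
    Y = + (x ℕ.* x)

    p∣x : p ℕ∣.∣ x
    p∣x = ℕ∣.∣n⇒∣m*n 2 (ℕ∣.m∣m*n (B !))

    2∣x : 2 ℕ∣.∣ x
    2∣x = ℕ∣.m∣m*n (p ℕ.* B !)

    B!∣x : B ! ℕ∣.∣ x
    B!∣x = ℕ∣.∣n⇒∣m*n 2 (ℕ∣.n∣m*n p)

    2≤p : 2 ℕ.≤ p
    2≤p = ℕ.nonTrivial⇒n>1 p {{Primality.prime⇒nonTrivial p-prime}}

    4≤x : 4 ℕ.≤ x
    4≤x = ℕP.*-mono-≤ (ℕP.≤-refl {2}) (ℕP.≤-trans 2≤p (ℕP.m≤m*n p (B !) {{B ℕP.!≢0}}))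

    3≤x*x : 3 ℕ.≤ x ℕ.* x
    3≤x*x = ℕP.≤-trans (ℕP.≤-trans (ℕP.n≤1+n 3) 4≤x) (ℕP.m≤m*n x x {{ℕ.>-nonZero (ℕP.≤-trans (ℕ.s≤s ℕ.z≤n) 4≤x)}})

    X*X≡Y : X ℤ.* X ≡ Y
    X*X≡Y = ≡.sym (ℤP.pos-* x x)

    ∤x⇒> : ∀ {m} → ¬ suc m ℕ∣.∣ x → B ℕ.< suc m
    ∤x⇒> {m} q∤x = ℕP.≰⇒> λ q≤B → q∤x (ℕ∣.∣-trans (ℕ∣.m∣m*n (m !)) (ℕ∣.∣-trans (ℕ∣.m≤n⇒m!∣n! q≤B) B!∣x))

    quadruple : ∀ {m s t} → m ≡ s ℕ.+ s → s ≡ t ℕ.+ t → m ≡ (t ℕ.+ t) ℕ.+ (t ℕ.+ t)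
    quadruple ≡.refl ≡.refl = ≡.refl

    double : ∀ t → t ℕ.+ t ≡ 2 ℕ.* t
    double t = cong (t ℕ.+_) (≡.sym (ℕP.+-identityʳ t))

    1≤p : 1 ℕ.≤ p
    1≤p = ℕP.≤-trans (ℕ.s≤s ℕ.z≤n) 2≤p

    X≈0⇒Y≈0 : ∀ {m} (q-prime : Prime (suc m)) → let open Residues m q-prime in X ≈ₘ + 0 → Y ≈ₘ + 0
    X≈0⇒Y≈0 {m} q-prime X≈0 = K.trans (≈⇒≈ₘ (≡.sym X*X≡Y)) (K.*-cong X≈0 X≈0)
      where open Residues m q-prime

  PrimeAbove : Set
  PrimeAbove = ∃₂ λ m n → Prime (suc m) × B ℕ.< suc m × p ℕ∣.∣ n × m ≡ (n ℕ.+ n) ℕ.+ (n ℕ.+ n)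

  module _ {m} (q-prime : Prime (suc m)) (q∤x : ¬ suc m ℕ∣.∣ x) where

    private
      open Orders m q-prime
      open Residues m q-prime

      X≉0 : ¬ X ≈ₘ + 0
      X≉0 X≈0 = q∤x (≈0⇒∣ X≈0)

      2≉0 : ¬ + 2 ≈ₘ + 0
      2≉0 2≈0 = q∤x (ℕ∣.∣-trans (≈0⇒∣ 2≈0) 2∣x)

      -1≉0 : ¬ -[1+ 0 ] ≈ₘ + 0
      -1≉0 e = 1≉0 (K.-‿cong e)

      ^≉0 : ∀ {z} k → ¬ z ≈ₘ + 0 → ¬ z ℤ.^ k ≈ₘ + 0
      ^≉0 zero    z≉0 = 1≉0
      ^≉0 (suc k) z≉0 e = [ z≉0 , ^≉0 k z≉0 ]′ (*-≈0 e)

      abstract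
        ∣m : ∀ {z} → ¬ z ≈ₘ + 0 → z ℤ.* z ≈ₘ -[1+ 0 ] → ∃ λ t → m ≡ (t ℕ.+ t) ℕ.+ (t ℕ.+ t)
        ∣m {z} z≉0 z²≈-1 with even-cofactor { -[1+ 0 ]} {1} {m} 2≉0 -1≉0 K.refl (≡.sym (ℕP.*-identityˡ m))
        ... | s , m≡2s with even-cofactor {z} {2} {s} 2≉0 z≉0 (K.trans (≈⇒≈ₘ (cong (z ℤ.*_) (ℤP.*-identityʳ z))) z²≈-1) (≡.trans m≡2s (double s))
        ...   | t , s≡2t = t , quadruple {m} {s} {t} m≡2s s≡2t

    -- `Y` is a square root of -1, so m = 4t; then X^4 = -1 extracts a third factor 2, which makes t
    -- even.
    prime-above-2 : p ≡ 2 → Y ℤ.* Y ≈ₘ -[1+ 0 ] → PrimeAbove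
    prime-above-2 p≡2 Y²≈-1 with ∣m {Y} (λ Y≈0 → [ X≉0 , X≉0 ]′ (*-≈0 (K.trans (≈⇒≈ₘ X*X≡Y) Y≈0))) Y²≈-1
    ... | t , m≡4t = m , t , q-prime , ∤x⇒> q∤x , p∣t , m≡4t
      where
      X^4≈-1 : X ℤ.^ 4 ≈ₘ -[1+ 0 ]
      X^4≈-1 = K.trans (≈⇒≈ₘ (≡.trans (^-double X 2) (≡.trans (cong (λ w → w ℤ.^ 2) X*X≡Y) (cong (Y ℤ.*_) (ℤP.*-identityʳ Y))))) Y²≈-1
      p∣t : p ℕ∣.∣ t
      p∣t with even-cofactor {X} {4} {t} 2≉0 X≉0 X^4≈-1 (≡.trans m≡4t (≡.trans (≡.trans (double (t ℕ.+ t)) (cong (2 ℕ.*_) (double t))) (≡.sym (ℕP.*-assoc 2 2 t))))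
      ... | s , t≡2s = ≡.subst₂ ℕ∣._∣_ (≡.sym p≡2) (≡.sym (≡.trans t≡2s (double s))) (ℕ∣.m∣m*n s)

    -- X^p is a square root of -1, so m = 4t, and the odd prime p, which divides m, divides t.
    prime-above-odd : ¬ p ≡ 2 → p ℕ∣.∣ m → Y ℤ.^ p ≈ₘ -[1+ 0 ] → PrimeAbove
    prime-above-odd p≢2 p∣m Y^p≈-1 with ∣m {X ℤ.^ p} (^≉0 p X≉0) (K.trans (≈⇒≈ₘ (≡.trans (≡.sym (^-distribʳ-* X X p)) (cong (ℤ._^ p) X*X≡Y))) Y^p≈-1)
    ... | t , m≡4t = m , t , q-prime , ∤x⇒> q∤x , p∣half p∣2t , m≡4t
      where
      p∣half : ∀ {s} → p ℕ∣.∣ s ℕ.+ s → p ℕ∣.∣ s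
      p∣half {s} p∣2s with euclidsLemma 2 s p-prime (≡.subst (p ℕ∣.∣_) (double s) p∣2s)
      ... | inj₂ p∣s = p∣s
      ... | inj₁ p∣2 = contradiction (ℕP.≤-antisym (ℕ∣.∣⇒≤ p∣2) 2≤p) p≢2
      p∣2t : p ℕ∣.∣ t ℕ.+ t
      p∣2t = p∣half (≡.subst (p ℕ∣.∣_) m≡4t p∣m)

  prime-above : PrimeAbove
  prime-above with p ℕP.≟ 2
  ... | yes p≡2 = from-divisor (prime-divisor _ (∣geometric∣≥2 {p} {u} 2≤p 3≤∣u∣))
    where
    -- For p = 2 the sum is 1 + u. The fourth power x⁴ ≡ -1 gives x order 8 modulo q, whereas x²
    -- would only yield 4 | q - 1.
    u = Y ℤ.* Y
    3≤∣u∣ : 3 ℕ.≤ ∣ u ∣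
    3≤∣u∣ = ℕP.≤-trans (ℕP.*-mono-≤ 3≤x*x (ℕP.≤-trans (ℕ.s≤s ℕ.z≤n) 3≤x*x)) (ℕP.≤-reflexive (≡.sym (ℤP.abs-* Y Y)))
    from-divisor : (∃ λ q → Prime q × q ℕ∣.∣ ∣ geometric p u ∣) → PrimeAbove
    from-divisor (zero  , q-prime , _)   = contradiction q-prime ¬prime[0]
    from-divisor (suc m , q-prime , q∣G) = conclude (∣geometric⇒ {m} {p} {u} {x} q-prime 1≤p q∣G X≈0⇒u≈0 p∣x)
      where
      open Residues m q-prime
      X≈0⇒u≈0 : X ≈ₘ + 0 → u ≈ₘ + 0
      X≈0⇒u≈0 X≈0 = K.trans (K.*-congʳ {Y} (X≈0⇒Y≈0 q-prime X≈0)) (K.zeroˡ Y)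
      conclude : ¬ suc m ℕ∣.∣ x × u ℤ.^ p ≈ₘ + 1 × ¬ u ≈ₘ + 1 × ¬ u ≈ₘ + 0 → PrimeAbove
      conclude (q∤x , u^p≈1 , u≉1 , _) = prime-above-2 q-prime q∤x p≡2 u≈-1
        where
        u^2≈1 : u ℤ.^ 2 ≈ₘ + 1
        u^2≈1 = ≡.subst (λ n → u ℤ.^ n ≈ₘ + 1) p≡2 u^p≈1
        u≈-1 : u ≈ₘ -[1+ 0 ]
        u≈-1 = [ (λ e → contradiction (-≈0⇒≈ e) u≉1) , -≈0⇒≈ ]′
          (*-≈0 (K.trans (≈⇒≈ₘ (solve 1 (λ u → (u :- con (+ 1)) :* (u :- con -[1+ 0 ]) := u :* (u :* con (+ 1)) :- con (+ 1)) ≡.refl u)) (≈⇒-≈0 u^2≈1)))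
          where open ℤS.+-*-Solver
  ... | no  p≢2 = from-divisor (prime-divisor _ (∣geometric∣≥2 {p} {u} 2≤p 3≤∣u∣))
    where
    -- The sign matters: as p is odd, u^p = 1 becomes (x^p)² = -1, so the order p of u and a square
    -- root of -1 come from the same congruence.
    u = ℤ.- Y
    3≤∣u∣ : 3 ℕ.≤ ∣ u ∣
    3≤∣u∣ = ℕP.≤-trans 3≤x*x (ℕP.≤-reflexive (≡.sym (ℤP.∣-i∣≡∣i∣ Y)))
    odd : ∃ λ e → p ≡ suc (e ℕ.+ e)
    odd with halve p
    ... | e , inj₂ p≡ = e , p≡
    ... | e , inj₁ p≡ with prime⇒irreducible p-prime (ℕ∣.divides e (≡.trans p≡ (≡.trans (double e) (ℕP.*-comm 2 e))))
    ...   | inj₂ 2≡p = contradiction (≡.sym 2≡p) p≢2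
    neg-^p : ∀ y → (ℤ.- y) ℤ.^ p ≡ ℤ.- (y ℤ.^ p)
    neg-^p y with odd
    ... | e , p≡ = begin
      (ℤ.- y) ℤ.^ p                             ≡⟨ cong ((ℤ.- y) ℤ.^_) p≡ ⟩
      ℤ.- y ℤ.* (ℤ.- y) ℤ.^ (e ℕ.+ e)           ≡⟨ cong (ℤ.- y ℤ.*_) (^-double (ℤ.- y) e) ⟩
      ℤ.- y ℤ.* (ℤ.- y ℤ.* ℤ.- y) ℤ.^ e
        ≡⟨ cong (λ w → ℤ.- y ℤ.* w ℤ.^ e) (solve 1 (λ y → (:- y) :* (:- y) := y :* y) ≡.refl y) ⟩
      ℤ.- y ℤ.* (y ℤ.* y) ℤ.^ e                 ≡⟨ cong (ℤ.- y ℤ.*_) (^-double y e) ⟨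
      ℤ.- y ℤ.* y ℤ.^ (e ℕ.+ e)                 ≡⟨ ℤP.neg-distribˡ-* y (y ℤ.^ (e ℕ.+ e)) ⟨
      ℤ.- (y ℤ.^ suc (e ℕ.+ e))                 ≡⟨ cong (λ n → ℤ.- (y ℤ.^ n)) p≡ ⟨
      ℤ.- (y ℤ.^ p)                             ∎
      where
      open ≡-Reasoning
      open ℤS.+-*-Solver
    from-divisor : (∃ λ q → Prime q × q ℕ∣.∣ ∣ geometric p u ∣) → PrimeAbove
    from-divisor (zero  , q-prime , _)   = contradiction q-prime ¬prime[0]
    from-divisor (suc m , q-prime , q∣G) = conclude (∣geometric⇒ {m} {p} {u} {x} q-prime 1≤p q∣G (λ X≈0 → K.-‿cong (X≈0⇒Y≈0 q-prime X≈0)) p∣x)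
      where
      open Residues m q-prime
      conclude : ¬ suc m ℕ∣.∣ x × u ℤ.^ p ≈ₘ + 1 × ¬ u ≈ₘ + 1 × ¬ u ≈ₘ + 0 → PrimeAbove
      conclude (q∤x , u^p≈1 , u≉1 , u≉0) = prime-above-odd q-prime q∤x p≢2 (Orders.prime-order m q-prime p-prime u≉0 u^p≈1 u≉1) Y^p≈-1
        where
        Y^p≈-1 : Y ℤ.^ p ≈ₘ -[1+ 0 ]
        Y^p≈-1 = K.trans (≈⇒≈ₘ (≡.trans (≡.sym (ℤP.neg-involutive (Y ℤ.^ p))) (cong ℤ.-_ (≡.sym (neg-^p Y))))) (K.-‿cong u^p≈1)

-- The monoid ring of ⟨2,3⟩ inside the polynomial ring.

fieldRing : HeytingField 0ℓ 0ℓ 0ℓ → CommutativeRing 0ℓ 0ℓ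
fieldRing F = HeytingCommutativeRing.commutativeRing (HeytingField.heytingCommutativeRing F)

2≤⟨2,3⟩ : ∀ k → ∃ _∈⟨2,3⟩
2≤⟨2,3⟩ k = 2 ℕ.+ k , 2+n∈⟨2,3⟩ k

1∉⟨2,3⟩ : ¬ 1 ∈⟨2,3⟩
1∉⟨2,3⟩ (suc a , b , ())
1∉⟨2,3⟩ (zero , suc b , ())

-- F[X; ⟨2,3⟩] is identified with the dense polynomials without linear term.
module DensePolynomial (F : HeytingField 0ℓ 0ℓ 0ℓ) where

  open MonoidRing F ⟨2,3⟩
  open CommutativeRing (fieldRing F) hiding (zero; refl)
  private
    module R = CommutativeRing (fieldRing F)
    module M = CommutativeMonoid ⟨2,3⟩
    module L = PolynomialProperties (fieldRing F)
    module P = CommutativeRing L.polynomialRing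
    module PS = NatSolver P.commutativeSemiring
  open L using (coeff; monomial; shift; at; _∷-cong_)

  toDense : Poly → L.Poly
  toDense []            = []
  toDense ((a , α) ∷ f) = monomial a (proj₁ α) L.+ₚ toDense f

  private
    fromDense≥2 : ℕ → L.Poly → Poly
    fromDense≥2 k []      = []
    fromDense≥2 k (a ∷ f) = (a , 2≤⟨2,3⟩ k) ∷ fromDense≥2 (suc k) f

  -- The coefficient at X is dropped, so that `toDense` recovers f only if f has no linear term.
  -- Zero coefficients are kept; the relation `drop-0` absorbs them.
  fromDense : L.Poly → Poly
  fromDense f = (coeff f 0 , M.ε) ∷ fromDense≥2 0 (drop 2 f)

  private
    monomial-cong : ∀ {a b m n} → a ≈ b → m ≡ n → monomial a m L.≈ₚ monomial b n
    monomial-cong {m = m} a≈b ≡.refl = L.shift-cong m (a≈b ∷-cong P.refl)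

    shift-+ : ∀ k f g → shift k f L.+ₚ shift k g L.≈ₚ shift k (f L.+ₚ g)
    shift-+ zero    f g = P.refl
    shift-+ (suc k) f g = +-identityʳ 0# ∷-cong shift-+ k f g

    shift-shift : ∀ m n f → shift m (shift n f) ≡ shift (m ℕ.+ n) f
    shift-shift zero    n f = ≡.refl
    shift-shift (suc m) n f = cong (0# ∷_) (shift-shift m n f)

    ·-shift : ∀ a n f → a L.· shift n f L.≈ₚ shift n (a L.· f)
    ·-shift a zero    f = P.refl
    ·-shift a (suc n) f = zeroʳ a ∷-cong ·-shift a n f

    monomial-0 : ∀ n → monomial 0# n L.≈ₚ []
    monomial-0 zero    = L.∷≈[] (R.refl) P.refl
    monomial-0 (suc n) = L.∷≈[] (R.refl) (monomial-0 n)

    monomial-monomial : ∀ a m b n → monomial a m L.*ₚ monomial b n L.≈ₚ monomial (a * b) (m ℕ.+ n)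
    monomial-monomial a m b n = P.trans (L.monomial-* a m (monomial b n))
      (P.trans (L.shift-cong m (·-shift a n (b ∷ []))) (P.reflexive (shift-shift m n (a * b ∷ []))))

  toDense-cong : ∀ {f g} → f ≈ₚ g → toDense f L.≈ₚ toDense g
  toDense-cong ≈-refl          = P.refl
  toDense-cong (≈-sym e)       = P.sym (toDense-cong e)
  toDense-cong (≈-trans d e)   = P.trans (toDense-cong d) (toDense-cong e)
  toDense-cong (prep a≈b α≡β e) = P.+-cong (monomial-cong a≈b α≡β) (toDense-cong e)
  toDense-cong (swap {a , α} {b , β} {f}) =
    PS.solve 3 (λ x y z → x PS.:+ (y PS.:+ z) PS.:= y PS.:+ (x PS.:+ z)) P.refl (monomial a (proj₁ α)) (monomial b (proj₁ β)) (toDense f)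
  toDense-cong (collect {a} {b} {α} {f}) =
    P.trans (P.sym (P.+-assoc (monomial a (proj₁ α)) (monomial b (proj₁ α)) (toDense f)))
            (P.+-congʳ {toDense f} (shift-+ (proj₁ α) (a ∷ []) (b ∷ [])))
  toDense-cong (drop-0 {α} {f}) = P.+-congʳ {toDense f} (monomial-0 (proj₁ α))

  toDense-++ : ∀ f g → toDense (f ++ g) L.≈ₚ toDense f L.+ₚ toDense g
  toDense-++ []            g = P.refl
  toDense-++ ((a , α) ∷ f) g = P.trans (P.+-congˡ {monomial a (proj₁ α)} (toDense-++ f g))
    (P.sym (P.+-assoc (monomial a (proj₁ α)) (toDense f) (toDense g)))

  toDense-* : ∀ f g → toDense (f *ₚ g) L.≈ₚ toDense f L.*ₚ toDense g
  toDense-* []            g = P.refl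
  toDense-* ((a , α) ∷ f) g = P.trans (toDense-++ (map (λ (b , β) → a * b , α M.∙ β) g) (f *ₚ g))
    (P.trans (P.+-cong (toDense-term g) (toDense-* f g)) (P.sym (P.distribʳ (toDense g) (monomial a (proj₁ α)) (toDense f))))
    where
    toDense-term : ∀ g → toDense (map (λ (b , β) → a * b , α M.∙ β) g) L.≈ₚ monomial a (proj₁ α) L.*ₚ toDense g
    toDense-term []            = P.sym (P.zeroʳ (monomial a (proj₁ α)))
    toDense-term ((b , β) ∷ g) = P.trans
      (P.+-cong (P.sym (monomial-monomial a (proj₁ α) b (proj₁ β))) (toDense-term g))
      (P.sym (P.distribˡ (monomial a (proj₁ α)) (monomial b (proj₁ β)) (toDense g)))

  private
    toDense-fromDense≥2 : ∀ k f → toDense (fromDense≥2 k f) L.≈ₚ shift (2 ℕ.+ k) f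
    toDense-fromDense≥2 k []      = P.sym (shift-[] (2 ℕ.+ k))
      where
      shift-[] : ∀ k → shift k [] L.≈ₚ []
      shift-[] zero    = P.refl
      shift-[] (suc k) = L.∷≈[] (R.refl) (shift-[] k)
    toDense-fromDense≥2 k (a ∷ f) = P.trans (P.+-congˡ {monomial a (2 ℕ.+ k)} (P.trans (toDense-fromDense≥2 (suc k) f) (P.reflexive (shift-suc (2 ℕ.+ k)))))
      (P.trans (shift-+ (2 ℕ.+ k) (a ∷ []) (0# ∷ f)) (L.shift-cong (2 ℕ.+ k) (+-identityʳ a ∷-cong P.refl)))
      where
      shift-suc : ∀ k → shift (suc k) f ≡ shift k (0# ∷ f)
      shift-suc zero    = ≡.refl
      shift-suc (suc k) = cong (0# ∷_) (shift-suc k)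

  toDense-fromDense : ∀ {f} → coeff f 1 ≈ 0# → toDense (fromDense f) L.≈ₚ f
  toDense-fromDense {f} f₁≈0 = P.trans (P.+-congˡ {coeff f 0 ∷ []} (toDense-fromDense≥2 0 (drop 2 f))) (split f f₁≈0)
    where
    split : ∀ f → coeff f 1 ≈ 0# → (coeff f 0 ∷ []) L.+ₚ shift 2 (drop 2 f) L.≈ₚ f
    split []          _    = L.∷≈[] (+-identityʳ 0#) (L.∷≈[] R.refl P.refl)
    split (a ∷ [])    _    = +-identityʳ a ∷-cong L.∷≈[] R.refl P.refl
    split (a ∷ b ∷ f) b≈0  = +-identityʳ a ∷-cong R.sym b≈0 ∷-cong P.refl

  private
    prep-0 : ∀ {a α f} → a ≈ 0# → (a , α) ∷ f ≈ₚ f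
    prep-0 {α = α} a≈0 = ≈-trans (prep a≈0 (M.refl {α}) ≈-refl) (drop-0 {α})

    fromDense≥2-cong : ∀ k {f g} → f L.≈ₚ g → fromDense≥2 k f ≈ₚ fromDense≥2 k g
    fromDense≥2-cong k {[]}    {[]}    e = ≈-refl
    fromDense≥2-cong k {[]}    {b ∷ g} e = ≈-sym (≈-trans (prep-0 (R.sym (at e 0))) (≈-sym (fromDense≥2-cong (suc k) (P.sym (L.tail≈[] (P.sym e))))))
    fromDense≥2-cong k {a ∷ f} {[]}    e = ≈-trans (prep-0 (at e 0)) (fromDense≥2-cong (suc k) (L.tail≈[] e))
    fromDense≥2-cong k {a ∷ f} {b ∷ g} e = prep (at e 0) (M.refl {2≤⟨2,3⟩ k}) (fromDense≥2-cong (suc k) (L.tail≈ e))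

    coeff-drop : ∀ k f i → coeff (drop k f) i ≡ coeff f (k ℕ.+ i)
    coeff-drop zero    f       i = ≡.refl
    coeff-drop (suc k) []      i = ≡.refl
    coeff-drop (suc k) (a ∷ f) i = coeff-drop k f i

    drop-cong : ∀ k {f g} → f L.≈ₚ g → drop k f L.≈ₚ drop k g
    drop-cong k {f} {g} e .at i =
      trans (reflexive (coeff-drop k f i)) (trans (at e (k ℕ.+ i)) (reflexive (≡.sym (coeff-drop k g i))))

    insert≥2 : ∀ j a k f α → proj₁ α ≡ 2 ℕ.+ (j ℕ.+ k) →
               fromDense≥2 j (monomial a k L.+ₚ f) ≈ₚ (a , α) ∷ fromDense≥2 j f
    insert≥2 j a zero    []      α e = prep R.refl (≡.sym (≡.trans e (cong (2 ℕ.+_) (ℕP.+-identityʳ j)))) ≈-refl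
    insert≥2 j a zero    (b ∷ f) α e = ≈-trans (≈-sym collect) (prep R.refl (≡.sym (≡.trans e (cong (2 ℕ.+_) (ℕP.+-identityʳ j)))) ≈-refl)
    insert≥2 j a (suc k) []      α e = ≈-trans drop-0
      (≈-trans (fromDense≥2-cong (suc j) (P.sym (P.+-identityʳ (monomial a k)))) (insert≥2 (suc j) a k [] α (≡.trans e (cong (2 ℕ.+_) (ℕP.+-suc j k)))))
    insert≥2 j a (suc k) (b ∷ f) α e = ≈-trans (prep (+-identityˡ b) (M.refl {2≤⟨2,3⟩ j}) (insert≥2 (suc j) a k f α (≡.trans e (cong (2 ℕ.+_) (ℕP.+-suc j k))))) swap

    -- The inductive step of `fromDense-toDense`: a term travels past the lower exponents by `swap`
    -- and merges with its equal by `collect`. Exponent 1 cannot occur, as it is not in the monoid.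
    insert : ∀ a α f → fromDense (monomial a (proj₁ α) L.+ₚ f) ≈ₚ (a , α) ∷ fromDense f
    insert a (0 , α) []          = ≈-trans (prep (R.sym (+-identityʳ a)) (M.refl {M.ε}) ≈-refl) (≈-trans (≈-sym collect) (prep R.refl ≡.refl ≈-refl))
    insert a (0 , α) (b ∷ f)     = ≈-trans (≈-sym collect) (prep R.refl ≡.refl ≈-refl)
    insert a (1 , α) f           = contradiction α 1∉⟨2,3⟩
    insert a (suc (suc k) , α) []          = ≈-trans (prep R.refl (M.refl {M.ε})
      (≈-trans (fromDense≥2-cong 0 (P.sym (P.+-identityʳ (monomial a k)))) (insert≥2 0 a k [] (suc (suc k) , α) ≡.refl))) swap
    insert a (suc (suc k) , α) (b ∷ [])    = ≈-trans (prep (+-identityˡ b) (M.refl {M.ε})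
      (≈-trans (fromDense≥2-cong 0 (P.sym (P.+-identityʳ (monomial a k)))) (insert≥2 0 a k [] (suc (suc k) , α) ≡.refl))) swap
    insert a (suc (suc k) , α) (b ∷ c ∷ f) = ≈-trans (prep (+-identityˡ b) (M.refl {M.ε}) (insert≥2 0 a k f (suc (suc k) , α) ≡.refl)) swap

  fromDense-cong : ∀ {f g} → f L.≈ₚ g → fromDense f ≈ₚ fromDense g
  fromDense-cong e = prep (at e 0) (M.refl {M.ε}) (fromDense≥2-cong 0 (drop-cong 2 e))

  fromDense-toDense : ∀ f → fromDense (toDense f) ≈ₚ f
  fromDense-toDense []            = drop-0
  fromDense-toDense ((a , α) ∷ f) = ≈-trans (insert a α (toDense f)) (prep R.refl (M.refl {α}) (fromDense-toDense f))

  -- `fromDense` is a left inverse that respects equality. Equations in the monoid ring, whose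
  -- equality is generated by rules, can therefore be checked on coefficients.
  toDense-injective : ∀ {f g} → toDense f L.≈ₚ toDense g → f ≈ₚ g
  toDense-injective {f} {g} e = ≈-trans (≈-sym (fromDense-toDense f)) (≈-trans (fromDense-cong e) (fromDense-toDense g))

-- Reducibility of X^q - 1 over 𝔽_p and the conclusion.

module _ (p : ℕ) (p-prime : Prime p) where

  private
    R : CommutativeRing 0ℓ 0ℓ
    R = fieldRing (𝔽 p p-prime)
    module R = CommutativeRing R

  open import Algebra.Definitions.RawMonoid R.+-rawMonoid using () renaming (_×_ to _⊛_)

  private
    ⊛-1 : ∀ n → n ⊛ (+ 1) ≡ + n
    ⊛-1 zero    = ≡.refl
    ⊛-1 (suc n) = cong (λ t → + 1 ℤ.+ t) (⊛-1 n)

    ∣⇒≈0 : ∀ {x} → + p ℤ∣.∣ x → x R.≈ + 0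
    ∣⇒≈0 {x} = ≡.subst (+ p ℤ∣.∣_) (≡.sym (ℤP.+-identityʳ x))

    ≈0⇒∣ : ∀ {x} → x R.≈ + 0 → + p ℤ∣.∣ x
    ≈0⇒∣ {x} = ≡.subst (+ p ℤ∣.∣_) (ℤP.+-identityʳ x)

    1≉0 : ¬ + 1 R.≈ + 0
    1≉0 p∣1 = ¬prime[1] (≡.subst Prime (ℕ∣.∣1⇒≡1 (ℤ∣.∣⇒∣ᵤ p∣1)) p-prime)

    invertible : ∀ x → ¬ x R.≈ + 0 → ∃ λ y → y ℤ.* x R.≈ + 1
    invertible x x≉0 with HeytingField.#⇒invertible (𝔽 p p-prime) {x} {+ 0} x≉0
    ... | y , yx≈1 , _ = y , ≡.subst (λ t → y ℤ.* t R.≈ + 1) (ℤP.+-identityʳ x) yx≈1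

  𝔽-discrete : IsDiscreteField R
  𝔽-discrete = record
    { ≈0? = λ x → + p ℤ∣.∣? (x ℤ.- + 0) ; ≉0⇒invertible = invertible ; 1≉0 = 1≉0 }

  𝔽-characteristic : HasCharacteristic (𝔽 p p-prime) p
  𝔽-characteristic n = mk⇔
    (λ n≈0 → ℤ∣.∣⇒∣ᵤ (≡.subst (+ p ℤ∣.∣_) (⊛-1 n) (≈0⇒∣ n≈0)))
    (λ p∣n → ∣⇒≈0 (≡.subst (+ p ℤ∣.∣_) (≡.sym (⊛-1 n)) (ℤ∣.∣ᵤ⇒∣ p∣n)))

  module _ (k : ℕ) (q-prime : Prime (2 ℕ.+ k)) (n : ℕ) (p∣n : p ℕ∣.∣ n)
           (m≡4n : suc k ≡ (n ℕ.+ n) ℕ.+ (n ℕ.+ n)) where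

    private
      q = 2 ℕ.+ k

      1≤2n : 1 ℕ.≤ n ℕ.+ n
      1≤2n = ℕP.n≢0⇒n>0 λ 2n≡0 → contradiction (≡.trans m≡4n (cong₂ ℕ._+_ 2n≡0 2n≡0)) λ ()

      open QuadraticCharacter (suc k) q-prime n (n ℕ.+ n) 1≤2n ≡.refl m≡4n
      open CyclicConvolution R (suc k)
      open Factorisation R 𝔽-discrete k
      open DensePolynomial (𝔽 p p-prime)
      module L = FieldPolynomial R 𝔽-discrete
      module Z/q = Residues (suc k) q-prime
      open MonoidRing (𝔽 p p-prime) ⟨2,3⟩

      p∣m : p ℕ∣.∣ suc k
      p∣m = ≡.subst (p ℕ∣.∣_) (≡.sym m≡4n) (ℕ∣.∣m∣n⇒∣m+n (ℕ∣.∣m∣n⇒∣m+n p∣n p∣n) (ℕ∣.∣m∣n⇒∣m+n p∣n p∣n))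

      q≈1 : q ⊛ (+ 1) R.≈ + 1
      q≈1 = ≡.subst (R._≈ + 1) (≡.sym (⊛-1 q)) (ℤ∣.∣ᵤ⇒∣ p∣m)

      N : L.Poly
      N = ⟦ ν ⟧

      coeff-N : ∀ {i} → i ℕ.< q → L.coeff N i ≡ ν (+ i)
      coeff-N = coeff-applyUpTo (λ i → ν (+ i))

      ν-periodic : Periodic ν
      ν-periodic x = R.reflexive (ν-cong {x ℤ.+ + q} {x} (Z/q.multiple (+ 1) (cong (λ t → x ℤ.+ t) (≡.sym (ℤP.*-identityˡ (+ q))))))

      -- The integer identity `∑νν` has right-hand side n(1 + δ), and p divides n.
      ν+ν*ν≈0 : ∀ x → ν x ℤ.+ convolve q (λ i → ν (+ i)) ν x R.≈ + 0
      ν+ν*ν≈0 x = ∣⇒≈0 (≡.subst (+ p ℤ∣.∣_) (≡.sym (∑νν′ x)) (ℤ∣.∣m⇒∣m*n (+ 1 ℤ.+ δ x) (ℤ∣.∣ᵤ⇒∣ {+ p} {+ n} p∣n)))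
        where
        ∑νν′ : ∀ x → ν x ℤ.+ convolve q (λ i → ν (+ i)) ν x ≡ + n ℤ.* (+ 1 ℤ.+ δ x)
        ∑νν′ x = ≡.trans (cong (λ t → ν x ℤ.+ t) (≡.sym (S≡sum (λ y → ν y ℤ.* ν (x ℤ.- y))))) (∑νν x)

      N≉0 : ¬ N L.≈ₚ []
      N≉0 N≈0 with nonresidue
      ... | b , b<q , χb≡-1 = 1≉0 (≡.subst (R._≈ + 0) (≡.trans (coeff-N b<q) (ν-nonresidue χb≡-1)) (L.at N≈0 b))

      T : Poly
      T = X^ q , prime∈⟨2,3⟩ q-prime -𝟏

      toDense-unit : ∀ {f} → f ∣ RawSemiring.1# rawSemiring → L.Unit (toDense f)
      toDense-unit {f} f∣1 = toDense c , P.trans (P.sym (toDense-* c f)) (toDense-cong cf≈1)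
        where
        open _∣ʳ_ f∣1 renaming (quotient to c; equality to cf≈1)
        module P = CommutativeRing L.polynomialRing

    private
      module P = CommutativeRing L.polynomialRing

      LinearFreeFactors : Set
      LinearFreeFactors = ∃₂ λ f g → f L.*ₚ g L.≈ₚ L.X^ q -𝟏 ×
        (L.coeff f 1 R.≈ + 0 × L.coeff g 1 R.≈ + 0) × ¬ L.Unit f × ¬ L.Unit g

      factors : LinearFreeFactors
      factors = linear-free-factors q≈1 N (Deg<-applyUpTo (λ i → ν (+ i)) q)
        (R.reflexive (≡.trans (coeff-N (ℕ.s≤s ℕ.z≤n)) ν-0)) (R.reflexive (≡.trans (coeff-N (ℕ.s≤s (ℕ.s≤s ℕ.z≤n))) ν-1))
        N≉0 (⟦⟧-idempotent ν ν-periodic ν+ν*ν≈0) (L.bézout N (L.X^ q -𝟏))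

      unit-cong : ∀ {f g} → f L.≈ₚ g → L.Unit f → L.Unit g
      unit-cong f≈g (c , cf≈1) = c , P.trans (P.*-congˡ {c} (P.sym f≈g)) cf≈1

      -- Units need to be transported in one direction only: a unit of the monoid ring stays a unit
      -- in the larger ring of all polynomials, where neither f nor g is one.
      factors⇒¬irreducible : LinearFreeFactors → ¬ Irreducible T
      factors⇒¬irreducible (f , g , fg≈Z , (f₁≈0 , g₁≈0) , f-nonunit , g-nonunit) irreducible =
        [ (λ u → f-nonunit (unit-cong (toDense-fromDense {f} f₁≈0) (toDense-unit u)))
        , (λ u → g-nonunit (unit-cong (toDense-fromDense {g} g₁≈0) (toDense-unit u))) ]′
        (Divisibility.Irreducible.split-∣1 irreducible {fromDense f} {fromDense g} (toDense-injective {T} {fromDense f *ₚ fromDense g} T≈fg))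
        where
        T≈fg : toDense T L.≈ₚ toDense (fromDense f *ₚ fromDense g)
        T≈fg = P.trans (P.sym fg≈Z) (P.sym (P.trans (toDense-* (fromDense f) (fromDense g))
          (P.*-cong (toDense-fromDense {f} f₁≈0) (toDense-fromDense {g} g₁≈0))))

    X^q-1-reducible : Reducible T
    X^q-1-reducible = (λ T∣1 → Z-nonunit (toDense-unit T∣1)) , factors⇒¬irreducible factors

-- From n x = q follows n = 1 or n = q, and the second case would need x = 1, which is missing from
-- the monoid.
prime-exponent-indivisible : ∀ {q} (q-prime : Prime q) → Indivisible ⟨2,3⟩ (q , prime∈⟨2,3⟩ q-prime)
prime-exponent-indivisible {q} q-prime n 0<n (x , x∈) nx≡q = by-cases (prime⇒irreducible q-prime (ℕ∣.divides x (≡.trans (≡.sym nx≡q′) (ℕP.*-comm n x))))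
  where
  open Multiples (CommutativeMonoid.rawMonoid ⟨2,3⟩) using () renaming (_×_ to _·_)
  value : ∀ n → proj₁ (n · (x , x∈)) ≡ n ℕ.* x
  value zero    = ≡.refl
  value (suc n) = cong (x ℕ.+_) (value n)
  nx≡q′ : n ℕ.* x ≡ q
  nx≡q′ = ≡.trans (≡.sym (value n)) nx≡q
  by-cases : n ≡ 1 ⊎ n ≡ q → n ≡ 1 × x ≡ q
  by-cases (inj₁ ≡.refl) = ≡.refl , ≡.trans (≡.sym (ℕP.*-identityˡ x)) nx≡q′
  by-cases (inj₂ n≡q)  = contradiction (≡.subst _∈⟨2,3⟩ x≡1 x∈) 1∉⟨2,3⟩
    where
    x≡1 : x ≡ 1
    x≡1 = ℕP.*-cancelˡ-≡ x 1 n {{ℕ.>-nonZero 0<n}} (≡.trans nx≡q′ (≡.trans (≡.sym n≡q) (≡.sym (ℕP.*-identityʳ n))))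

E-infinite : ∀ p (p-prime : Prime p) → Infinite (E p p-prime)
E-infinite p p-prime B with prime-above p p-prime B
... | zero  , n , q-prime , _ , _ = contradiction q-prime ¬prime[1]
... | suc k , n , q-prime , B<q , p∣n , m≡4n = 2 ℕ.+ k , B<q , q-prime , X^q-1-reducible p p-prime k q-prime n p∣n m≡4n

open import Data.Nat using (_*_)

corollary1 : (∀ (p : ℕ) → Prime p → ∀ (n : ℕ) → SquareFree n →
    GRH (RadicalField n p) × GRH (RadicalField (4 * n) p)) →
    (∀ (p : ℕ) (p-prime : Prime p) → Infinite (E p p-prime)) ×
    (∀ (p : ℕ) → Prime p → ¬ IsMatsuda ⟨2,3⟩ p)
corollary1 _ = E-infinite , λ p p-prime matsuda →
  -- The bound 0 serves only to pick one q in E(p); its exponent is indivisible, so the Matsuda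
  -- property over the field with p elements is contradicted.
  let q , _ , q-prime , _ , ¬irreducible = E-infinite p p-prime 0
  in ¬irreducible (IsMatsuda.irreducible matsuda (𝔽 p p-prime) (𝔽-characteristic p p-prime)
       (q , prime∈⟨2,3⟩ q-prime) (prime-exponent-indivisible q-prime))
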